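{- Let $n\ge1$ and let $K_{2n+1}^{(3)}$ be the complete 3-graph on vertex set $[2n+1]$ (all 3-subsets are triples), with the canonical triple orientation $\omega_0$. Let $\mathcal T^+$ and $\mathcal T^-$ be the sets of spanning trees $T$ of $K_{2n+1}^{(3)}$ with $\mathrm{sgn}(T,\omega_0)=+1$ and $-1$ respectively. Then $|\mathcal T^+|-|\mathcal T^-|=(2n+1)^{n-1}$.
   Context: A cycle in a 3-graph is a sequence $a_0,t_1,a_1,\dots,t_\ell,a_\ell=a_0$, $\ell\ge2$, of distinct vertices $a_0,\dots,a_{\ell-1}$ and distinct triples with $a_{i-1},a_i\in t_i$. A spanning tree is a set of triples containing no cycle, covering all vertices, and connected via paths of triples. A triple orientation $\omega$ on vertex set $[2n+1]$ assigns each triple $t=\{i,j,k\}$ a 3-cycle $\sigma(t,\omega)\in\{(i\,j\,k),(j\,i\,k)\}$; the canonical orientation $\omega_0$ assigns to $\{i,j,k\}$ with $i<j<k$ the cycle $(i\,j\,k)$. For a spanning tree $T$, $\prod_{t\in T}\sigma(t,\omega)$ is a $(2n+1)$-cycle $(s(1)\,s(2)\cdots s(2n+1))$ for some permutation $s$ of $[2n+1]$, and $\mathrm{sgn}(T,\omega)$ is the sign of $s$ (independent of the order of factors and of how the cycle is written). -}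

module Defs where

open import Data.Nat as ℕ using (ℕ; zero; suc; _+_; _*_; _%_; _≤_)
open import Data.Fin as Fin using (Fin; toℕ; _<_)
open import Data.Fin.Properties using (_≟_)
open import Data.Nat.DivMod using (m%n<n)
open import Data.Vec using (Vec; lookup)
open import Data.List using (List; []; _∷_; allFin; concatMap; foldr; filter; length)
open import Data.Bool using (Bool; true; false; if_then_else_)
open import Data.Product using (Σ; ∃; _×_; _,_)
open import Data.Sum using (_⊎_)
open import Data.Integer as ℤ using (ℤ)
open import Relation.Binary.PropositionalEquality using (_≡_)
open import Relation.Nullary using (¬_)
open import Relation.Nullary.Decidable using (⌊_⌋)
open import Function using (_∘_; id)
open import Function.Definitions using (Injective)

-- Vertex set [N] is modelled by Fin N (vertex m+1 of the paper ↔ m : Fin N).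

record Triple (N : ℕ) : Set where
  constructor triple
  field
    i j k : Fin N
    i<j   : i < j
    j<k   : j < k
open Triple public

_∈ᵥ_ : ∀ {N} → Fin N → Triple N → Set
v ∈ᵥ t = v ≡ i t ⊎ v ≡ j t ⊎ v ≡ k t

-- A set of triples of K_N^(3): a Boolean array indexed by (i,j,k);
-- entry (i,j,k) true means the triple {i,j,k} belongs to the set.
TSet : ℕ → Set
TSet N = Vec (Vec (Vec Bool N) N) N

entry : ∀ {N} → TSet N → Fin N → Fin N → Fin N → Bool
entry S a b c = lookup (lookup (lookup S a) b) c

-- Well-formedness: only entries with a < b < c may be true, so that
-- sets of triples correspond bijectively to well-formed arrays.
WellFormed : ∀ {N} → TSet N → Set
WellFormed {N} S = ∀ (a b c : Fin N) → entry S a b c ≡ true → a < b × b < c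

_∈ₜ_ : ∀ {N} → Triple N → TSet N → Set
t ∈ₜ S = entry S (i t) (j t) (k t) ≡ true

next : ∀ {ℓ} → Fin (suc ℓ) → Fin (suc ℓ)
next {ℓ} r = Fin.fromℕ< (m%n<n (suc (toℕ r)) (suc ℓ))

-- A cycle in S of length ℓ = m+2 ≥ 2: distinct vertices a_0..a_{ℓ-1},
-- distinct triples t_1..t_ℓ of S with a_{r-1}, a_r ∈ t_r (indices mod ℓ).
-- Here t r plays the role of t_{r+1}, containing a r and a (r+1 mod ℓ).
record Cycle {N : ℕ} (S : TSet N) : Set where
  field
    m    : ℕ
    a    : Fin (suc (suc m)) → Fin N
    t    : Fin (suc (suc m)) → Triple N
    a-inj : Injective _≡_ _≡_ a
    t-inj : Injective _≡_ _≡_ t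
    t∈S  : ∀ r → t r ∈ₜ S
    a∈t  : ∀ r → a r ∈ᵥ t r
    a'∈t : ∀ r → a (next r) ∈ᵥ t r

data Walk {N : ℕ} (S : TSet N) : Fin N → Fin N → Set where
  here : ∀ {u} → Walk S u u
  step : ∀ {u w v} (t : Triple N) → t ∈ₜ S → u ∈ᵥ t → w ∈ᵥ t → Walk S w v → Walk S u v

record SpanningTree {N : ℕ} (S : TSet N) : Set where
  field
    wellFormed : WellFormed S
    acyclic    : ¬ Cycle S
    covering   : ∀ (v : Fin N) → ∃ λ (t : Triple N) → t ∈ₜ S × v ∈ᵥ t
    connected  : ∀ (u v : Fin N) → Walk S u v

-- The 3-cycle (a b c): a ↦ b, b ↦ c, c ↦ a, fixing everything else.
-- For {i<j<k} this is σ({i,j,k}, ω₀) = (i j k).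
cyc3 : ∀ {N} → Fin N → Fin N → Fin N → Fin N → Fin N
cyc3 a b c v =
  if ⌊ v ≟ a ⌋ then b else
  if ⌊ v ≟ b ⌋ then c else
  if ⌊ v ≟ c ⌋ then a else v

allTriples : (N : ℕ) → List (Fin N × Fin N × Fin N)
allTriples N = concatMap (λ a → concatMap (λ b → Data.List.map (λ c → (a , b , c)) (allFin N)) (allFin N)) (allFin N)

prodω₀ : ∀ {N} → TSet N → Fin N → Fin N
prodω₀ {N} S = foldr mulStep id (allTriples N)
  where
  mulStep : Fin N × Fin N × Fin N → (Fin N → Fin N) → (Fin N → Fin N)
  mulStep (a , b , c) f = if entry S a b c then cyc3 a b c ∘ f else f

iter : ∀ {A : Set} → (A → A) → ℕ → A → A
iter f zero    x = x
iter f (suc r) x = f (iter f r x)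

-- For a spanning tree the product π is an N-cycle; writing it as
-- (s(0) s(1) ... s(N-1)) starting from vertex 0 gives s(r) = π^r(0).
cycleWord : ∀ {N} → TSet (suc N) → Fin (suc N) → Fin (suc N)
cycleWord S r = iter (prodω₀ S) (toℕ r) Fin.zero

inversions : ∀ {N} → (Fin N → Fin N) → ℕ
inversions {N} s = length (filter (λ p → Fin._<?_ (s (Data.Product.proj₂ p)) (s (Data.Product.proj₁ p)))
                     (filter (λ p → Fin._<?_ (Data.Product.proj₁ p) (Data.Product.proj₂ p))
                       (concatMap (λ x → Data.List.map (λ y → (x , y)) (allFin N)) (allFin N))))

signPerm : ∀ {N} → (Fin N → Fin N) → ℤ
signPerm s = if ⌊ (inversions s % 2) ℕ.≟ 0 ⌋ then ℤ.+ 1 else ℤ.-[1+ 0 ]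

sgnω₀ : ∀ {N} → TSet (suc N) → ℤ
sgnω₀ S = signPerm (cycleWord S)

{-# OPTIONS --safe #-}
module Submission where

-- Work in the exterior algebra over ℤ with one generator θ_v per vertex and θ_0 = 0, and give the triple
-- a < b < c the element q = (θ_b - θ_a)(θ_c - θ_b) = θ_a θ_b + θ_b θ_c + θ_c θ_a.  For an odd word put
-- E(w₀ … w_k) = (θ_{w₁} - θ_{w₀}) ⋯ (θ_{w_k} - θ_{w_{k-1}}).  It is invariant under rotation, kills θ_u - θ_v for
-- all letters u, v, and satisfies E(aA bB cC) = q(a,b,c) E(aA) E(bB) E(cC).  Composing with the 3-cycle (a b c)
-- merges three cycles of a permutation in exactly this way, so the product of the q's over a set T of n
-- triples is E of the (2n+1)-cycle, that is sgn(T) times the top monomial, when T is a spanning tree; a cycle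
-- in T makes the product vanish.  The signed count is therefore the top coefficient of the n-th elementary
-- symmetric function of the q's, which is (Σ q)ⁿ / n! since the q's commute and square to zero.  Finally
-- Σ q = N ε - 2 u v with N = 2n+1, u = Σ θ_j, v = Σ j θ_j and ε = Σ_{i<j} θ_i θ_j, and the top coefficients of εⁿ and
-- εⁿ⁻¹ u v are both n!, which gives N ^ (n-1).

open import Defs
open import Data.Nat using (ℕ; suc; _*_; _^_; _∸_; _≤_)
open import Data.Integer using (ℤ; +_; -[1+_]; _-_)
open import Data.List using (List; length)
open import Data.List.Membership.Propositional using (_∈_)
open import Data.List.Relation.Unary.Unique.Propositional using (Unique)
open import Data.Product using (_×_)
open import Function.Bundles using (_⇔_)
open import Relation.Binary.PropositionalEquality using (_≡_)
open import Data.Bool using (Bool; true; false; if_then_else_; not; _xor_)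
import Data.Bool.Properties as BoolP
open import Data.Empty using (⊥; ⊥-elim)
open import Data.Fin as Fin using (Fin; zero; suc; toℕ)
import Data.Fin.Properties as FinP
import Data.Integer as ℤ
import Data.Integer.Properties as ℤP
open import Data.Integer.Tactic.RingSolver using (solve-∀)
open import Data.List as List using ([]; _∷_; [_]; _++_; _∷ʳ_; concat; concatMap; foldr; filter; tabulate; allFin; lookup; cartesianProduct; cartesianProductWith)
import Data.List.Properties as ListP
open import Data.List.Membership.Propositional using (_∉_; find; lose)
open import Data.List.Membership.Propositional.Properties
  using (∈-∃++; ∈-++⁻; ∈-++⁺ˡ; ∈-++⁺ʳ; ∈-concat⁻′; ∈-concat⁺′; ∈-allFin; ∈-lookup; ∈-map⁺; ∈-filter⁺; ∈-filter⁻;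
         ∈-cartesianProductWith⁺; ∈-cartesianProduct⁺)
open import Data.List.Relation.Binary.Permutation.Propositional as Perm using (_↭_; ↭-sym; ↭-refl; ↭-trans; ↭-reflexive)
import Data.List.Relation.Binary.Permutation.Propositional.Properties as PermP
import Data.List.Relation.Binary.Permutation.Setoid.Properties as PermS
open import Data.List.Relation.Unary.All as All using (All; []; _∷_)
import Data.List.Relation.Unary.All.Properties as AllP
open import Data.List.Relation.Unary.AllPairs using ([]; _∷_)
open import Data.List.Relation.Unary.Any using (here; there; any?)
import Data.List.Relation.Unary.Unique.Propositional.Properties as UniqueP
open import Data.Nat as ℕ using (zero; _!; _%_)
open import Data.Nat.DivMod using (m%n<n; m%n%n≡m%n; %-distribˡ-+; n%n≡0; m<n⇒m%n≡m; [m+n]%n≡m%n)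
import Data.Nat.Properties as ℕP
open import Data.Product using (_,_; proj₁; proj₂; ∃)
open import Data.Sum using (_⊎_; inj₁; inj₂; [_,_]′)
open import Data.Unit using (⊤; tt)
open import Data.Vec as Vec using (Vec; []; _∷_)
open import Function using (_∘_; id)
open import Function.Bundles using (Equivalence)
open import Function.Definitions using (Injective)
open import Relation.Binary.PropositionalEquality hiding ([_])
open import Relation.Nullary using (¬_; ¬?; Dec; yes; no; does)
open import Relation.Nullary.Decidable using (⌊_⌋; map′; _×-dec_; dec-true)
open ≡-Reasoning

-- This is a Pfaffian analogue of the matrix-tree theorem: the top coefficient of (Σ q)ⁿ / n! is the
-- Pfaffian of the skew form Σ q once vertex 0 has been struck out. Setting θ_0 = 0 makes 2n, the
-- degree of a product of n of the q's, the top degree. Odd length is what lets E live on cycles.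
-- Rotating an odd word moves one difference past an odd number of others, and the sign this costs
-- is repaid by reversing the difference that closes the cycle. Odd words also give even elements,
-- so the values of separate cycles commute. The obstacle is that `sgnω₀` comes from composing
-- permutations, whereas the count is algebraic. One invariant, `Forest`, ties the two together: the
-- same words record the cycles of the permutation, the components of the triple set and the value
-- of the product. Each merge loses two words, so n triples without a cycle leave exactly one. The
-- trees are given by arbitrary lists, so the sum runs over all Boolean arrays instead. An array
-- that encodes no triple set has weight zero, and a grading keeps track of the number of triples.
-- Coefficients are integers, so n! is cancelled at the end rather than inverted.

-- The exterior algebra over ℤ, one generator at a time

module ExteriorAlgebra where

  infix 5 _+θ_

  -- In a +θ b the θ is the generator with index 0; those of a and b are shifted up by one.
  data Λ : ℕ → Set where
    scalar : ℤ → Λ zero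
    _+θ_   : ∀ {m} → Λ m → Λ m → Λ (suc m)

  constant : ∀ {m} → ℤ → Λ m
  constant {zero}  z = scalar z
  constant {suc m} z = constant z +θ constant (+ 0)

  infixl 6 _⊕_
  infixl 7 _⊛_
  infix  8 ⊝_

  _⊕_ : ∀ {m} → Λ m → Λ m → Λ m
  scalar x ⊕ scalar y = scalar (x ℤ.+ y)
  (a +θ b) ⊕ (c +θ d) = a ⊕ c +θ b ⊕ d

  ⊝_ : ∀ {m} → Λ m → Λ m
  ⊝ scalar x = scalar (ℤ.- x)
  ⊝ (a +θ b) = ⊝ a +θ ⊝ b

  -- The grade involution: x θ = θ (bar x) for the generator θ with index 0.
  bar : ∀ {m} → Λ m → Λ m
  bar (scalar x) = scalar x
  bar (a +θ b)   = bar a +θ ⊝ bar b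

  -- The generator is read as standing on the left, a + θ b. Moving θ to the front past `a` turns
  -- `a` into `bar a`, and the term with θ twice is gone because θ squares to zero.
  _⊛_ : ∀ {m} → Λ m → Λ m → Λ m
  scalar x ⊛ scalar y = scalar (x ℤ.* y)
  (a +θ b) ⊛ (c +θ d) = a ⊛ c +θ b ⊛ c ⊕ bar a ⊛ d

  ⊕-assoc : ∀ {m} (x y z : Λ m) → (x ⊕ y) ⊕ z ≡ x ⊕ (y ⊕ z)
  ⊕-assoc (scalar x) (scalar y) (scalar z) = cong scalar (ℤP.+-assoc x y z)
  ⊕-assoc (a +θ b) (c +θ d) (e +θ f) = cong₂ _+θ_ (⊕-assoc a c e) (⊕-assoc b d f)

  ⊕-comm : ∀ {m} (x y : Λ m) → x ⊕ y ≡ y ⊕ x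
  ⊕-comm (scalar x) (scalar y) = cong scalar (ℤP.+-comm x y)
  ⊕-comm (a +θ b) (c +θ d) = cong₂ _+θ_ (⊕-comm a c) (⊕-comm b d)

  ⊕-identityˡ : ∀ {m} (x : Λ m) → constant (+ 0) ⊕ x ≡ x
  ⊕-identityˡ (scalar x) = cong scalar (ℤP.+-identityˡ x)
  ⊕-identityˡ (a +θ b) = cong₂ _+θ_ (⊕-identityˡ a) (⊕-identityˡ b)

  ⊕-identityʳ : ∀ {m} (x : Λ m) → x ⊕ constant (+ 0) ≡ x
  ⊕-identityʳ x = trans (⊕-comm x _) (⊕-identityˡ x)

  ⊝-inverseˡ : ∀ {m} (x : Λ m) → ⊝ x ⊕ x ≡ constant (+ 0)
  ⊝-inverseˡ (scalar x) = cong scalar (ℤP.+-inverseˡ x)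
  ⊝-inverseˡ (a +θ b) = cong₂ _+θ_ (⊝-inverseˡ a) (⊝-inverseˡ b)

  ⊝-inverseʳ : ∀ {m} (x : Λ m) → x ⊕ ⊝ x ≡ constant (+ 0)
  ⊝-inverseʳ x = trans (⊕-comm x _) (⊝-inverseˡ x)

  ⊕-interchange : ∀ {m} (w x y z : Λ m) → (w ⊕ x) ⊕ (y ⊕ z) ≡ (w ⊕ y) ⊕ (x ⊕ z)
  ⊕-interchange w x y z = begin
    (w ⊕ x) ⊕ (y ⊕ z)  ≡⟨ ⊕-assoc w x _ ⟩
    w ⊕ (x ⊕ (y ⊕ z))  ≡⟨ cong (w ⊕_) (⊕-assoc x y z) ⟨
    w ⊕ ((x ⊕ y) ⊕ z)  ≡⟨ cong (λ t → w ⊕ (t ⊕ z)) (⊕-comm x y) ⟩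
    w ⊕ ((y ⊕ x) ⊕ z)  ≡⟨ cong (w ⊕_) (⊕-assoc y x z) ⟩
    w ⊕ (y ⊕ (x ⊕ z))  ≡⟨ ⊕-assoc w y _ ⟨
    (w ⊕ y) ⊕ (x ⊕ z)  ∎

  ⊝-distrib : ∀ {m} (x y : Λ m) → ⊝ (x ⊕ y) ≡ ⊝ x ⊕ ⊝ y
  ⊝-distrib (scalar x) (scalar y) = cong scalar (ℤP.neg-distrib-+ x y)
  ⊝-distrib (a +θ b) (c +θ d) = cong₂ _+θ_ (⊝-distrib a c) (⊝-distrib b d)

  bar-⊝ : ∀ {m} (x : Λ m) → bar (⊝ x) ≡ ⊝ bar x
  bar-⊝ (scalar x) = refl
  bar-⊝ (a +θ b) = cong₂ _+θ_ (bar-⊝ a) (cong ⊝_ (bar-⊝ b))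

  bar-⊕ : ∀ {m} (x y : Λ m) → bar (x ⊕ y) ≡ bar x ⊕ bar y
  bar-⊕ (scalar x) (scalar y) = refl
  bar-⊕ (a +θ b) (c +θ d) = cong₂ _+θ_ (bar-⊕ a c) (trans (cong ⊝_ (bar-⊕ b d)) (⊝-distrib (bar b) (bar d)))

  ⊝-involutive : ∀ {m} (x : Λ m) → ⊝ ⊝ x ≡ x
  ⊝-involutive (scalar x) = cong scalar (ℤP.neg-involutive x)
  ⊝-involutive (a +θ b) = cong₂ _+θ_ (⊝-involutive a) (⊝-involutive b)

  bar-involutive : ∀ {m} (x : Λ m) → bar (bar x) ≡ x
  bar-involutive (scalar x) = refl
  bar-involutive (a +θ b) = cong₂ _+θ_ (bar-involutive a)
    (trans (cong ⊝_ (trans (bar-⊝ (bar b)) (cong ⊝_ (bar-involutive b)))) (⊝-involutive b))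

  ⊛-distribˡ : ∀ {m} (x y z : Λ m) → x ⊛ (y ⊕ z) ≡ x ⊛ y ⊕ x ⊛ z
  ⊛-distribˡ (scalar x) (scalar y) (scalar z) = cong scalar (ℤP.*-distribˡ-+ x y z)
  ⊛-distribˡ (a +θ b) (c +θ d) (e +θ f) = cong₂ _+θ_ (⊛-distribˡ a c e)
    (trans (cong₂ _⊕_ (⊛-distribˡ b c e) (⊛-distribˡ (bar a) d f)) (⊕-interchange _ _ _ _))

  ⊛-distribʳ : ∀ {m} (x y z : Λ m) → (y ⊕ z) ⊛ x ≡ y ⊛ x ⊕ z ⊛ x
  ⊛-distribʳ (scalar x) (scalar y) (scalar z) = cong scalar (ℤP.*-distribʳ-+ x y z)
  ⊛-distribʳ (a +θ b) (c +θ d) (e +θ f) = cong₂ _+θ_ (⊛-distribʳ a c e)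
    (trans (cong₂ _⊕_ (⊛-distribʳ a d f) (trans (cong (_⊛ b) (bar-⊕ c e)) (⊛-distribʳ b (bar c) (bar e))))
           (⊕-interchange _ _ _ _))

  ⊝-⊛ˡ : ∀ {m} (x y : Λ m) → ⊝ x ⊛ y ≡ ⊝ (x ⊛ y)
  ⊝-⊛ˡ (scalar x) (scalar y) = cong scalar (sym (ℤP.neg-distribˡ-* x y))
  ⊝-⊛ˡ (a +θ b) (c +θ d) = cong₂ _+θ_ (⊝-⊛ˡ a c)
    (trans (cong₂ _⊕_ (⊝-⊛ˡ b c) (trans (cong (_⊛ d) (bar-⊝ a)) (⊝-⊛ˡ (bar a) d))) (sym (⊝-distrib _ _)))

  ⊝-⊛ʳ : ∀ {m} (x y : Λ m) → x ⊛ ⊝ y ≡ ⊝ (x ⊛ y)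
  ⊝-⊛ʳ (scalar x) (scalar y) = cong scalar (sym (ℤP.neg-distribʳ-* x y))
  ⊝-⊛ʳ (a +θ b) (c +θ d) = cong₂ _+θ_ (⊝-⊛ʳ a c)
    (trans (cong₂ _⊕_ (⊝-⊛ʳ b c) (⊝-⊛ʳ (bar a) d)) (sym (⊝-distrib _ _)))

  bar-⊛ : ∀ {m} (x y : Λ m) → bar (x ⊛ y) ≡ bar x ⊛ bar y
  bar-⊛ (scalar x) (scalar y) = refl
  bar-⊛ (a +θ b) (c +θ d) = cong₂ _+θ_ (bar-⊛ a c) (begin
    ⊝ bar (b ⊛ c ⊕ bar a ⊛ d)
      ≡⟨ cong ⊝_ (bar-⊕ (b ⊛ c) _) ⟩
    ⊝ (bar (b ⊛ c) ⊕ bar (bar a ⊛ d))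
      ≡⟨ ⊝-distrib _ _ ⟩
    ⊝ bar (b ⊛ c) ⊕ ⊝ bar (bar a ⊛ d)
      ≡⟨ cong₂ (λ u v → ⊝ u ⊕ ⊝ v) (bar-⊛ b c) (bar-⊛ (bar a) d) ⟩
    ⊝ (bar b ⊛ bar c) ⊕ ⊝ (bar (bar a) ⊛ bar d)
      ≡⟨ cong₂ _⊕_ (⊝-⊛ˡ (bar b) (bar c)) (⊝-⊛ʳ (bar (bar a)) (bar d)) ⟨
    ⊝ bar b ⊛ bar c ⊕ bar (bar a) ⊛ ⊝ bar d ∎)

  ⊛-assoc : ∀ {m} (x y z : Λ m) → (x ⊛ y) ⊛ z ≡ x ⊛ (y ⊛ z)
  ⊛-assoc (scalar x) (scalar y) (scalar z) = cong scalar (ℤP.*-assoc x y z)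
  ⊛-assoc (a +θ b) (c +θ d) (e +θ f) = cong₂ _+θ_ (⊛-assoc a c e) (begin
    (b ⊛ c ⊕ bar a ⊛ d) ⊛ e ⊕ bar (a ⊛ c) ⊛ f
      ≡⟨ cong₂ _⊕_ (⊛-distribʳ e (b ⊛ c) (bar a ⊛ d)) (cong (_⊛ f) (bar-⊛ a c)) ⟩
    (b ⊛ c ⊛ e ⊕ bar a ⊛ d ⊛ e) ⊕ bar a ⊛ bar c ⊛ f
      ≡⟨ cong₂ _⊕_ (cong₂ _⊕_ (⊛-assoc b c e) (⊛-assoc (bar a) d e)) (⊛-assoc (bar a) (bar c) f) ⟩
    (b ⊛ (c ⊛ e) ⊕ bar a ⊛ (d ⊛ e)) ⊕ bar a ⊛ (bar c ⊛ f)
      ≡⟨ ⊕-assoc (b ⊛ (c ⊛ e)) _ _ ⟩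
    b ⊛ (c ⊛ e) ⊕ (bar a ⊛ (d ⊛ e) ⊕ bar a ⊛ (bar c ⊛ f))
      ≡⟨ cong (b ⊛ (c ⊛ e) ⊕_) (⊛-distribˡ (bar a) (d ⊛ e) (bar c ⊛ f)) ⟨
    b ⊛ (c ⊛ e) ⊕ bar a ⊛ (d ⊛ e ⊕ bar c ⊛ f) ∎)

  ⊛-zeroˡ : ∀ {m} (x : Λ m) → constant (+ 0) ⊛ x ≡ constant (+ 0)
  ⊛-zeroʳ : ∀ {m} (x : Λ m) → x ⊛ constant (+ 0) ≡ constant (+ 0)

  bar-constant : ∀ {m} z → bar (constant {m} z) ≡ constant z
  ⊝-constant : ∀ {m} z → ⊝ constant {m} z ≡ constant (ℤ.- z)
  ⊝-constant {zero} z = refl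
  ⊝-constant {suc m} z = cong₂ _+θ_ (⊝-constant z) (⊝-constant (+ 0))
  bar-constant {zero} z = refl
  bar-constant {suc m} z = cong₂ _+θ_ (bar-constant z) (trans (cong ⊝_ (bar-constant (+ 0))) (⊝-constant (+ 0)))

  ⊛-zeroˡ (scalar x) = cong scalar (ℤP.*-zeroˡ x)
  ⊛-zeroˡ (a +θ b) = cong₂ _+θ_ (⊛-zeroˡ a)
    (trans (cong₂ _⊕_ (⊛-zeroˡ a) (trans (cong (_⊛ b) (bar-constant (+ 0))) (⊛-zeroˡ b))) (⊕-identityˡ _))
  ⊛-zeroʳ (scalar x) = cong scalar (ℤP.*-zeroʳ x)
  ⊛-zeroʳ (a +θ b) = cong₂ _+θ_ (⊛-zeroʳ a)
    (trans (cong₂ _⊕_ (⊛-zeroʳ b) (⊛-zeroʳ (bar a))) (⊕-identityˡ _))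

  ⊛-identityˡ : ∀ {m} (x : Λ m) → constant (+ 1) ⊛ x ≡ x
  ⊛-identityˡ (scalar x) = cong scalar (ℤP.*-identityˡ x)
  ⊛-identityˡ (a +θ b) = cong₂ _+θ_ (⊛-identityˡ a)
    (trans (cong₂ _⊕_ (⊛-zeroˡ a) (trans (cong (_⊛ b) (bar-constant (+ 1))) (⊛-identityˡ b))) (⊕-identityˡ _))

  ⊛-identityʳ : ∀ {m} (x : Λ m) → x ⊛ constant (+ 1) ≡ x
  ⊛-identityʳ (scalar x) = cong scalar (ℤP.*-identityʳ x)
  ⊛-identityʳ (a +θ b) = cong₂ _+θ_ (⊛-identityʳ a)
    (trans (cong₂ _⊕_ (⊛-identityʳ b) (⊛-zeroʳ (bar a))) (⊕-identityʳ _))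

  constant-⊕ : ∀ {m} y z → constant {m} (y ℤ.+ z) ≡ constant y ⊕ constant z
  constant-⊕ {zero} y z = refl
  constant-⊕ {suc m} y z = cong₂ _+θ_ (constant-⊕ y z) (constant-⊕ (+ 0) (+ 0))

  constant-⊛ : ∀ {m} y z → constant {m} (y ℤ.* z) ≡ constant y ⊛ constant z
  constant-⊛ {zero} y z = refl
  constant-⊛ {suc m} y z = cong₂ _+θ_ (constant-⊛ y z)
    (sym (trans (cong₂ _⊕_ (⊛-zeroˡ _) (⊛-zeroʳ _)) (⊕-identityˡ _)))

  pattern 0ℤ = + 0
  pattern 1ℤ = + 1

  𝟘 𝟙 : ∀ {m} → Λ m
  𝟘 = constant 0ℤ
  𝟙 = constant 1ℤ

  -- Parity as an eigenvalue of the grade involution. Since ℤ has no 2-torsion, this says that only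
  -- even (respectively odd) degrees occur.
  Even Odd : ∀ {m} → Λ m → Set
  Even x = bar x ≡ x
  Odd  x = bar x ≡ ⊝ x

  ⊝-injective : ∀ {m} {x y : Λ m} → ⊝ x ≡ ⊝ y → x ≡ y
  ⊝-injective {x = x} {y} e = trans (sym (⊝-involutive x)) (trans (cong ⊝_ e) (⊝-involutive y))

  +θ-injectiveˡ : ∀ {m} {a b c d : Λ m} → (a +θ b) ≡ (c +θ d) → a ≡ c
  +θ-injectiveˡ refl = refl

  +θ-injectiveʳ : ∀ {m} {a b c d : Λ m} → (a +θ b) ≡ (c +θ d) → b ≡ d
  +θ-injectiveʳ refl = refl

  x≡-x⇒x≡0 : ∀ z → z ≡ ℤ.- z → z ≡ 0ℤ
  x≡-x⇒x≡0 (+ zero) e = refl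

  -- The coefficients are integers, so there is no 2-torsion. Through this, anticommutation forces
  -- the square of an odd element to vanish.
  x≡⊝x⇒x≡𝟘 : ∀ {m} (x : Λ m) → x ≡ ⊝ x → x ≡ 𝟘
  x≡⊝x⇒x≡𝟘 (scalar z) e = cong scalar (x≡-x⇒x≡0 z (scalar-injective e))
    where
    scalar-injective : ∀ {y z} → scalar y ≡ scalar z → y ≡ z
    scalar-injective refl = refl
  x≡⊝x⇒x≡𝟘 (a +θ b) e = cong₂ _+θ_ (x≡⊝x⇒x≡𝟘 a (+θ-injectiveˡ e)) (x≡⊝x⇒x≡𝟘 b (+θ-injectiveʳ e))

  -- A mutual induction: the component `b` of `a +θ b` has the opposite parity to the whole, so each
  -- of the two statements calls the other.
  even-comm : ∀ {m} (x y : Λ m) → Even x → x ⊛ y ≡ y ⊛ x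
  odd-comm  : ∀ {m} (x y : Λ m) → Odd x → x ⊛ y ≡ bar y ⊛ x

  even-comm (scalar x) (scalar y) _ = cong scalar (ℤP.*-comm x y)
  even-comm (a +θ b) (c +θ d) e = cong₂ _+θ_ (even-comm a c ea) (begin
    b ⊛ c ⊕ bar a ⊛ d  ≡⟨ cong₂ _⊕_ (odd-comm b c ob) (cong (_⊛ d) ea) ⟩
    bar c ⊛ b ⊕ a ⊛ d  ≡⟨ cong (bar c ⊛ b ⊕_) (even-comm a d ea) ⟩
    bar c ⊛ b ⊕ d ⊛ a  ≡⟨ ⊕-comm _ _ ⟩
    d ⊛ a ⊕ bar c ⊛ b  ∎)
    where
    ea = +θ-injectiveˡ e
    ob : Odd b
    ob = trans (sym (⊝-involutive _)) (cong ⊝_ (+θ-injectiveʳ e))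

  odd-comm x@(scalar _) y@(scalar _) o = trans (cong (_⊛ y) x≡𝟘)
    (trans (⊛-zeroˡ y) (trans (sym (⊛-zeroʳ y)) (cong (y ⊛_) (sym x≡𝟘))))
    where
    x≡𝟘 : x ≡ 𝟘
    x≡𝟘 = x≡⊝x⇒x≡𝟘 x o
  odd-comm (a +θ b) (c +θ d) o = cong₂ _+θ_ (odd-comm a c oa) (begin
    b ⊛ c ⊕ bar a ⊛ d               ≡⟨ cong₂ _⊕_ (even-comm b c eb) (trans (cong (_⊛ d) oa) (⊝-⊛ˡ a d)) ⟩
    c ⊛ b ⊕ ⊝ (a ⊛ d)               ≡⟨ cong (λ t → c ⊛ b ⊕ ⊝ t) (odd-comm a d oa) ⟩
    c ⊛ b ⊕ ⊝ (bar d ⊛ a)           ≡⟨ ⊕-comm _ _ ⟩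
    ⊝ (bar d ⊛ a) ⊕ c ⊛ b           ≡⟨ cong₂ _⊕_ (sym (⊝-⊛ˡ (bar d) a)) (cong (_⊛ b) (sym (bar-involutive c))) ⟩
    ⊝ bar d ⊛ a ⊕ bar (bar c) ⊛ b   ∎)
    where
    oa = +θ-injectiveˡ o
    eb : Even b
    eb = ⊝-injective (+θ-injectiveʳ o)

  odd-square : ∀ {m} (x : Λ m) → Odd x → x ⊛ x ≡ 𝟘
  odd-square x o = x≡⊝x⇒x≡𝟘 _ (begin
    x ⊛ x      ≡⟨ odd-comm x x o ⟩
    bar x ⊛ x  ≡⟨ cong (_⊛ x) o ⟩
    ⊝ x ⊛ x    ≡⟨ ⊝-⊛ˡ x x ⟩
    ⊝ (x ⊛ x)  ∎)

  odd-anticomm : ∀ {m} (x y : Λ m) → Odd x → Odd y → x ⊛ y ≡ ⊝ (y ⊛ x)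
  odd-anticomm x y ox oy = trans (odd-comm x y ox) (trans (cong (_⊛ x) oy) (⊝-⊛ˡ y x))

  odd-⊕ : ∀ {m} {x y : Λ m} → Odd x → Odd y → Odd (x ⊕ y)
  odd-⊕ {x = x} {y} ox oy = trans (bar-⊕ x y) (trans (cong₂ _⊕_ ox oy) (sym (⊝-distrib x y)))

  odd-⊝ : ∀ {m} {x : Λ m} → Odd x → Odd (⊝ x)
  odd-⊝ {x = x} ox = trans (bar-⊝ x) (cong ⊝_ ox)

  even-⊕ : ∀ {m} {x y : Λ m} → Even x → Even y → Even (x ⊕ y)
  even-⊕ {x = x} {y} ex ey = trans (bar-⊕ x y) (cong₂ _⊕_ ex ey)

  even-⊛ : ∀ {m} {x y : Λ m} → Even x → Even y → Even (x ⊛ y)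
  even-⊛ {x = x} {y} ex ey = trans (bar-⊛ x y) (cong₂ _⊛_ ex ey)

  odd-⊛-odd : ∀ {m} {x y : Λ m} → Odd x → Odd y → Even (x ⊛ y)
  odd-⊛-odd {x = x} {y} ox oy = begin
    bar (x ⊛ y)    ≡⟨ bar-⊛ x y ⟩
    bar x ⊛ bar y  ≡⟨ cong₂ _⊛_ ox oy ⟩
    ⊝ x ⊛ ⊝ y      ≡⟨ ⊝-⊛ˡ x (⊝ y) ⟩
    ⊝ (x ⊛ ⊝ y)    ≡⟨ cong ⊝_ (⊝-⊛ʳ x y) ⟩
    ⊝ ⊝ (x ⊛ y)    ≡⟨ ⊝-involutive _ ⟩
    x ⊛ y          ∎

  odd-⊛-even : ∀ {m} {x y : Λ m} → Odd x → Even y → Odd (x ⊛ y)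
  odd-⊛-even {x = x} {y} ox ey = trans (bar-⊛ x y) (trans (cong₂ _⊛_ ox ey) (⊝-⊛ˡ x y))

  -- The Berezin integral, normalised to 1 on the product of all generators in increasing order.
  top : ∀ {m} → Λ m → ℤ
  top (scalar z) = z
  top (a +θ b)   = top b

  top-⊕ : ∀ {m} (x y : Λ m) → top (x ⊕ y) ≡ top x ℤ.+ top y
  top-⊕ (scalar x) (scalar y) = refl
  top-⊕ (a +θ b) (c +θ d) = top-⊕ b d

  constant-⊛-+θ : ∀ {m} z (a b : Λ m) → constant z ⊛ (a +θ b) ≡ (constant z ⊛ a +θ constant z ⊛ b)
  constant-⊛-+θ z a b = cong (constant z ⊛ a +θ_)
    (trans (cong₂ _⊕_ (⊛-zeroˡ a) (cong (_⊛ b) (bar-constant z))) (⊕-identityˡ _))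

  top-constant-⊛ : ∀ {m} z (x : Λ m) → top (constant z ⊛ x) ≡ z ℤ.* top x
  top-constant-⊛ z (scalar x) = refl
  top-constant-⊛ z (a +θ b) = trans (cong top (constant-⊛-+θ z a b)) (top-constant-⊛ z b)

open ExteriorAlgebra

-- Linear identities by reflection

module LinearNormaliser where

  infixl 6 _:+_
  infix  8 :-_
  data Lin (k : ℕ) : Set where
    var  : Fin k → Lin k
    _:+_ : Lin k → Lin k → Lin k
    :-_  : Lin k → Lin k
    :0   : Lin k

  unit : ∀ {k} → Fin k → Vec ℤ k
  unit {suc k} Fin.zero    = 1ℤ ∷ Vec.replicate k 0ℤ
  unit {suc k} (Fin.suc x) = 0ℤ ∷ unit x

  coefficients : ∀ {k} → Lin k → Vec ℤ k
  coefficients (var x)  = unit x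
  coefficients (s :+ t) = Vec.zipWith ℤ._+_ (coefficients s) (coefficients t)
  coefficients (:- t)   = Vec.map ℤ.-_ (coefficients t)
  coefficients :0       = Vec.replicate _ 0ℤ

  module _ {m : ℕ} where

    eval : ∀ {k} → Vec (Λ m) k → Lin k → Λ m
    eval ρ (var x)  = Vec.lookup ρ x
    eval ρ (s :+ t) = eval ρ s ⊕ eval ρ t
    eval ρ (:- t)   = ⊝ eval ρ t
    eval ρ :0       = 𝟘

    combination : ∀ {k} → Vec ℤ k → Vec (Λ m) k → Λ m
    combination []       []      = 𝟘
    combination (c ∷ cs) (x ∷ ρ) = constant c ⊛ x ⊕ combination cs ρ

    combination-0 : ∀ {k} (ρ : Vec (Λ m) k) → combination (Vec.replicate k 0ℤ) ρ ≡ 𝟘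
    combination-0 []      = refl
    combination-0 (x ∷ ρ) = trans (cong₂ _⊕_ (⊛-zeroˡ x) (combination-0 ρ)) (⊕-identityˡ 𝟘)

    combination-unit : ∀ {k} (x : Fin k) (ρ : Vec (Λ m) k) → combination (unit x) ρ ≡ Vec.lookup ρ x
    combination-unit Fin.zero    (x ∷ ρ) = trans (cong₂ _⊕_ (⊛-identityˡ x) (combination-0 ρ)) (⊕-identityʳ x)
    combination-unit (Fin.suc i) (x ∷ ρ) = trans (cong₂ _⊕_ (⊛-zeroˡ x) (combination-unit i ρ)) (⊕-identityˡ _)

    combination-+ : ∀ {k} (bs cs : Vec ℤ k) (ρ : Vec (Λ m) k) →
      combination (Vec.zipWith ℤ._+_ bs cs) ρ ≡ combination bs ρ ⊕ combination cs ρ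
    combination-+ []       []       []      = sym (⊕-identityˡ 𝟘)
    combination-+ (b ∷ bs) (c ∷ cs) (x ∷ ρ) = begin
      constant (b ℤ.+ c) ⊛ x ⊕ combination (Vec.zipWith ℤ._+_ bs cs) ρ
        ≡⟨ cong₂ _⊕_ (trans (cong (_⊛ x) (constant-⊕ b c)) (⊛-distribʳ x (constant b) (constant c))) (combination-+ bs cs ρ) ⟩
      (constant b ⊛ x ⊕ constant c ⊛ x) ⊕ (combination bs ρ ⊕ combination cs ρ)
        ≡⟨ ⊕-interchange (constant b ⊛ x) (constant c ⊛ x) (combination bs ρ) (combination cs ρ) ⟩
      (constant b ⊛ x ⊕ combination bs ρ) ⊕ (constant c ⊛ x ⊕ combination cs ρ) ∎

    combination-neg : ∀ {k} (cs : Vec ℤ k) (ρ : Vec (Λ m) k) → combination (Vec.map ℤ.-_ cs) ρ ≡ ⊝ combination cs ρ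
    combination-neg []       []      = sym (⊝-constant 0ℤ)
    combination-neg (c ∷ cs) (x ∷ ρ) = trans
      (cong₂ _⊕_ (trans (cong (_⊛ x) (sym (⊝-constant c))) (⊝-⊛ˡ (constant c) x)) (combination-neg cs ρ))
      (sym (⊝-distrib (constant c ⊛ x) (combination cs ρ)))

    eval-coefficients : ∀ {k} (ρ : Vec (Λ m) k) (t : Lin k) → combination (coefficients t) ρ ≡ eval ρ t
    eval-coefficients ρ (var x)  = combination-unit x ρ
    eval-coefficients ρ (s :+ t) = trans (combination-+ (coefficients s) (coefficients t) ρ)
      (cong₂ _⊕_ (eval-coefficients ρ s) (eval-coefficients ρ t))
    eval-coefficients ρ (:- t)   = trans (combination-neg (coefficients t) ρ) (cong ⊝_ (eval-coefficients ρ t))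
    eval-coefficients ρ :0       = combination-0 ρ

    -- Products enter as opaque variables, and the last hypothesis compares closed integer vectors,
    -- so `refl` discharges it by computation.
    linear : ∀ {k} (ρ : Vec (Λ m) k) (s t : Lin k) → coefficients s ≡ coefficients t → eval ρ s ≡ eval ρ t
    linear ρ s t e = trans (sym (eval-coefficients ρ s)) (trans (cong (λ c → combination c ρ) e) (eval-coefficients ρ t))

  pattern v₀ = var Fin.zero
  pattern v₁ = var (Fin.suc Fin.zero)
  pattern v₂ = var (Fin.suc (Fin.suc Fin.zero))
  pattern v₃ = var (Fin.suc (Fin.suc (Fin.suc Fin.zero)))
  pattern v₄ = var (Fin.suc (Fin.suc (Fin.suc (Fin.suc Fin.zero))))
  pattern v₅ = var (Fin.suc (Fin.suc (Fin.suc (Fin.suc (Fin.suc Fin.zero)))))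

open LinearNormaliser

-- Powers of quadratic elements and their top coefficients

module Quadratic where

  constant-comm : ∀ {m} z (x : Λ m) → x ⊛ constant z ≡ constant z ⊛ x
  constant-comm z x = sym (even-comm (constant z) x (bar-constant z))

  constant-pull : ∀ {m} z (x y : Λ m) → x ⊛ (constant z ⊛ y) ≡ constant z ⊛ (x ⊛ y)
  constant-pull z x y = begin
    x ⊛ (constant z ⊛ y) ≡⟨ ⊛-assoc x (constant z) y ⟨
    x ⊛ constant z ⊛ y   ≡⟨ cong (_⊛ y) (constant-comm z x) ⟩
    constant z ⊛ x ⊛ y   ≡⟨ ⊛-assoc (constant z) x y ⟩
    constant z ⊛ (x ⊛ y) ∎

  constant-suc : ∀ {m} k (x : Λ m) → constant (+ suc k) ⊛ x ≡ x ⊕ constant (+ k) ⊛ x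
  constant-suc k x = begin
    constant (+ suc k) ⊛ x               ≡⟨ cong (_⊛ x) (constant-⊕ 1ℤ (+ k)) ⟩
    (𝟙 ⊕ constant (+ k)) ⊛ x             ≡⟨ ⊛-distribʳ x 𝟙 (constant (+ k)) ⟩
    𝟙 ⊛ x ⊕ constant (+ k) ⊛ x           ≡⟨ cong (_⊕ constant (+ k) ⊛ x) (⊛-identityˡ x) ⟩
    x ⊕ constant (+ k) ⊛ x               ∎

  infixr 9 _^Λ_
  _^Λ_ : ∀ {m} → Λ m → ℕ → Λ m
  x ^Λ zero  = 𝟙
  x ^Λ suc k = x ⊛ x ^Λ k

  even-^ : ∀ {m} (x : Λ m) k → Even x → Even (x ^Λ k)
  even-^ x zero    e = bar-constant 1ℤ
  even-^ x (suc k) e = even-⊛ e (even-^ x k e)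

  -- The factor k makes the truncated exponent harmless: at k = 0, where `x ^Λ (k ∸ 1)` is not the
  -- wanted power, both sides vanish.
  pow-suc : ∀ {m} (x : Λ m) k → constant (+ k) ⊛ (x ⊛ x ^Λ (k ℕ.∸ 1)) ≡ constant (+ k) ⊛ x ^Λ k
  pow-suc x zero    = trans (⊛-zeroˡ _) (sym (⊛-zeroˡ 𝟙))
  pow-suc x (suc k) = refl

  -- The second-order term of the binomial expansion is dropped because y ⊛ y vanishes.
  pow-⊕ : ∀ {m} (x y : Λ m) k → Even y → y ⊛ y ≡ 𝟘 →
    (x ⊕ y) ^Λ k ≡ x ^Λ k ⊕ constant (+ k) ⊛ (x ^Λ (k ℕ.∸ 1) ⊛ y)
  pow-⊕ x y zero    ey yy = sym (trans (cong (𝟙 ⊕_) (⊛-zeroˡ (𝟙 ⊛ y))) (⊕-identityʳ 𝟙))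
  pow-⊕ x y (suc k) ey yy = begin
    (x ⊕ y) ⊛ (x ⊕ y) ^Λ k
      ≡⟨ cong ((x ⊕ y) ⊛_) (pow-⊕ x y k ey yy) ⟩
    (x ⊕ y) ⊛ (X ⊕ c ⊛ (X′ ⊛ y))
      ≡⟨ trans (⊛-distribʳ _ x y) (cong₂ _⊕_ (⊛-distribˡ x _ _) (⊛-distribˡ y _ _)) ⟩
    (x ⊛ X ⊕ x ⊛ (c ⊛ (X′ ⊛ y))) ⊕ (y ⊛ X ⊕ y ⊛ (c ⊛ (X′ ⊛ y)))
      ≡⟨ cong₂ (λ s t → (x ⊛ X ⊕ s) ⊕ t) mixed (cong₂ _⊕_ (even-comm y X ey) second) ⟩
    (x ⊛ X ⊕ c ⊛ (X ⊛ y)) ⊕ (X ⊛ y ⊕ 𝟘)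
      ≡⟨ linear (x ⊛ X ∷ c ⊛ (X ⊛ y) ∷ X ⊛ y ∷ []) ((v₀ :+ v₁) :+ (v₂ :+ :0)) (v₀ :+ (v₂ :+ v₁)) refl ⟩
    x ⊛ X ⊕ (X ⊛ y ⊕ c ⊛ (X ⊛ y))
      ≡⟨ cong (x ⊛ X ⊕_) (constant-suc k (X ⊛ y)) ⟨
    x ⊛ X ⊕ constant (+ suc k) ⊛ (X ⊛ y) ∎
    where
    c  = constant (+ k)
    X  = x ^Λ k
    X′ = x ^Λ (k ℕ.∸ 1)
    mixed : x ⊛ (c ⊛ (X′ ⊛ y)) ≡ c ⊛ (X ⊛ y)
    mixed = begin
      x ⊛ (c ⊛ (X′ ⊛ y))  ≡⟨ constant-pull (+ k) x _ ⟩
      c ⊛ (x ⊛ (X′ ⊛ y))  ≡⟨ cong (c ⊛_) (⊛-assoc x X′ y) ⟨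
      c ⊛ (x ⊛ X′ ⊛ y)    ≡⟨ ⊛-assoc c (x ⊛ X′) y ⟨
      c ⊛ (x ⊛ X′) ⊛ y    ≡⟨ cong (_⊛ y) (pow-suc x k) ⟩
      c ⊛ X ⊛ y           ≡⟨ ⊛-assoc c X y ⟩
      c ⊛ (X ⊛ y)         ∎
    second : y ⊛ (c ⊛ (X′ ⊛ y)) ≡ 𝟘
    second = begin
      y ⊛ (c ⊛ (X′ ⊛ y))  ≡⟨ constant-pull (+ k) y _ ⟩
      c ⊛ (y ⊛ (X′ ⊛ y))  ≡⟨ cong (c ⊛_) (even-comm y _ ey) ⟩
      c ⊛ (X′ ⊛ y ⊛ y)    ≡⟨ cong (c ⊛_) (trans (⊛-assoc X′ y y) (cong (X′ ⊛_) yy)) ⟩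
      c ⊛ (X′ ⊛ 𝟘)        ≡⟨ trans (cong (c ⊛_) (⊛-zeroʳ X′)) (⊛-zeroʳ c) ⟩
      𝟘 ∎

  pow-constant : ∀ {m} z (x : Λ m) k → (constant z ⊛ x) ^Λ k ≡ constant (z ℤ.^ k) ⊛ x ^Λ k
  pow-constant z x zero    = sym (⊛-identityʳ 𝟙)
  pow-constant z x (suc k) = begin
    constant z ⊛ x ⊛ (constant z ⊛ x) ^Λ k          ≡⟨ cong (constant z ⊛ x ⊛_) (pow-constant z x k) ⟩
    constant z ⊛ x ⊛ (constant (z ℤ.^ k) ⊛ x ^Λ k)  ≡⟨ ⊛-assoc (constant z) x _ ⟩
    constant z ⊛ (x ⊛ (constant (z ℤ.^ k) ⊛ x ^Λ k)) ≡⟨ cong (constant z ⊛_) (constant-pull (z ℤ.^ k) x _) ⟩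
    constant z ⊛ (constant (z ℤ.^ k) ⊛ x ^Λ suc k)  ≡⟨ ⊛-assoc (constant z) _ _ ⟨
    constant z ⊛ constant (z ℤ.^ k) ⊛ x ^Λ suc k    ≡⟨ cong (_⊛ x ^Λ suc k) (constant-⊛ z (z ℤ.^ k)) ⟨
    constant (z ℤ.* z ℤ.^ k) ⊛ x ^Λ suc k           ∎

  sum : ∀ {m} → List (Λ m) → Λ m
  sum = List.foldr _⊕_ 𝟘

  esym : ∀ {m} → List (Λ m) → ℕ → Λ m
  esym []       zero    = 𝟙
  esym []       (suc k) = 𝟘
  esym (q ∷ qs) zero    = esym qs zero
  esym (q ∷ qs) (suc k) = esym qs (suc k) ⊕ q ⊛ esym qs k

  SquareZero : ∀ {m} → Λ m → Set
  SquareZero q = Even q × q ⊛ q ≡ 𝟘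

  esym-zero : ∀ {m} (qs : List (Λ m)) → esym qs zero ≡ 𝟙
  esym-zero []       = refl
  esym-zero (q ∷ qs) = esym-zero qs

  -- By `pow-⊕`, adding one square-zero element q to a sum s turns the power k+1 into s^(k+1) +
  -- (k+1) s^k q. After multiplication by (k+1)!, this is exactly the recursion that defines `esym`.
  !-esym : ∀ {m} (qs : List (Λ m)) → All SquareZero qs → ∀ k → constant (+ (k !)) ⊛ esym qs k ≡ sum qs ^Λ k
  !-esym []       []             zero    = ⊛-identityˡ 𝟙
  !-esym []       []             (suc k) = trans (⊛-zeroʳ _) (sym (⊛-zeroˡ _))
  !-esym (q ∷ qs) ((e , s) ∷ h) zero    = trans (⊛-identityˡ _) (esym-zero qs)
  !-esym (q ∷ qs) ((e , s) ∷ h) (suc k) = begin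
    constant (+ (suc k !)) ⊛ (esym qs (suc k) ⊕ q ⊛ esym qs k)
      ≡⟨ ⊛-distribˡ (constant (+ (suc k !))) _ _ ⟩
    constant (+ (suc k !)) ⊛ esym qs (suc k) ⊕ constant (+ (suc k !)) ⊛ (q ⊛ esym qs k)
      ≡⟨ cong₂ _⊕_ (!-esym qs h (suc k)) (cong (λ t → constant t ⊛ (q ⊛ esym qs k)) (ℤP.pos-* (suc k) (k !))) ⟩
    sum qs ^Λ suc k ⊕ constant (+ suc k ℤ.* + (k !)) ⊛ (q ⊛ esym qs k)
      ≡⟨ cong (λ t → sum qs ^Λ suc k ⊕ t ⊛ (q ⊛ esym qs k)) (constant-⊛ (+ suc k) (+ (k !))) ⟩
    sum qs ^Λ suc k ⊕ constant (+ suc k) ⊛ constant (+ (k !)) ⊛ (q ⊛ esym qs k)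
      ≡⟨ cong (sum qs ^Λ suc k ⊕_) (⊛-assoc (constant (+ suc k)) (constant (+ (k !))) (q ⊛ esym qs k)) ⟩
    sum qs ^Λ suc k ⊕ constant (+ suc k) ⊛ (constant (+ (k !)) ⊛ (q ⊛ esym qs k))
      ≡⟨ cong (λ t → sum qs ^Λ suc k ⊕ constant (+ suc k) ⊛ t) (constant-pull (+ (k !)) q (esym qs k)) ⟨
    sum qs ^Λ suc k ⊕ constant (+ suc k) ⊛ (q ⊛ (constant (+ (k !)) ⊛ esym qs k))
      ≡⟨ cong (λ t → sum qs ^Λ suc k ⊕ constant (+ suc k) ⊛ (q ⊛ t)) (!-esym qs h k) ⟩
    sum qs ^Λ suc k ⊕ constant (+ suc k) ⊛ (q ⊛ sum qs ^Λ k)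
      ≡⟨ cong (λ t → sum qs ^Λ suc k ⊕ constant (+ suc k) ⊛ t) (even-comm q _ e) ⟩
    sum qs ^Λ suc k ⊕ constant (+ suc k) ⊛ (sum qs ^Λ k ⊛ q)
      ≡⟨ pow-⊕ (sum qs) q (suc k) e s ⟨
    (sum qs ⊕ q) ^Λ suc k
      ≡⟨ cong (_^Λ suc k) (⊕-comm (sum qs) q) ⟩
    (q ⊕ sum qs) ^Λ suc k ∎

  ∑ : ∀ {m n} → (Fin n → Λ m) → Λ m
  ∑ {n = zero}  f = 𝟘
  ∑ {n = suc n} f = f zero ⊕ ∑ (f ∘ suc)

  ∑-cong : ∀ {m n} {f g : Fin n → Λ m} → (∀ x → f x ≡ g x) → ∑ f ≡ ∑ g
  ∑-cong {n = zero}  h = refl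
  ∑-cong {n = suc n} h = cong₂ _⊕_ (h zero) (∑-cong (h ∘ suc))

  ∑-𝟘 : ∀ {m} n → ∑ {m} {n} (λ _ → 𝟘) ≡ 𝟘
  ∑-𝟘 zero    = refl
  ∑-𝟘 (suc n) = trans (⊕-identityˡ _) (∑-𝟘 n)

  ∑-⊕ : ∀ {m n} (f g : Fin n → Λ m) → ∑ (λ x → f x ⊕ g x) ≡ ∑ f ⊕ ∑ g
  ∑-⊕ {n = zero}  f g = sym (⊕-identityˡ 𝟘)
  ∑-⊕ {n = suc n} f g = trans (cong (f zero ⊕ g zero ⊕_) (∑-⊕ (f ∘ suc) (g ∘ suc))) (⊕-interchange (f zero) (g zero) _ _)

  ∑-⊛ˡ : ∀ {m n} (x : Λ m) (f : Fin n → Λ m) → ∑ (λ i → x ⊛ f i) ≡ x ⊛ ∑ f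
  ∑-⊛ˡ {n = zero}  x f = sym (⊛-zeroʳ x)
  ∑-⊛ˡ {n = suc n} x f = trans (cong (x ⊛ f zero ⊕_) (∑-⊛ˡ x (f ∘ suc))) (sym (⊛-distribˡ x _ _))

  ∑-⊝ : ∀ {m n} (f : Fin n → Λ m) → ∑ (λ i → ⊝ f i) ≡ ⊝ ∑ f
  ∑-⊝ {n = zero}  f = sym (⊝-constant 0ℤ)
  ∑-⊝ {n = suc n} f = trans (cong (⊝ f zero ⊕_) (∑-⊝ (f ∘ suc))) (sym (⊝-distrib _ _))

  ∑-constant : ∀ {m} n (x : Λ m) → ∑ {m} {n} (λ _ → x) ≡ constant (+ n) ⊛ x
  ∑-constant zero    x = sym (⊛-zeroˡ x)
  ∑-constant (suc n) x = trans (cong (x ⊕_) (∑-constant n x)) (sym (constant-suc n x))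

  -- The weights j in ∑j·θ count from 0; ∑θθ sums θᵢθⱼ over i < j.
  ∑j·θ ∑θθ : ∀ {m n} → (Fin n → Λ m) → Λ m
  ∑j·θ {n = zero}  θ = 𝟘
  ∑j·θ {n = suc n} θ = ∑j·θ (θ ∘ suc) ⊕ ∑ (θ ∘ suc)
  ∑θθ {n = zero}  θ = 𝟘
  ∑θθ {n = suc n} θ = θ zero ⊛ ∑ (θ ∘ suc) ⊕ ∑θθ (θ ∘ suc)

  odd-∑ : ∀ {m n} (θ : Fin n → Λ m) → (∀ i → Odd (θ i)) → Odd (∑ θ)
  odd-∑ {n = zero}  θ o = trans (bar-constant 0ℤ) (sym (⊝-constant 0ℤ))
  odd-∑ {n = suc n} θ o = odd-⊕ (o zero) (odd-∑ (θ ∘ suc) (o ∘ suc))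

  odd-∑j·θ : ∀ {m n} (θ : Fin n → Λ m) → (∀ i → Odd (θ i)) → Odd (∑j·θ θ)
  odd-∑j·θ {n = zero}  θ o = trans (bar-constant 0ℤ) (sym (⊝-constant 0ℤ))
  odd-∑j·θ {n = suc n} θ o = odd-⊕ (odd-∑j·θ (θ ∘ suc) (o ∘ suc)) (odd-∑ (θ ∘ suc) (o ∘ suc))

  even-∑θθ : ∀ {m n} (θ : Fin n → Λ m) → (∀ i → Odd (θ i)) → Even (∑θθ θ)
  even-∑θθ {n = zero}  θ o = bar-constant 0ℤ
  even-∑θθ {n = suc n} θ o = even-⊕ (odd-⊛-odd (o zero) (odd-∑ (θ ∘ suc) (o ∘ suc))) (even-∑θθ (θ ∘ suc) (o ∘ suc))

  odd-𝟘 : ∀ {m} → Odd (𝟘 {m})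
  odd-𝟘 = trans (bar-constant 0ℤ) (sym (⊝-constant 0ℤ))

  gen : ∀ {m} → Fin m → Λ m
  gen zero    = 𝟘 +θ 𝟙
  gen (suc i) = gen i +θ 𝟘

  odd-gen : ∀ {m} (i : Fin m) → Odd (gen i)
  odd-gen zero    = cong₂ _+θ_ (trans (bar-constant 0ℤ) (sym (⊝-constant 0ℤ))) (cong ⊝_ (bar-constant 1ℤ))
  odd-gen (suc i) = cong₂ _+θ_ (odd-gen i) (cong ⊝_ (bar-constant 0ℤ))

  ∑-lift : ∀ {m n} (θ : Fin n → Λ m) → ∑ (λ i → θ i +θ 𝟘) ≡ (∑ θ +θ 𝟘)
  ∑-lift {n = zero}  θ = refl
  ∑-lift {n = suc n} θ = trans (cong ((θ zero +θ 𝟘) ⊕_) (∑-lift (θ ∘ suc))) (cong (∑ θ +θ_) (⊕-identityˡ 𝟘))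

  ∑j·θ-lift : ∀ {m n} (θ : Fin n → Λ m) → ∑j·θ (λ i → θ i +θ 𝟘) ≡ (∑j·θ θ +θ 𝟘)
  ∑j·θ-lift {n = zero}  θ = refl
  ∑j·θ-lift {n = suc n} θ = trans (cong₂ _⊕_ (∑j·θ-lift (θ ∘ suc)) (∑-lift (θ ∘ suc))) (cong (∑j·θ θ +θ_) (⊕-identityˡ 𝟘))

  lift-⊛ : ∀ {m} (a b : Λ m) → (a +θ 𝟘) ⊛ (b +θ 𝟘) ≡ (a ⊛ b +θ 𝟘)
  lift-⊛ a b = cong (a ⊛ b +θ_) (trans (cong₂ _⊕_ (⊛-zeroˡ b) (⊛-zeroʳ (bar a))) (⊕-identityˡ 𝟘))

  lift-^ : ∀ {m} (a : Λ m) k → (a +θ 𝟘) ^Λ k ≡ (a ^Λ k +θ 𝟘)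
  lift-^ a zero    = refl
  lift-^ a (suc k) = trans (cong ((a +θ 𝟘) ⊛_) (lift-^ a k)) (lift-⊛ a (a ^Λ k))

  ∑θθ-lift : ∀ {m n} (θ : Fin n → Λ m) → ∑θθ (λ i → θ i +θ 𝟘) ≡ (∑θθ θ +θ 𝟘)
  ∑θθ-lift {n = zero}  θ = refl
  ∑θθ-lift {n = suc n} θ = trans
    (cong₂ _⊕_ (trans (cong ((θ zero +θ 𝟘) ⊛_) (∑-lift (θ ∘ suc))) (lift-⊛ (θ zero) _)) (∑θθ-lift (θ ∘ suc)))
    (cong (∑θθ θ +θ_) (⊕-identityˡ 𝟘))

  ∑gen ∑j·gen ∑gengen : ∀ m → Λ m
  ∑gen m    = ∑ (gen {m})
  ∑j·gen m  = ∑j·θ (gen {m})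
  ∑gengen m = ∑θθ (gen {m})

  ∑gen-suc : ∀ m → ∑gen (suc m) ≡ (∑gen m +θ 𝟙)
  ∑gen-suc m = trans (cong ((𝟘 +θ 𝟙) ⊕_) (∑-lift gen)) (cong₂ _+θ_ (⊕-identityˡ _) (⊕-identityʳ _))

  ∑j·gen-suc : ∀ m → ∑j·gen (suc m) ≡ (∑j·gen m ⊕ ∑gen m +θ 𝟘)
  ∑j·gen-suc m = trans (cong₂ _⊕_ (∑j·θ-lift gen) (∑-lift gen)) (cong (∑j·gen m ⊕ ∑gen m +θ_) (⊕-identityˡ 𝟘))

  ∑gengen-suc : ∀ m → ∑gengen (suc m) ≡ (∑gengen m +θ ∑gen m)
  ∑gengen-suc m = trans (cong₂ _⊕_ (cong ((𝟘 +θ 𝟙) ⊛_) (∑-lift gen)) (∑θθ-lift gen)) (cong₂ _+θ_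
    (trans (cong (_⊕ ∑gengen m) (⊛-zeroˡ _)) (⊕-identityˡ _))
    (trans (⊕-identityʳ _) (trans (cong₂ _⊕_ (⊛-identityˡ _) (⊛-zeroʳ (bar 𝟘))) (⊕-identityʳ _))))

  odd-∑gen : ∀ m → Odd (∑gen m)
  odd-∑gen m = odd-∑ gen odd-gen

  -- The top coefficient only sees the second component, which is what makes the recursion in m close up.
  pow-∑gengen-suc : ∀ m k → ∑gengen (suc m) ^Λ k ≡
    (∑gengen m ^Λ k +θ constant (+ k) ⊛ (∑gengen m ^Λ (k ℕ.∸ 1) ⊛ ∑gen m))
  pow-∑gengen-suc m k = begin
    ∑gengen (suc m) ^Λ k
      ≡⟨ cong (_^Λ k) (trans (∑gengen-suc m) (cong₂ _+θ_ (sym (⊕-identityʳ ε)) (sym (⊕-identityˡ σ)))) ⟩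
    ((ε +θ 𝟘) ⊕ (𝟘 +θ σ)) ^Λ k
      ≡⟨ pow-⊕ (ε +θ 𝟘) (𝟘 +θ σ) k
           (cong₂ _+θ_ (bar-constant 0ℤ) (trans (cong ⊝_ (odd-∑gen m)) (⊝-involutive σ)))
           (cong₂ _+θ_ (⊛-zeroˡ 𝟘) (trans (cong₂ _⊕_ (⊛-zeroʳ σ) (trans (cong (_⊛ σ) (bar-constant 0ℤ)) (⊛-zeroˡ σ))) (⊕-identityˡ 𝟘))) ⟩
    (ε +θ 𝟘) ^Λ k ⊕ constant (+ k) ⊛ ((ε +θ 𝟘) ^Λ (k ℕ.∸ 1) ⊛ (𝟘 +θ σ))
      ≡⟨ cong₂ (λ s t → s ⊕ constant (+ k) ⊛ (t ⊛ (𝟘 +θ σ))) (lift-^ ε k) (lift-^ ε (k ℕ.∸ 1)) ⟩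
    (ε ^Λ k +θ 𝟘) ⊕ constant (+ k) ⊛ (ε ^Λ (k ℕ.∸ 1) ⊛ 𝟘 +θ 𝟘 ⊛ 𝟘 ⊕ bar (ε ^Λ (k ℕ.∸ 1)) ⊛ σ)
      ≡⟨ cong (λ t → (ε ^Λ k +θ 𝟘) ⊕ constant (+ k) ⊛ t) (cong₂ _+θ_ (⊛-zeroʳ _)
           (trans (cong₂ _⊕_ (⊛-zeroˡ 𝟘) (cong (_⊛ σ) (even-^ ε (k ℕ.∸ 1) (even-∑θθ gen odd-gen)))) (⊕-identityˡ _))) ⟩
    (ε ^Λ k +θ 𝟘) ⊕ constant (+ k) ⊛ (𝟘 +θ ε ^Λ (k ℕ.∸ 1) ⊛ σ)
      ≡⟨ cong ((ε ^Λ k +θ 𝟘) ⊕_) (constant-⊛-+θ (+ k) 𝟘 _) ⟩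
    (ε ^Λ k +θ 𝟘) ⊕ (constant (+ k) ⊛ 𝟘 +θ constant (+ k) ⊛ (ε ^Λ (k ℕ.∸ 1) ⊛ σ))
      ≡⟨ cong₂ _+θ_ (trans (cong (ε ^Λ k ⊕_) (⊛-zeroʳ (constant (+ k)))) (⊕-identityʳ _)) (⊕-identityˡ _) ⟩
    (ε ^Λ k +θ constant (+ k) ⊛ (ε ^Λ (k ℕ.∸ 1) ⊛ σ)) ∎
    where
    ε = ∑gengen m
    σ = ∑gen m

  top-𝟘 : ∀ m → top (𝟘 {m}) ≡ 0ℤ
  top-𝟘 zero    = refl
  top-𝟘 (suc m) = top-𝟘 m

  module _ (m k : ℕ) where
    private
      ε = ∑gengen m
      σ = ∑gen m
      τ = ∑j·gen m
      -- The θ-component of `∑gengen (suc m) ^Λ k`. It ends in the odd factor σ, so it annihilates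
      -- every multiple of σ.
      B = constant (+ k) ⊛ (ε ^Λ (k ℕ.∸ 1) ⊛ σ)
      even-ε^ : ∀ j → Even (ε ^Λ j)
      even-ε^ j = even-^ ε j (even-∑θθ gen odd-gen)
      σσ : σ ⊛ σ ≡ 𝟘
      σσ = odd-square σ (odd-∑gen m)
      B⊛ : ∀ x → B ⊛ x ≡ constant (+ k) ⊛ (ε ^Λ (k ℕ.∸ 1) ⊛ (σ ⊛ x))
      B⊛ x = trans (⊛-assoc (constant (+ k)) _ x) (cong (constant (+ k) ⊛_) (⊛-assoc _ σ x))
      B⊛σ : ∀ x → B ⊛ (σ ⊛ x) ≡ 𝟘
      B⊛σ x = begin
        B ⊛ (σ ⊛ x)
          ≡⟨ B⊛ (σ ⊛ x) ⟩
        constant (+ k) ⊛ (ε ^Λ (k ℕ.∸ 1) ⊛ (σ ⊛ (σ ⊛ x)))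
          ≡⟨ cong (λ t → constant (+ k) ⊛ (ε ^Λ (k ℕ.∸ 1) ⊛ t)) (trans (sym (⊛-assoc σ σ x)) (trans (cong (_⊛ x) σσ) (⊛-zeroˡ x))) ⟩
        constant (+ k) ⊛ (ε ^Λ (k ℕ.∸ 1) ⊛ 𝟘)
          ≡⟨ trans (cong (constant (+ k) ⊛_) (⊛-zeroʳ _)) (⊛-zeroʳ (constant (+ k))) ⟩
        𝟘 ∎

    top-pow : top (∑gengen (suc m) ^Λ k) ≡ + k ℤ.* top (ε ^Λ (k ℕ.∸ 1) ⊛ σ)
    top-pow = trans (cong top (pow-∑gengen-suc m k)) (top-constant-⊛ (+ k) (ε ^Λ (k ℕ.∸ 1) ⊛ σ))

    top-pow-∑gen : top (∑gengen (suc m) ^Λ k ⊛ ∑gen (suc m)) ≡ top (ε ^Λ k)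
    top-pow-∑gen = begin
      top (∑gengen (suc m) ^Λ k ⊛ ∑gen (suc m))
        ≡⟨ cong₂ (λ s t → top (s ⊛ t)) (pow-∑gengen-suc m k) (∑gen-suc m) ⟩
      top (B ⊛ σ ⊕ bar (ε ^Λ k) ⊛ 𝟙)
        ≡⟨ cong₂ (λ s t → top (s ⊕ t)) (trans (cong (B ⊛_) (sym (⊛-identityʳ σ))) (B⊛σ 𝟙)) (trans (⊛-identityʳ _) (even-ε^ k)) ⟩
      top (𝟘 ⊕ ε ^Λ k)
        ≡⟨ cong top (⊕-identityˡ (ε ^Λ k)) ⟩
      top (ε ^Λ k) ∎

    top-pow-∑j·gen : top (∑gengen (suc m) ^Λ k ⊛ ∑j·gen (suc m)) ≡ + k ℤ.* top (ε ^Λ (k ℕ.∸ 1) ⊛ (σ ⊛ τ))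
    top-pow-∑j·gen = begin
      top (∑gengen (suc m) ^Λ k ⊛ ∑j·gen (suc m))
        ≡⟨ cong₂ (λ s t → top (s ⊛ t)) (pow-∑gengen-suc m k) (∑j·gen-suc m) ⟩
      top (B ⊛ (τ ⊕ σ) ⊕ bar (ε ^Λ k) ⊛ 𝟘)
        ≡⟨ cong top (trans (cong₂ _⊕_ (⊛-distribˡ B τ σ) (⊛-zeroʳ (bar (ε ^Λ k)))) (⊕-identityʳ _)) ⟩
      top (B ⊛ τ ⊕ B ⊛ σ)
        ≡⟨ cong top (trans (cong (B ⊛ τ ⊕_) (trans (cong (B ⊛_) (sym (⊛-identityʳ σ))) (B⊛σ 𝟙))) (⊕-identityʳ _)) ⟩
      top (B ⊛ τ)
        ≡⟨ cong top (B⊛ τ) ⟩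
      top (constant (+ k) ⊛ (ε ^Λ (k ℕ.∸ 1) ⊛ (σ ⊛ τ)))
        ≡⟨ top-constant-⊛ (+ k) (ε ^Λ (k ℕ.∸ 1) ⊛ (σ ⊛ τ)) ⟩
      + k ℤ.* top (ε ^Λ (k ℕ.∸ 1) ⊛ (σ ⊛ τ)) ∎

    top-pow-∑gen-∑j·gen : top (∑gengen (suc m) ^Λ k ⊛ (∑gen (suc m) ⊛ ∑j·gen (suc m))) ≡
      top (ε ^Λ k ⊛ τ) ℤ.+ top (ε ^Λ k ⊛ σ)
    top-pow-∑gen-∑j·gen = begin
      top (∑gengen (suc m) ^Λ k ⊛ (∑gen (suc m) ⊛ ∑j·gen (suc m)))
        ≡⟨ cong₂ (λ s t → top (s ⊛ t)) (pow-∑gengen-suc m k) (cong₂ _⊛_ (∑gen-suc m) (∑j·gen-suc m)) ⟩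
      top (B ⊛ (σ ⊛ (τ ⊕ σ)) ⊕ bar (ε ^Λ k) ⊛ (𝟙 ⊛ (τ ⊕ σ) ⊕ bar σ ⊛ 𝟘))
        ≡⟨ cong top (cong₂ _⊕_ (B⊛σ (τ ⊕ σ)) (cong₂ _⊛_ (even-ε^ k) (trans (cong₂ _⊕_ (⊛-identityˡ _) (⊛-zeroʳ (bar σ))) (⊕-identityʳ _)))) ⟩
      top (𝟘 ⊕ ε ^Λ k ⊛ (τ ⊕ σ))
        ≡⟨ cong top (trans (⊕-identityˡ _) (⊛-distribˡ (ε ^Λ k) τ σ)) ⟩
      top (ε ^Λ k ⊛ τ ⊕ ε ^Λ k ⊛ σ)
        ≡⟨ top-⊕ (ε ^Λ k ⊛ τ) (ε ^Λ k ⊛ σ) ⟩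
      top (ε ^Λ k ⊛ τ) ℤ.+ top (ε ^Λ k ⊛ σ) ∎

  2*suc : ∀ n → 2 ℕ.* suc n ≡ suc (suc (2 ℕ.* n))
  2*suc n = cong suc (ℕP.+-suc n (n ℕ.+ 0))

  -- Removing one generator trades a factor ε for σ at the price of the exponent; removing the next
  -- one uses up σ. Two generators thus cost one power of ε and yield the factor n. The size is a
  -- variable tied by an equation because `2 * suc n` does not compute to a double successor.
  top-∑gengen^n : ∀ n m → m ≡ 2 ℕ.* n → top (∑gengen m ^Λ n) ≡ + (n !)
  top-∑gengen^n zero    .0 refl = refl
  top-∑gengen^n (suc n) m  e with refl ← trans e (2*suc n) = begin
    top (∑gengen (2 ℕ.+ 2 ℕ.* n) ^Λ suc n)
      ≡⟨ top-pow (1 ℕ.+ 2 ℕ.* n) (suc n) ⟩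
    + suc n ℤ.* top (∑gengen (1 ℕ.+ 2 ℕ.* n) ^Λ n ⊛ ∑gen (1 ℕ.+ 2 ℕ.* n))
      ≡⟨ cong (+ suc n ℤ.*_) (trans (top-pow-∑gen (2 ℕ.* n) n) (top-∑gengen^n n _ refl)) ⟩
    + suc n ℤ.* + (n !)
      ≡⟨ ℤP.pos-* (suc n) (n !) ⟨
    + (suc n !) ∎

  -- Removing two generators gives a(n+1) = (n+1) a(n) + (n+1)!. The additional term arises because
  -- removing the first generator shifts the weights by one, which turns τ into τ + σ.
  top-∑gengen^n∸1 : ∀ n m → m ≡ 2 ℕ.* suc n → top (∑gengen m ^Λ n ⊛ (∑gen m ⊛ ∑j·gen m)) ≡ + (suc n !)
  top-∑gengen^n∸1 zero    m e with refl ← e = refl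
  top-∑gengen^n∸1 (suc n) m e with refl ← trans e (2*suc (suc n)) = begin
    top (∑gengen (2 ℕ.+ M) ^Λ suc n ⊛ (∑gen (2 ℕ.+ M) ⊛ ∑j·gen (2 ℕ.+ M)))
      ≡⟨ top-pow-∑gen-∑j·gen (1 ℕ.+ M) (suc n) ⟩
    top (∑gengen (1 ℕ.+ M) ^Λ suc n ⊛ ∑j·gen (1 ℕ.+ M)) ℤ.+ top (∑gengen (1 ℕ.+ M) ^Λ suc n ⊛ ∑gen (1 ℕ.+ M))
      ≡⟨ cong₂ ℤ._+_ (trans (top-pow-∑j·gen M (suc n)) (cong (+ suc n ℤ.*_) (top-∑gengen^n∸1 n M refl)))
                     (trans (top-pow-∑gen M (suc n)) (top-∑gengen^n (suc n) M refl)) ⟩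
    + suc n ℤ.* + (suc n !) ℤ.+ + (suc n !)
      ≡⟨ cong (ℤ._+ + (suc n !)) (ℤP.pos-* (suc n) (suc n !)) ⟨
    + (suc n ℕ.* suc n ! ℕ.+ suc n !)
      ≡⟨ cong +_ (ℕP.+-comm (suc n ℕ.* suc n !) (suc n !)) ⟩
    + (suc (suc n) !) ∎
    where
    M = 2 ℕ.* suc n

open Quadratic

-- The sum of q over all triples, and the top coefficient of its power

module TripleSum where

  -- The clauses are ordered so that the sums over triples unfold one vertex at a time.
  lt : ∀ {n} → Fin n → Fin n → Bool
  lt _       zero    = false
  lt zero    (suc b) = true
  lt (suc a) (suc b) = lt a b

  lt₃ : ∀ {n} → Fin n → Fin n → Fin n → Bool
  lt₃ _       zero    _       = false
  lt₃ _       (suc b) zero    = false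
  lt₃ zero    (suc b) (suc c) = lt b c
  lt₃ (suc a) (suc b) (suc c) = lt₃ a b c

  ∑< : ∀ {m n} → (Fin n → Fin n → Λ m) → Λ m
  ∑< F = ∑ λ b → ∑ λ c → if lt b c then F b c else 𝟘

  ∑<< : ∀ {m n} → (Fin n → Fin n → Fin n → Λ m) → Λ m
  ∑<< F = ∑ λ a → ∑ λ b → ∑ λ c → if lt₃ a b c then F a b c else 𝟘

  ∑<-suc : ∀ {m n} (F : Fin (suc n) → Fin (suc n) → Λ m) →
    ∑< F ≡ ∑ (λ c → F zero (suc c)) ⊕ ∑< (λ b c → F (suc b) (suc c))
  ∑<-suc {n = n} F = cong₂ _⊕_ (⊕-identityˡ _) (∑-cong {n = n} (λ b → ⊕-identityˡ _))

  ∑<<-suc : ∀ {m n} (F : Fin (suc n) → Fin (suc n) → Fin (suc n) → Λ m) →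
    ∑<< F ≡ ∑< (λ b c → F zero (suc b) (suc c)) ⊕ ∑<< (λ a b c → F (suc a) (suc b) (suc c))
  ∑<<-suc {m} {n} F = cong₂ _⊕_
    (drop-zero (λ b c → if lt₃ zero b c then F zero b c else 𝟘) (λ c → refl) (λ b → refl))
    (∑-cong (λ a → drop-zero (λ b c → if lt₃ (suc a) b c then F (suc a) b c else 𝟘) (λ c → refl) (λ b → refl)))
    where
    drop-zero : (G : Fin (suc n) → Fin (suc n) → Λ m) → (∀ c → G zero c ≡ 𝟘) → (∀ b → G (suc b) zero ≡ 𝟘) →
      ∑ (λ b → ∑ (G b)) ≡ ∑ (λ b → ∑ (λ c → G (suc b) (suc c)))
    drop-zero G h₀ h₁ = trans
      (cong₂ _⊕_ (trans (∑-cong h₀) (∑-𝟘 (suc n)))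
                 (∑-cong (λ b → trans (cong (_⊕ ∑ (λ c → G (suc b) (suc c))) (h₁ b)) (⊕-identityˡ _))))
      (⊕-identityˡ _)

  triad : ∀ {m} → Λ m → Λ m → Λ m → Λ m
  triad x y z = (y ⊕ ⊝ x) ⊛ (z ⊕ ⊝ y)

  -- A pair b < c contributes θ_b θ_c + x (θ_b - θ_c). The index j is the smaller one of n - 1 - j
  -- pairs and the larger one of j pairs, so x is multiplied by the sum of (n - 1 - 2j) θ_j.
  ∑<-triad : ∀ {m n} (x : Λ m) (θ : Fin n → Λ m) → Odd x → (∀ i → Odd (θ i)) →
    ∑< (λ b c → triad x (θ b) (θ c)) ≡
    ∑θθ θ ⊕ x ⊛ (constant (+ n) ⊛ ∑ θ ⊕ ⊝ ∑ θ ⊕ ⊝ (∑j·θ θ ⊕ ∑j·θ θ))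
  ∑<-triad {n = zero}  x θ ox o = sym (trans (⊕-identityˡ _) (trans (cong (x ⊛_)
    (trans (cong (λ t → t ⊕ ⊝ 𝟘 ⊕ ⊝ (𝟘 ⊕ 𝟘)) (⊛-zeroˡ 𝟘)) (linear [] (:0 :+ :- :0 :+ :- (:0 :+ :0)) :0 refl))) (⊛-zeroʳ x)))
  ∑<-triad {n = suc n} x θ ox o = begin
    ∑< (λ b c → triad x (θ b) (θ c))
      ≡⟨ ∑<-suc (λ b c → triad x (θ b) (θ c)) ⟩
    ∑ (λ c → (y ⊕ ⊝ x) ⊛ (θ (suc c) ⊕ ⊝ y)) ⊕ ∑< (λ b c → triad x (θ (suc b)) (θ (suc c)))
      ≡⟨ cong₂ _⊕_ row (∑<-triad x (θ ∘ suc) ox (o ∘ suc)) ⟩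
    (y ⊛ U ⊕ x ⊛ (ny ⊕ ⊝ U)) ⊕ (∑θθ (θ ∘ suc) ⊕ x ⊛ (nU ⊕ ⊝ U ⊕ ⊝ (V ⊕ V)))
      ≡⟨ ⊕-interchange (y ⊛ U) _ _ _ ⟩
    ∑θθ θ ⊕ (x ⊛ (ny ⊕ ⊝ U) ⊕ x ⊛ (nU ⊕ ⊝ U ⊕ ⊝ (V ⊕ V)))
      ≡⟨ cong (∑θθ θ ⊕_) (⊛-distribˡ x _ _) ⟨
    ∑θθ θ ⊕ x ⊛ ((ny ⊕ ⊝ U) ⊕ (nU ⊕ ⊝ U ⊕ ⊝ (V ⊕ V)))
      ≡⟨ cong (λ t → ∑θθ θ ⊕ x ⊛ t) (begin
           (ny ⊕ ⊝ U) ⊕ (nU ⊕ ⊝ U ⊕ ⊝ (V ⊕ V))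
             ≡⟨ linear (ny ∷ nU ∷ U ∷ V ∷ y ∷ []) ((v₀ :+ :- v₂) :+ (v₁ :+ :- v₂ :+ :- (v₃ :+ v₃)))
                  (((v₄ :+ v₂) :+ (v₀ :+ v₁)) :+ :- (v₄ :+ v₂) :+ :- ((v₃ :+ v₂) :+ (v₃ :+ v₂))) refl ⟩
           ((y ⊕ U) ⊕ (ny ⊕ nU)) ⊕ ⊝ (y ⊕ U) ⊕ ⊝ ((V ⊕ U) ⊕ (V ⊕ U))
             ≡⟨ cong (λ t → ((y ⊕ U) ⊕ t) ⊕ ⊝ (y ⊕ U) ⊕ ⊝ ((V ⊕ U) ⊕ (V ⊕ U))) (⊛-distribˡ N y U) ⟨
           ((y ⊕ U) ⊕ N ⊛ (y ⊕ U)) ⊕ ⊝ (y ⊕ U) ⊕ ⊝ ((V ⊕ U) ⊕ (V ⊕ U))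
             ≡⟨ cong (λ t → t ⊕ ⊝ (y ⊕ U) ⊕ ⊝ ((V ⊕ U) ⊕ (V ⊕ U))) (constant-suc n (y ⊕ U)) ⟨
           constant (+ suc n) ⊛ (y ⊕ U) ⊕ ⊝ (y ⊕ U) ⊕ ⊝ ((V ⊕ U) ⊕ (V ⊕ U)) ∎) ⟩
    ∑θθ θ ⊕ x ⊛ (constant (+ suc n) ⊛ ∑ θ ⊕ ⊝ ∑ θ ⊕ ⊝ (∑j·θ θ ⊕ ∑j·θ θ)) ∎
    where
    y  = θ zero
    U  = ∑ (θ ∘ suc)
    V  = ∑j·θ (θ ∘ suc)
    N  = constant (+ n)
    ny = N ⊛ y
    nU = N ⊛ U
    y⊛ny : y ⊛ ny ≡ 𝟘
    y⊛ny = trans (constant-pull (+ n) y y) (trans (cong (N ⊛_) (odd-square y (o zero))) (⊛-zeroʳ N))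
    row : ∑ (λ c → (y ⊕ ⊝ x) ⊛ (θ (suc c) ⊕ ⊝ y)) ≡ y ⊛ U ⊕ x ⊛ (ny ⊕ ⊝ U)
    row = begin
      ∑ (λ c → (y ⊕ ⊝ x) ⊛ (θ (suc c) ⊕ ⊝ y))
        ≡⟨ ∑-⊛ˡ (y ⊕ ⊝ x) (λ c → θ (suc c) ⊕ ⊝ y) ⟩
      (y ⊕ ⊝ x) ⊛ ∑ (λ c → θ (suc c) ⊕ ⊝ y)
        ≡⟨ cong ((y ⊕ ⊝ x) ⊛_) (trans (∑-⊕ (θ ∘ suc) (λ _ → ⊝ y)) (cong (U ⊕_) (trans (∑-⊝ {n = n} (λ _ → y)) (cong ⊝_ (∑-constant n y))))) ⟩
      (y ⊕ ⊝ x) ⊛ (U ⊕ ⊝ ny)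
        ≡⟨ ⊛-distribʳ (U ⊕ ⊝ ny) y (⊝ x) ⟩
      y ⊛ (U ⊕ ⊝ ny) ⊕ ⊝ x ⊛ (U ⊕ ⊝ ny)
        ≡⟨ cong₂ _⊕_
             (trans (⊛-distribˡ y U (⊝ ny)) (trans (cong (y ⊛ U ⊕_) (trans (⊝-⊛ʳ y ny) (trans (cong ⊝_ y⊛ny) (⊝-constant 0ℤ)))) (⊕-identityʳ _)))
             (trans (⊝-⊛ˡ x _) (trans (sym (⊝-⊛ʳ x _)) (cong (x ⊛_) (linear (ny ∷ U ∷ []) (:- (v₁ :+ :- v₀)) (v₀ :+ :- v₁) refl)))) ⟩
      y ⊛ U ⊕ x ⊛ (ny ⊕ ⊝ U) ∎

  -- For i < j the monomial θ_i θ_j occurs with sign + when the third vertex lies outside the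
  -- interval from i to j, and with sign - for the j - i - 1 vertices inside. Its coefficient is
  -- therefore n - 2 (j - i), and the sum of (j - i) θ_i θ_j over i < j is the product
  -- `∑ θ ⊛ ∑j·θ θ`.
  ∑<<-triad : ∀ {m n} (θ : Fin n → Λ m) → (∀ i → Odd (θ i)) →
    ∑<< (λ a b c → triad (θ a) (θ b) (θ c)) ≡ constant (+ n) ⊛ ∑θθ θ ⊕ ⊝ (∑ θ ⊛ ∑j·θ θ ⊕ ∑ θ ⊛ ∑j·θ θ)
  ∑<<-triad {n = zero}  θ o = sym (trans (cong₂ (λ s t → s ⊕ ⊝ (t ⊕ t)) (⊛-zeroˡ 𝟘) (⊛-zeroˡ 𝟘)) (linear [] (:0 :+ :- (:0 :+ :0)) :0 refl))
  ∑<<-triad {n = suc n} θ o = begin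
    ∑<< (λ a b c → triad (θ a) (θ b) (θ c))
      ≡⟨ ∑<<-suc (λ a b c → triad (θ a) (θ b) (θ c)) ⟩
    ∑< (λ b c → triad y (θ (suc b)) (θ (suc c))) ⊕ ∑<< (λ a b c → triad (θ (suc a)) (θ (suc b)) (θ (suc c)))
      ≡⟨ cong₂ _⊕_ (∑<-triad y (θ ∘ suc) (o zero) (o ∘ suc)) (∑<<-triad (θ ∘ suc) (o ∘ suc)) ⟩
    (E ⊕ y ⊛ (N ⊛ U ⊕ ⊝ U ⊕ ⊝ (V ⊕ V))) ⊕ (N ⊛ E ⊕ ⊝ (U ⊛ V ⊕ U ⊛ V))
      ≡⟨ cong (λ t → (E ⊕ t) ⊕ (N ⊛ E ⊕ ⊝ (U ⊛ V ⊕ U ⊛ V))) expand ⟩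
    (E ⊕ (N ⊛ (y ⊛ U) ⊕ ⊝ (y ⊛ U) ⊕ ⊝ (y ⊛ V ⊕ y ⊛ V))) ⊕ (N ⊛ E ⊕ ⊝ (U ⊛ V ⊕ U ⊛ V))
      ≡⟨ linear (E ∷ N ⊛ (y ⊛ U) ∷ y ⊛ U ∷ y ⊛ V ∷ N ⊛ E ∷ U ⊛ V ∷ [])
           ((v₀ :+ (v₁ :+ :- v₂ :+ :- (v₃ :+ v₃))) :+ (v₄ :+ :- (v₅ :+ v₅)))
           (((v₂ :+ v₀) :+ (v₁ :+ v₄)) :+ :- (((v₃ :+ v₂) :+ v₅) :+ ((v₃ :+ v₂) :+ v₅))) refl ⟩
    ((y ⊛ U ⊕ E) ⊕ (N ⊛ (y ⊛ U) ⊕ N ⊛ E)) ⊕ ⊝ (((y ⊛ V ⊕ y ⊛ U) ⊕ U ⊛ V) ⊕ ((y ⊛ V ⊕ y ⊛ U) ⊕ U ⊛ V))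
      ≡⟨ cong₂ (λ s t → s ⊕ ⊝ (t ⊕ t)) (trans (cong (y ⊛ U ⊕ E ⊕_) (sym (⊛-distribˡ N (y ⊛ U) E))) (sym (constant-suc n (y ⊛ U ⊕ E)))) (sym product) ⟩
    constant (+ suc n) ⊛ ∑θθ θ ⊕ ⊝ (∑ θ ⊛ ∑j·θ θ ⊕ ∑ θ ⊛ ∑j·θ θ) ∎
    where
    y  = θ zero
    U  = ∑ (θ ∘ suc)
    V  = ∑j·θ (θ ∘ suc)
    E  = ∑θθ (θ ∘ suc)
    N  = constant (+ n)
    expand : y ⊛ (N ⊛ U ⊕ ⊝ U ⊕ ⊝ (V ⊕ V)) ≡ N ⊛ (y ⊛ U) ⊕ ⊝ (y ⊛ U) ⊕ ⊝ (y ⊛ V ⊕ y ⊛ V)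
    expand = begin
      y ⊛ (N ⊛ U ⊕ ⊝ U ⊕ ⊝ (V ⊕ V))
        ≡⟨ trans (⊛-distribˡ y _ _) (cong (_⊕ y ⊛ ⊝ (V ⊕ V)) (⊛-distribˡ y _ _)) ⟩
      y ⊛ (N ⊛ U) ⊕ y ⊛ ⊝ U ⊕ y ⊛ ⊝ (V ⊕ V)
        ≡⟨ cong₂ _⊕_ (cong₂ _⊕_ (constant-pull (+ n) y U) (⊝-⊛ʳ y U)) (trans (⊝-⊛ʳ y _) (cong ⊝_ (⊛-distribˡ y V V))) ⟩
      N ⊛ (y ⊛ U) ⊕ ⊝ (y ⊛ U) ⊕ ⊝ (y ⊛ V ⊕ y ⊛ V) ∎
    product : (y ⊕ U) ⊛ (V ⊕ U) ≡ (y ⊛ V ⊕ y ⊛ U) ⊕ U ⊛ V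
    product = begin
      (y ⊕ U) ⊛ (V ⊕ U)
        ≡⟨ trans (⊛-distribʳ (V ⊕ U) y U) (cong₂ _⊕_ (⊛-distribˡ y V U) (⊛-distribˡ U V U)) ⟩
      (y ⊛ V ⊕ y ⊛ U) ⊕ (U ⊛ V ⊕ U ⊛ U)
        ≡⟨ cong ((y ⊛ V ⊕ y ⊛ U) ⊕_) (trans (cong (U ⊛ V ⊕_) (odd-square U (odd-∑ (θ ∘ suc) (o ∘ suc)))) (⊕-identityʳ _)) ⟩
      (y ⊛ V ⊕ y ⊛ U) ⊕ U ⊛ V ∎

  -- Only differences of vertices matter, so vertex 0 may be sent to 0.
  vertex : ∀ {M} → Fin (suc M) → Λ M
  vertex zero    = 𝟘
  vertex (suc i) = gen i

  odd-vertex : ∀ {M} (v : Fin (suc M)) → Odd (vertex v)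
  odd-vertex zero    = odd-𝟘
  odd-vertex (suc i) = odd-gen i

  ∑triads : ∀ M → Λ M
  ∑triads M = ∑<< (λ a b c → triad (vertex {M} a) (vertex b) (vertex c))

  -- Vertex 0 contributes nothing but shifts the weight of every generator by one, so the weighted
  -- sum becomes τ + σ. The added σ is lost again in the product with σ.
  ∑<<-vertex : ∀ M → ∑triads M ≡
    constant (+ suc M) ⊛ ∑gengen M ⊕ constant -[1+ 1 ] ⊛ (∑gen M ⊛ ∑j·gen M)
  ∑<<-vertex M = begin
    ∑triads M
      ≡⟨ ∑<<-triad vertex odd-vertex ⟩
    constant (+ suc M) ⊛ (𝟘 ⊛ σ ⊕ ∑gengen M) ⊕ ⊝ ((𝟘 ⊕ σ) ⊛ (τ ⊕ σ) ⊕ (𝟘 ⊕ σ) ⊛ (τ ⊕ σ))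
      ≡⟨ cong₂ (λ s t → constant (+ suc M) ⊛ s ⊕ ⊝ (t ⊕ t))
           (trans (cong (_⊕ ∑gengen M) (⊛-zeroˡ σ)) (⊕-identityˡ _))
           (trans (cong (_⊛ (τ ⊕ σ)) (⊕-identityˡ σ)) (trans (⊛-distribˡ σ τ σ)
             (trans (cong (σ ⊛ τ ⊕_) (odd-square σ (odd-∑gen M))) (⊕-identityʳ _)))) ⟩
    constant (+ suc M) ⊛ ∑gengen M ⊕ ⊝ (σ ⊛ τ ⊕ σ ⊛ τ)
      ≡⟨ cong (constant (+ suc M) ⊛ ∑gengen M ⊕_) double ⟩
    constant (+ suc M) ⊛ ∑gengen M ⊕ constant -[1+ 1 ] ⊛ (σ ⊛ τ) ∎
    where
    σ = ∑gen M
    τ = ∑j·gen M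
    double : ⊝ (σ ⊛ τ ⊕ σ ⊛ τ) ≡ constant -[1+ 1 ] ⊛ (σ ⊛ τ)
    double = begin
      ⊝ (σ ⊛ τ ⊕ σ ⊛ τ)                ≡⟨ cong (λ t → ⊝ (σ ⊛ τ ⊕ t)) (⊛-identityˡ (σ ⊛ τ)) ⟨
      ⊝ (σ ⊛ τ ⊕ 𝟙 ⊛ (σ ⊛ τ))          ≡⟨ cong ⊝_ (constant-suc 1 (σ ⊛ τ)) ⟨
      ⊝ (constant (+ 2) ⊛ (σ ⊛ τ))     ≡⟨ ⊝-⊛ˡ _ _ ⟨
      ⊝ constant (+ 2) ⊛ (σ ⊛ τ)       ≡⟨ cong (_⊛ (σ ⊛ τ)) (⊝-constant (+ 2)) ⟩
      constant -[1+ 1 ] ⊛ (σ ⊛ τ)      ∎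

  -- Since στ squares to zero, only two terms of the binomial expansion survive. With F = (n+1)!
  -- they are N^(n+1) F and -2 (n+1) N^n F. As N = 2 (n+1) + 1, the difference N - 2 (n+1) is 1, and
  -- one power of N disappears.
  top-∑<<-vertex : ∀ n → let M = 2 ℕ.* suc n in
    top (∑triads M ^Λ suc n) ≡ + (suc n !) ℤ.* (+ suc M) ℤ.^ n
  top-∑<<-vertex n = begin
    top (∑triads M ^Λ suc n)
      ≡⟨ cong (λ t → top (t ^Λ suc n)) (∑<<-vertex M) ⟩
    top ((constant N ⊛ ε ⊕ r) ^Λ suc n)
      ≡⟨ cong top (pow-⊕ (constant N ⊛ ε) r (suc n) even-r rr) ⟩
    top ((constant N ⊛ ε) ^Λ suc n ⊕ constant (+ suc n) ⊛ ((constant N ⊛ ε) ^Λ n ⊛ r))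
      ≡⟨ top-⊕ ((constant N ⊛ ε) ^Λ suc n) _ ⟩
    top ((constant N ⊛ ε) ^Λ suc n) ℤ.+ top (constant (+ suc n) ⊛ ((constant N ⊛ ε) ^Λ n ⊛ r))
      ≡⟨ cong₂ ℤ._+_
           (trans (cong top (pow-constant N ε (suc n)))
             (trans (top-constant-⊛ (N ℤ.^ suc n) (ε ^Λ suc n)) (cong (N ℤ.^ suc n ℤ.*_) (top-∑gengen^n (suc n) M refl))))
           (trans (top-constant-⊛ (+ suc n) ((constant N ⊛ ε) ^Λ n ⊛ r)) (cong (+ suc n ℤ.*_) second)) ⟩
    N ℤ.^ suc n ℤ.* F ℤ.+ + suc n ℤ.* (-[1+ 1 ] ℤ.* (N ℤ.^ n ℤ.* F))
      ≡⟨ cong (λ t → t ℤ.* N ℤ.^ n ℤ.* F ℤ.+ + suc n ℤ.* (-[1+ 1 ] ℤ.* (N ℤ.^ n ℤ.* F))) N≡1+2n ⟩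
    (1ℤ ℤ.+ + 2 ℤ.* + suc n) ℤ.* N ℤ.^ n ℤ.* F ℤ.+ + suc n ℤ.* (-[1+ 1 ] ℤ.* (N ℤ.^ n ℤ.* F))
      ≡⟨ cancel (+ suc n) (N ℤ.^ n) F ⟩
    F ℤ.* N ℤ.^ n ∎
    where
    M = 2 ℕ.* suc n
    N = + suc M
    F = + (suc n !)
    ε = ∑gengen M
    σ = ∑gen M
    τ = ∑j·gen M
    r = constant -[1+ 1 ] ⊛ (σ ⊛ τ)
    N≡1+2n : N ≡ 1ℤ ℤ.+ + 2 ℤ.* + suc n
    N≡1+2n = cong (λ t → 1ℤ ℤ.+ t) (ℤP.pos-* 2 (suc n))
    cancel : ∀ k p f → (1ℤ ℤ.+ + 2 ℤ.* k) ℤ.* p ℤ.* f ℤ.+ k ℤ.* (-[1+ 1 ] ℤ.* (p ℤ.* f)) ≡ f ℤ.* p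
    cancel = solve-∀
    odd-σ : Odd σ
    odd-σ = odd-∑gen M
    even-στ : Even (σ ⊛ τ)
    even-στ = odd-⊛-odd odd-σ (odd-∑j·θ gen odd-gen)
    even-r : Even r
    even-r = even-⊛ (bar-constant _) even-στ
    σr : σ ⊛ r ≡ 𝟘
    σr = begin
      σ ⊛ r                                ≡⟨ constant-pull -[1+ 1 ] σ (σ ⊛ τ) ⟩
      constant -[1+ 1 ] ⊛ (σ ⊛ (σ ⊛ τ))    ≡⟨ cong (constant -[1+ 1 ] ⊛_) (trans (sym (⊛-assoc σ σ τ)) (trans (cong (_⊛ τ) (odd-square σ odd-σ)) (⊛-zeroˡ τ))) ⟩
      constant -[1+ 1 ] ⊛ 𝟘                ≡⟨ ⊛-zeroʳ _ ⟩
      𝟘 ∎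
    rr : r ⊛ r ≡ 𝟘
    rr = begin
      constant -[1+ 1 ] ⊛ (σ ⊛ τ) ⊛ r      ≡⟨ cong (λ t → constant -[1+ 1 ] ⊛ t ⊛ r) (odd-anticomm σ τ odd-σ (odd-∑j·θ gen odd-gen)) ⟩
      constant -[1+ 1 ] ⊛ ⊝ (τ ⊛ σ) ⊛ r    ≡⟨ ⊛-assoc _ _ r ⟩
      constant -[1+ 1 ] ⊛ (⊝ (τ ⊛ σ) ⊛ r)  ≡⟨ cong (constant -[1+ 1 ] ⊛_) (trans (⊝-⊛ˡ (τ ⊛ σ) r) (cong ⊝_ (trans (⊛-assoc τ σ r) (trans (cong (τ ⊛_) σr) (⊛-zeroʳ τ))))) ⟩
      constant -[1+ 1 ] ⊛ ⊝ 𝟘              ≡⟨ trans (cong (constant -[1+ 1 ] ⊛_) (⊝-constant 0ℤ)) (⊛-zeroʳ _) ⟩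
      𝟘 ∎
    second : top ((constant N ⊛ ε) ^Λ n ⊛ r) ≡ -[1+ 1 ] ℤ.* (N ℤ.^ n ℤ.* F)
    second = begin
      top ((constant N ⊛ ε) ^Λ n ⊛ r)
        ≡⟨ cong top (trans (cong (_⊛ r) (pow-constant N ε n)) (constant-pull -[1+ 1 ] _ (σ ⊛ τ))) ⟩
      top (constant -[1+ 1 ] ⊛ (constant (N ℤ.^ n) ⊛ ε ^Λ n ⊛ (σ ⊛ τ)))
        ≡⟨ cong (λ t → top (constant -[1+ 1 ] ⊛ t)) (⊛-assoc (constant (N ℤ.^ n)) (ε ^Λ n) (σ ⊛ τ)) ⟩
      top (constant -[1+ 1 ] ⊛ (constant (N ℤ.^ n) ⊛ (ε ^Λ n ⊛ (σ ⊛ τ))))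
        ≡⟨ trans (top-constant-⊛ -[1+ 1 ] (constant (N ℤ.^ n) ⊛ (ε ^Λ n ⊛ (σ ⊛ τ)))) (cong (-[1+ 1 ] ℤ.*_) (top-constant-⊛ (N ℤ.^ n) (ε ^Λ n ⊛ (σ ⊛ τ)))) ⟩
      -[1+ 1 ] ℤ.* (N ℤ.^ n ℤ.* top (ε ^Λ n ⊛ (σ ⊛ τ)))
        ≡⟨ cong (λ t → -[1+ 1 ] ℤ.* (N ℤ.^ n ℤ.* t)) (top-∑gengen^n∸1 n M refl) ⟩
      -[1+ 1 ] ℤ.* (N ℤ.^ n ℤ.* F) ∎

  pos-^ : ∀ b n → (+ b) ℤ.^ n ≡ + (b ℕ.^ n)
  pos-^ b zero    = refl
  pos-^ b (suc n) = trans (cong (+ b ℤ.*_) (pos-^ b n)) (sym (ℤP.pos-* b (b ℕ.^ n)))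

  top-esym : ∀ n → let M = 2 ℕ.* suc n in (qs : List (Λ M)) → All SquareZero qs →
    sum qs ≡ ∑triads M →
    top (esym qs (suc n)) ≡ + (suc M ℕ.^ n)
  top-esym n qs h e = trans (ℤP.*-cancelˡ-≡ (+ (suc n !)) (top (esym qs (suc n))) _ {{nonzero}} (begin
    + (suc n !) ℤ.* top (esym qs (suc n))         ≡⟨ top-constant-⊛ (+ (suc n !)) (esym qs (suc n)) ⟨
    top (constant (+ (suc n !)) ⊛ esym qs (suc n)) ≡⟨ cong top (!-esym qs h (suc n)) ⟩
    top (sum qs ^Λ suc n)                         ≡⟨ cong (λ t → top (t ^Λ suc n)) e ⟩
    top (∑triads (2 ℕ.* suc n) ^Λ suc n)          ≡⟨ top-∑<<-vertex n ⟩
    + (suc n !) ℤ.* (+ suc (2 ℕ.* suc n)) ℤ.^ n   ∎)) (pos-^ (suc (2 ℕ.* suc n)) n)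
    where
    nonzero : ℤ.NonZero (+ (suc n !))
    nonzero = ℕP._!≢0 (suc n)

open TripleSum

-- Cyclic words, their exterior elements, and signs

module Words where

  odd : ℕ → Bool
  odd zero    = false
  odd (suc n) = not (odd n)

  odd-+ : ∀ m n → odd (m ℕ.+ n) ≡ odd m xor odd n
  odd-+ zero    n = refl
  odd-+ (suc m) n = trans (cong not (odd-+ m n)) (BoolP.not-distribˡ-xor (odd m) (odd n))

  OddLength : ∀ {A : Set} → List A → Set
  OddLength xs = odd (length xs) ≡ true

  odd-suc⁻ : ∀ n {b} → odd (suc n) ≡ b → odd n ≡ not b
  odd-suc⁻ n e = trans (sym (BoolP.not-involutive (odd n))) (cong not e)

  oddLength-++-comm : ∀ {A : Set} (xs ys : List A) → OddLength (xs ++ ys) → OddLength (ys ++ xs)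
  oddLength-++-comm xs ys o = trans (cong odd (trans (ListP.length-++ ys) (trans (ℕP.+-comm (length ys) (length xs)) (sym (ListP.length-++ xs))))) o

  module _ {M : ℕ} where

    private V = Fin (suc M)

    δ : V → V → Λ M
    δ a b = vertex b ⊕ ⊝ vertex a

    odd-δ : ∀ a b → Odd (δ a b)
    odd-δ a b = odd-⊕ (odd-vertex b) (odd-⊝ (odd-vertex a))

    δ-trans : ∀ a b c → δ a c ≡ δ a b ⊕ δ b c
    δ-trans a b c = linear (vertex a ∷ vertex b ∷ vertex c ∷ []) (v₂ :+ :- v₀) ((v₁ :+ :- v₀) :+ (v₂ :+ :- v₁)) refl

    δ-sym : ∀ a b → δ a b ≡ ⊝ δ b a
    δ-sym a b = linear (vertex a ∷ vertex b ∷ []) (v₁ :+ :- v₀) (:- (v₀ :+ :- v₁)) refl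

    q : V → V → V → Λ M
    q a b c = triad (vertex a) (vertex b) (vertex c)

    even-q : ∀ a b c → Even (q a b c)
    even-q a b c = odd-⊛-odd (odd-δ a b) (odd-δ b c)

    q-square : ∀ a b c → q a b c ⊛ q a b c ≡ 𝟘
    q-square a b c = begin
      q a b c ⊛ q a b c                      ≡⟨ cong (_⊛ q a b c) (odd-anticomm (δ a b) (δ b c) (odd-δ a b) (odd-δ b c)) ⟩
      ⊝ (δ b c ⊛ δ a b) ⊛ (δ a b ⊛ δ b c)    ≡⟨ ⊝-⊛ˡ _ _ ⟩
      ⊝ (δ b c ⊛ δ a b ⊛ (δ a b ⊛ δ b c))    ≡⟨ cong ⊝_ (⊛-assoc (δ b c) (δ a b) _) ⟩
      ⊝ (δ b c ⊛ (δ a b ⊛ (δ a b ⊛ δ b c)))  ≡⟨ cong (λ t → ⊝ (δ b c ⊛ t)) (trans (sym (⊛-assoc (δ a b) (δ a b) (δ b c)))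
                                                  (trans (cong (_⊛ δ b c) (odd-square _ (odd-δ a b))) (⊛-zeroˡ (δ b c)))) ⟩
      ⊝ (δ b c ⊛ 𝟘)                          ≡⟨ trans (cong ⊝_ (⊛-zeroʳ (δ b c))) (⊝-constant 0ℤ) ⟩
      𝟘 ∎

    steps : V → List V → Λ M
    steps x []       = 𝟙
    steps x (y ∷ ys) = δ x y ⊛ steps y ys

    wordΛ : List V → Λ M
    wordΛ []       = 𝟙
    wordΛ (x ∷ xs) = steps x xs

    even-steps : ∀ x xs → odd (length xs) ≡ false → Even (steps x xs)
    odd-steps  : ∀ x xs → odd (length xs) ≡ true → Odd (steps x xs)
    even-steps x []       _ = bar-constant 1ℤ
    even-steps x (y ∷ ys) p = odd-⊛-odd (odd-δ x y) (odd-steps y ys (odd-suc⁻ (length ys) p))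
    odd-steps  x (y ∷ ys) p = odd-⊛-even (odd-δ x y) (even-steps y ys (odd-suc⁻ (length ys) p))

    even-wordΛ : ∀ w → OddLength w → Even (wordΛ w)
    even-wordΛ (x ∷ xs) o = even-steps x xs (odd-suc⁻ (length xs) o)

    -- Moving the right-hand x leftwards past y only replaces y by `bar y`, after which the two
    -- copies of x meet.
    sandwich : ∀ (x y : Λ M) → Odd x → x ⊛ y ⊛ x ≡ 𝟘
    sandwich x y o = begin
      x ⊛ y ⊛ x          ≡⟨ ⊛-assoc x y x ⟩
      x ⊛ (y ⊛ x)        ≡⟨ cong (λ t → x ⊛ (t ⊛ x)) (bar-involutive y) ⟨
      x ⊛ (bar (bar y) ⊛ x) ≡⟨ cong (x ⊛_) (odd-comm x (bar y) o) ⟨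
      x ⊛ (x ⊛ bar y)    ≡⟨ ⊛-assoc x x (bar y) ⟨
      x ⊛ x ⊛ bar y      ≡⟨ trans (cong (_⊛ bar y) (odd-square x o)) (⊛-zeroˡ (bar y)) ⟩
      𝟘 ∎

    -- Split `δ x v` at the second letter y. The part `δ x y` repeats the first factor of the
    -- product, and the part `δ y v` is annihilated by the tail.
    steps-kills : ∀ x xs {v} → v ∈ xs → steps x xs ⊛ δ x v ≡ 𝟘
    steps-kills x (y ∷ ys) (here refl) = sandwich (δ x y) (steps y ys) (odd-δ x y)
    steps-kills x (y ∷ ys) {v} (there p) = begin
      δ x y ⊛ steps y ys ⊛ δ x v
        ≡⟨ cong (δ x y ⊛ steps y ys ⊛_) (δ-trans x y v) ⟩
      δ x y ⊛ steps y ys ⊛ (δ x y ⊕ δ y v)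
        ≡⟨ ⊛-distribˡ (δ x y ⊛ steps y ys) (δ x y) (δ y v) ⟩
      δ x y ⊛ steps y ys ⊛ δ x y ⊕ δ x y ⊛ steps y ys ⊛ δ y v
        ≡⟨ cong₂ _⊕_ (sandwich (δ x y) (steps y ys) (odd-δ x y)) (⊛-assoc (δ x y) (steps y ys) (δ y v)) ⟩
      𝟘 ⊕ δ x y ⊛ (steps y ys ⊛ δ y v)
        ≡⟨ trans (⊕-identityˡ _) (cong (δ x y ⊛_) (steps-kills y ys p)) ⟩
      δ x y ⊛ 𝟘
        ≡⟨ ⊛-zeroʳ (δ x y) ⟩
      𝟘 ∎

    wordΛ-kills : ∀ w {u v} → u ∈ w → v ∈ w → wordΛ w ⊛ δ u v ≡ 𝟘
    wordΛ-kills (x ∷ xs) {u} {v} p p′ = begin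
      steps x xs ⊛ δ u v                                ≡⟨ cong (steps x xs ⊛_) (trans (δ-trans u x v) (cong (_⊕ δ x v) (δ-sym u x))) ⟩
      steps x xs ⊛ (⊝ δ x u ⊕ δ x v)                    ≡⟨ ⊛-distribˡ (steps x xs) (⊝ δ x u) (δ x v) ⟩
      steps x xs ⊛ ⊝ δ x u ⊕ steps x xs ⊛ δ x v         ≡⟨ cong₂ _⊕_ (trans (⊝-⊛ʳ _ _) (trans (cong ⊝_ (kill p)) (⊝-constant 0ℤ))) (kill p′) ⟩
      𝟘 ⊕ 𝟘                                             ≡⟨ ⊕-identityˡ 𝟘 ⟩
      𝟘 ∎
      where
      kill : ∀ {v} → v ∈ (x ∷ xs) → steps x xs ⊛ δ x v ≡ 𝟘
      kill (here refl) = trans (cong (steps x xs ⊛_) (⊝-inverseʳ (vertex x))) (⊛-zeroʳ _)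
      kill (there p)   = steps-kills x xs p

    -- The true step across the junction starts from the last letter before `b`. Starting it from
    -- `a` instead changes it by a difference of two letters of `a ∷ xs`, which `steps a xs`
    -- annihilates. Rotation and merging both rest on this freedom.
    steps-++ : ∀ a xs b ys → steps a (xs ++ b ∷ ys) ≡ steps a xs ⊛ (δ a b ⊛ steps b ys)
    steps-++ a []       b ys = sym (⊛-identityˡ _)
    steps-++ a (x ∷ xs) b ys = begin
      δ a x ⊛ steps x (xs ++ b ∷ ys)
        ≡⟨ cong (δ a x ⊛_) (steps-++ x xs b ys) ⟩
      δ a x ⊛ (steps x xs ⊛ (δ x b ⊛ steps b ys))
        ≡⟨ trans (sym (⊛-assoc _ _ _)) (sym (⊛-assoc _ _ _)) ⟩
      δ a x ⊛ steps x xs ⊛ δ x b ⊛ steps b ys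
        ≡⟨ cong (_⊛ steps b ys) (⊕-identityˡ _) ⟨
      (𝟘 ⊕ δ a x ⊛ steps x xs ⊛ δ x b) ⊛ steps b ys
        ≡⟨ cong (λ t → (t ⊕ δ a x ⊛ steps x xs ⊛ δ x b) ⊛ steps b ys) (sandwich (δ a x) (steps x xs) (odd-δ a x)) ⟨
      (δ a x ⊛ steps x xs ⊛ δ a x ⊕ δ a x ⊛ steps x xs ⊛ δ x b) ⊛ steps b ys
        ≡⟨ cong (_⊛ steps b ys) (trans (cong (steps a (x ∷ xs) ⊛_) (δ-trans a x b)) (⊛-distribˡ (steps a (x ∷ xs)) (δ a x) (δ x b))) ⟨
      δ a x ⊛ steps x xs ⊛ δ a b ⊛ steps b ys
        ≡⟨ ⊛-assoc _ _ _ ⟩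
      δ a x ⊛ steps x xs ⊛ (δ a b ⊛ steps b ys) ∎

    -- The first difference passes an odd product and picks up a sign, which `δ x y ≡ ⊝ δ y x`
    -- cancels. By `steps-++`, `δ y x` then serves as the step from the last letter back to x.
    wordΛ-snoc : ∀ x xs → OddLength (x ∷ xs) → wordΛ (x ∷ xs) ≡ wordΛ (xs ++ x ∷ [])
    wordΛ-snoc x []       o = refl
    wordΛ-snoc x (y ∷ ys) o = begin
      δ x y ⊛ steps y ys          ≡⟨ odd-comm (δ x y) (steps y ys) (odd-δ x y) ⟩
      bar (steps y ys) ⊛ δ x y    ≡⟨ cong₂ _⊛_ (odd-steps y ys (trans (sym (BoolP.not-involutive (odd (length ys)))) o)) (δ-sym x y) ⟩
      ⊝ steps y ys ⊛ ⊝ δ y x      ≡⟨ trans (⊝-⊛ˡ _ _) (trans (cong ⊝_ (⊝-⊛ʳ _ _)) (⊝-involutive _)) ⟩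
      steps y ys ⊛ δ y x          ≡⟨ cong (steps y ys ⊛_) (⊛-identityʳ (δ y x)) ⟨
      steps y ys ⊛ (δ y x ⊛ 𝟙)    ≡⟨ steps-++ y ys x [] ⟨
      steps y (ys ++ x ∷ [])      ∎

    wordΛ-rotate : ∀ xs ys → OddLength (xs ++ ys) → wordΛ (xs ++ ys) ≡ wordΛ (ys ++ xs)
    wordΛ-rotate []       ys o = cong wordΛ (sym (ListP.++-identityʳ ys))
    wordΛ-rotate (x ∷ xs) ys o = begin
      wordΛ (x ∷ xs ++ ys)            ≡⟨ wordΛ-snoc x (xs ++ ys) o ⟩
      wordΛ ((xs ++ ys) ++ x ∷ [])    ≡⟨ cong wordΛ assoc ⟩
      wordΛ (xs ++ (ys ++ x ∷ []))    ≡⟨ wordΛ-rotate xs (ys ++ x ∷ []) (subst OddLength assoc (oddLength-++-comm (x ∷ []) (xs ++ ys) o)) ⟩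
      wordΛ ((ys ++ x ∷ []) ++ xs)    ≡⟨ cong wordΛ (ListP.++-assoc ys (x ∷ []) xs) ⟩
      wordΛ (ys ++ x ∷ xs)            ∎
      where
      assoc : (xs ++ ys) ++ x ∷ [] ≡ xs ++ (ys ++ x ∷ [])
      assoc = ListP.++-assoc xs ys (x ∷ [])

    -- By `steps-++` the two junctions contribute `δ a b` and `δ b c`, whose product is q. Words of
    -- odd length are even elements, so they can be moved out from between these two factors.
    wordΛ-merge : ∀ a A b B c C → OddLength (a ∷ A) → OddLength (b ∷ B) →
      wordΛ ((a ∷ A) ++ (b ∷ B) ++ (c ∷ C)) ≡ q a b c ⊛ (wordΛ (a ∷ A) ⊛ (wordΛ (b ∷ B) ⊛ wordΛ (c ∷ C)))
    wordΛ-merge a A b B c C oA oB = begin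
      steps a (A ++ b ∷ (B ++ c ∷ C))
        ≡⟨ trans (steps-++ a A b (B ++ c ∷ C)) (cong (λ t → sA ⊛ (δ a b ⊛ t)) (steps-++ b B c C)) ⟩
      sA ⊛ (δ a b ⊛ (sB ⊛ (δ b c ⊛ sC)))
        ≡⟨ cong (λ t → sA ⊛ (δ a b ⊛ t)) (trans (sym (⊛-assoc sB _ _)) (trans (cong (_⊛ sC) (even-comm sB (δ b c) (even-wordΛ (b ∷ B) oB))) (⊛-assoc (δ b c) sB sC))) ⟩
      sA ⊛ (δ a b ⊛ (δ b c ⊛ (sB ⊛ sC)))
        ≡⟨ cong (sA ⊛_) (sym (⊛-assoc (δ a b) (δ b c) _)) ⟩
      sA ⊛ (q a b c ⊛ (sB ⊛ sC))
        ≡⟨ trans (sym (⊛-assoc sA _ _)) (trans (cong (_⊛ (sB ⊛ sC)) (even-comm sA (q a b c) (even-wordΛ (a ∷ A) oA))) (⊛-assoc (q a b c) sA _)) ⟩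
      q a b c ⊛ (sA ⊛ (sB ⊛ sC)) ∎
      where
      sA = steps a A
      sB = steps b B
      sC = steps c C

    wordsΛ : List (List V) → Λ M
    wordsΛ []       = 𝟙
    wordsΛ (w ∷ ws) = wordΛ w ⊛ wordsΛ ws

    wordsΛ-↭ : ∀ {ws ws′} → All OddLength ws → ws ↭ ws′ → wordsΛ ws ≡ wordsΛ ws′
    wordsΛ-↭ h            Perm.refl          = refl
    wordsΛ-↭ (o ∷ h)      (Perm.prep w p)    = cong (wordΛ w ⊛_) (wordsΛ-↭ h p)
    wordsΛ-↭ (o ∷ o′ ∷ h) (Perm.swap w w′ p) = begin
      wordΛ w ⊛ (wordΛ w′ ⊛ _)  ≡⟨ cong (λ t → wordΛ w ⊛ (wordΛ w′ ⊛ t)) (wordsΛ-↭ h p) ⟩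
      wordΛ w ⊛ (wordΛ w′ ⊛ _)  ≡⟨ ⊛-assoc (wordΛ w) (wordΛ w′) _ ⟨
      wordΛ w ⊛ wordΛ w′ ⊛ _    ≡⟨ cong (_⊛ _) (even-comm (wordΛ w) (wordΛ w′) (even-wordΛ w o)) ⟩
      wordΛ w′ ⊛ wordΛ w ⊛ _    ≡⟨ ⊛-assoc (wordΛ w′) (wordΛ w) _ ⟩
      wordΛ w′ ⊛ (wordΛ w ⊛ _)  ∎
    wordsΛ-↭ h (Perm.trans p p′) = trans (wordsΛ-↭ h p) (wordsΛ-↭ (PermP.All-resp-↭ p h) p′)

    wordsΛ-kills : ∀ {ws w u v} → All OddLength ws → w ∈ ws → u ∈ w → v ∈ w → δ u v ⊛ wordsΛ ws ≡ 𝟘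
    wordsΛ-kills {w ∷ ws} {_} {u} {v} (o ∷ h) (here refl) p p′ = begin
      δ u v ⊛ (wordΛ w ⊛ wordsΛ ws)  ≡⟨ ⊛-assoc (δ u v) (wordΛ w) (wordsΛ ws) ⟨
      δ u v ⊛ wordΛ w ⊛ wordsΛ ws    ≡⟨ cong (_⊛ wordsΛ ws) (trans (sym (even-comm (wordΛ w) (δ u v) (even-wordΛ w o))) (wordΛ-kills w p p′)) ⟩
      𝟘 ⊛ wordsΛ ws                  ≡⟨ ⊛-zeroˡ _ ⟩
      𝟘 ∎
    wordsΛ-kills {w ∷ ws} {_} {u} {v} (o ∷ h) (there m) p p′ = begin
      δ u v ⊛ (wordΛ w ⊛ wordsΛ ws)  ≡⟨ ⊛-assoc (δ u v) (wordΛ w) (wordsΛ ws) ⟨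
      δ u v ⊛ wordΛ w ⊛ wordsΛ ws    ≡⟨ cong (_⊛ wordsΛ ws) (even-comm (wordΛ w) (δ u v) (even-wordΛ w o)) ⟨
      wordΛ w ⊛ δ u v ⊛ wordsΛ ws    ≡⟨ ⊛-assoc (wordΛ w) (δ u v) (wordsΛ ws) ⟩
      wordΛ w ⊛ (δ u v ⊛ wordsΛ ws)  ≡⟨ cong (wordΛ w ⊛_) (wordsΛ-kills h m p p′) ⟩
      wordΛ w ⊛ 𝟘                    ≡⟨ ⊛-zeroʳ _ ⟩
      𝟘 ∎

    q-kills-ab : ∀ a b c x → δ a b ⊛ x ≡ 𝟘 → q a b c ⊛ x ≡ 𝟘
    q-kills-ab a b c x e = begin
      δ a b ⊛ δ b c ⊛ x        ≡⟨ cong (_⊛ x) (odd-anticomm (δ a b) (δ b c) (odd-δ a b) (odd-δ b c)) ⟩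
      ⊝ (δ b c ⊛ δ a b) ⊛ x    ≡⟨ trans (⊝-⊛ˡ _ x) (cong ⊝_ (⊛-assoc (δ b c) (δ a b) x)) ⟩
      ⊝ (δ b c ⊛ (δ a b ⊛ x))  ≡⟨ trans (cong ⊝_ (trans (cong (δ b c ⊛_) e) (⊛-zeroʳ _))) (⊝-constant 0ℤ) ⟩
      𝟘 ∎

    q-kills-bc : ∀ a b c x → δ b c ⊛ x ≡ 𝟘 → q a b c ⊛ x ≡ 𝟘
    q-kills-bc a b c x e = trans (⊛-assoc (δ a b) (δ b c) x) (trans (cong (δ a b ⊛_) e) (⊛-zeroʳ _))

    -- Writing `δ b c` as `δ a c` minus `δ a b` and using that `δ a b` squares to zero shows that q
    -- is also `δ a b ⊛ δ a c`.
    q-kills-ac : ∀ a b c x → δ a c ⊛ x ≡ 𝟘 → q a b c ⊛ x ≡ 𝟘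
    q-kills-ac a b c x e = begin
      δ a b ⊛ δ b c ⊛ x                ≡⟨ cong (λ t → δ a b ⊛ t ⊛ x) (trans (δ-trans b a c) (cong (_⊕ δ a c) (δ-sym b a))) ⟩
      δ a b ⊛ (⊝ δ a b ⊕ δ a c) ⊛ x    ≡⟨ cong (_⊛ x) (⊛-distribˡ (δ a b) (⊝ δ a b) (δ a c)) ⟩
      (δ a b ⊛ ⊝ δ a b ⊕ δ a b ⊛ δ a c) ⊛ x
        ≡⟨ cong (λ t → (t ⊕ δ a b ⊛ δ a c) ⊛ x) (trans (⊝-⊛ʳ (δ a b) (δ a b)) (trans (cong ⊝_ (odd-square _ (odd-δ a b))) (⊝-constant 0ℤ))) ⟩
      (𝟘 ⊕ δ a b ⊛ δ a c) ⊛ x          ≡⟨ cong (_⊛ x) (⊕-identityˡ _) ⟩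
      δ a b ⊛ δ a c ⊛ x                ≡⟨ trans (⊛-assoc (δ a b) (δ a c) x) (trans (cong (δ a b ⊛_) e) (⊛-zeroʳ _)) ⟩
      𝟘 ∎

    ∏vertex : List V → Λ M
    ∏vertex []       = 𝟙
    ∏vertex (x ∷ xs) = vertex x ⊛ ∏vertex xs

    -- A factor `vertex x` in front absorbs the term `⊝ vertex x` of the next difference, leaving
    -- `vertex y` to do the same one letter later.
    vertex-⊛-steps : ∀ x xs → vertex x ⊛ steps x xs ≡ vertex x ⊛ ∏vertex xs
    vertex-⊛-steps x []       = refl
    vertex-⊛-steps x (y ∷ ys) = begin
      vertex x ⊛ ((vertex y ⊕ ⊝ vertex x) ⊛ steps y ys)
        ≡⟨ ⊛-assoc _ _ _ ⟨
      vertex x ⊛ (vertex y ⊕ ⊝ vertex x) ⊛ steps y ys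
        ≡⟨ cong (_⊛ steps y ys) (trans (⊛-distribˡ (vertex x) (vertex y) (⊝ vertex x)) (trans (cong (vertex x ⊛ vertex y ⊕_)
             (trans (⊝-⊛ʳ _ _) (trans (cong ⊝_ (odd-square _ (odd-vertex x))) (⊝-constant 0ℤ)))) (⊕-identityʳ _))) ⟩
      vertex x ⊛ vertex y ⊛ steps y ys
        ≡⟨ trans (⊛-assoc _ _ _) (cong (vertex x ⊛_) (vertex-⊛-steps y ys)) ⟩
      vertex x ⊛ (vertex y ⊛ ∏vertex ys) ∎

    -- Here the choice θ_0 = 0 pays off: the first difference is a bare generator, and every later
    -- subtraction is absorbed, so the element is a monomial.
    steps-zero : ∀ xs → steps zero xs ≡ ∏vertex xs
    steps-zero []       = refl
    steps-zero (y ∷ ys) = trans (cong (_⊛ steps y ys) (linear (vertex y ∷ []) (v₀ :+ :- :0) v₀ refl)) (vertex-⊛-steps y ys)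

  sign : ℕ → ℤ
  sign zero    = 1ℤ
  sign (suc n) = ℤ.- sign n

  sign-+ : ∀ m n → sign (m ℕ.+ n) ≡ sign m ℤ.* sign n
  sign-+ zero    n = sym (ℤP.*-identityˡ (sign n))
  sign-+ (suc m) n = trans (cong ℤ.-_ (sign-+ m n)) (ℤP.neg-distribˡ-* (sign m) (sign n))

  smaller : ∀ {n} → Fin n → List (Fin n) → ℕ
  smaller x []       = 0
  smaller x (y ∷ ys) = (if lt y x then 1 else 0) ℕ.+ smaller x ys

  listInversions : ∀ {n} → List (Fin n) → ℕ
  listInversions []       = 0
  listInversions (x ∷ xs) = smaller x xs ℕ.+ listInversions xs

  smaller-++ : ∀ {n} (x : Fin n) ys zs → smaller x (ys ++ zs) ≡ smaller x ys ℕ.+ smaller x zs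
  smaller-++ x []       zs = refl
  smaller-++ x (y ∷ ys) zs = trans (cong (_ ℕ.+_) (smaller-++ x ys zs)) (sym (ℕP.+-assoc (if lt y x then 1 else 0) _ _))

  smaller-zero : ∀ {n} (xs : List (Fin (suc n))) → smaller zero xs ≡ 0
  smaller-zero []             = refl
  smaller-zero (x ∷ xs)       = smaller-zero xs

  smaller-map-suc : ∀ {n} (x : Fin n) xs → smaller (suc x) (List.map suc xs) ≡ smaller x xs
  smaller-map-suc x []       = refl
  smaller-map-suc x (y ∷ ys) = cong ((if lt y x then 1 else 0) ℕ.+_) (smaller-map-suc x ys)

  listInversions-map-suc : ∀ {n} (xs : List (Fin n)) → listInversions (List.map suc xs) ≡ listInversions xs
  listInversions-map-suc []       = refl
  listInversions-map-suc (x ∷ xs) = cong₂ ℕ._+_ (smaller-map-suc x xs) (listInversions-map-suc xs)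

  -- The minimum is inverted with exactly the letters before it. The same number counts the signs
  -- when its generator is pulled to the front.
  listInversions-insert-zero : ∀ {n} (xs : List (Fin n)) (ys : List (Fin (suc n))) →
    listInversions (List.map suc xs ++ zero ∷ ys) ≡ length xs ℕ.+ listInversions (List.map suc xs ++ ys)
  listInversions-insert-zero []       ys = cong (ℕ._+ listInversions ys) (smaller-zero ys)
  listInversions-insert-zero (x ∷ xs) ys = begin
    smaller (suc x) (X ++ zero ∷ ys) ℕ.+ listInversions (X ++ zero ∷ ys)
      ≡⟨ cong₂ ℕ._+_ (trans (smaller-++ (suc x) X (zero ∷ ys)) (ℕP.+-suc (smaller (suc x) X) _)) (listInversions-insert-zero xs ys) ⟩
    suc (smaller (suc x) X ℕ.+ smaller (suc x) ys) ℕ.+ (length xs ℕ.+ listInversions (X ++ ys))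
      ≡⟨ cong (λ t → suc (t ℕ.+ (length xs ℕ.+ listInversions (X ++ ys)))) (smaller-++ (suc x) X ys) ⟨
    suc (smaller (suc x) (X ++ ys) ℕ.+ (length xs ℕ.+ listInversions (X ++ ys)))
      ≡⟨ cong suc (begin
           S ℕ.+ (length xs ℕ.+ I)   ≡⟨ ℕP.+-assoc S (length xs) I ⟨
           S ℕ.+ length xs ℕ.+ I     ≡⟨ cong (ℕ._+ I) (ℕP.+-comm S (length xs)) ⟩
           length xs ℕ.+ S ℕ.+ I     ≡⟨ ℕP.+-assoc (length xs) S I ⟩
           length xs ℕ.+ (S ℕ.+ I)   ∎) ⟩
    suc (length xs ℕ.+ (S ℕ.+ I)) ∎
    where
    X = List.map suc xs
    S = smaller (suc x) (X ++ ys)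
    I = listInversions (X ++ ys)

  ∏gen : ∀ {m} → List (Fin m) → Λ m
  ∏gen []       = 𝟙
  ∏gen (x ∷ xs) = gen x ⊛ ∏gen xs

  ∏vertex-map-suc : ∀ {m} (xs : List (Fin m)) → ∏vertex (List.map suc xs) ≡ ∏gen xs
  ∏vertex-map-suc []       = refl
  ∏vertex-map-suc (x ∷ xs) = cong (gen x ⊛_) (∏vertex-map-suc xs)

  ∏gen-map-suc : ∀ {m} (xs : List (Fin m)) → ∏gen (List.map suc xs) ≡ (∏gen xs +θ 𝟘)
  ∏gen-map-suc []       = refl
  ∏gen-map-suc (x ∷ xs) = trans (cong ((gen x +θ 𝟘) ⊛_) (∏gen-map-suc xs)) (lift-⊛ (gen x) (∏gen xs))

  constant-neg : ∀ {m} z (x : Λ m) → constant (ℤ.- z) ⊛ x ≡ ⊝ (constant z ⊛ x)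
  constant-neg z x = trans (cong (_⊛ x) (sym (⊝-constant z))) (⊝-⊛ˡ (constant z) x)

  ∏gen-insert-zero : ∀ {m} (xs ys : List (Fin (suc m))) →
    ∏gen (xs ++ zero ∷ ys) ≡ constant (sign (length xs)) ⊛ (gen zero ⊛ ∏gen (xs ++ ys))
  ∏gen-insert-zero []       ys = sym (⊛-identityˡ _)
  ∏gen-insert-zero (x ∷ xs) ys = begin
    gen x ⊛ ∏gen (xs ++ zero ∷ ys)
      ≡⟨ trans (cong (gen x ⊛_) (∏gen-insert-zero xs ys)) (constant-pull (sign (length xs)) (gen x) (gen zero ⊛ ∏gen (xs ++ ys))) ⟩
    constant (sign (length xs)) ⊛ (gen x ⊛ (gen zero ⊛ ∏gen (xs ++ ys)))
      ≡⟨ cong (constant (sign (length xs)) ⊛_) (begin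
           gen x ⊛ (gen zero ⊛ P)    ≡⟨ ⊛-assoc _ _ _ ⟨
           gen x ⊛ gen zero ⊛ P      ≡⟨ cong (_⊛ P) (odd-anticomm (gen x) (gen zero) (odd-gen x) (odd-gen zero)) ⟩
           ⊝ (gen zero ⊛ gen x) ⊛ P  ≡⟨ trans (⊝-⊛ˡ _ P) (cong ⊝_ (⊛-assoc _ _ _)) ⟩
           ⊝ (gen zero ⊛ (gen x ⊛ P)) ∎) ⟩
    constant (sign (length xs)) ⊛ ⊝ (gen zero ⊛ (gen x ⊛ P))
      ≡⟨ trans (⊝-⊛ʳ _ _) (sym (constant-neg (sign (length xs)) _)) ⟩
    constant (ℤ.- sign (length xs)) ⊛ (gen zero ⊛ (gen x ⊛ P)) ∎
    where
    P = ∏gen (xs ++ ys)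

  top-gen-zero : ∀ {m} (a : Λ m) → top (gen zero ⊛ (a +θ 𝟘)) ≡ top a
  top-gen-zero a = cong top (trans (cong₂ _⊕_ (⊛-identityˡ a) (⊛-zeroʳ (bar 𝟘))) (⊕-identityʳ a))

  allFin-suc : ∀ n → allFin (suc n) ≡ zero ∷ List.map suc (allFin n)
  allFin-suc n = cong (zero ∷_) (sym (ListP.map-tabulate (λ x → x) suc))

  map-++⁻ : ∀ {A B : Set} (f : A → B) ws xs {ys} → List.map f ws ≡ xs ++ ys →
    ∃ λ us → ∃ λ vs → xs ≡ List.map f us × ys ≡ List.map f vs × ws ≡ us ++ vs
  map-++⁻ f ws       []       e = [] , ws , refl , sym e , refl
  map-++⁻ f (w ∷ ws) (x ∷ xs) e with ListP.∷-injective e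
  ... | refl , e′ with map-++⁻ f ws xs e′
  ... | us , vs , refl , e₂ , refl = w ∷ us , vs , refl , e₂ , refl

  -- Pull generator 0 to the front. The sign accounts for the inversions that involve 0, and the
  -- remaining letters form a shifted permutation word on one generator fewer.
  top-∏gen : ∀ {m} (w : List (Fin m)) → w ↭ allFin m → top (∏gen w) ≡ sign (listInversions w)
  top-∏gen {zero} w p rewrite PermP.↭-empty-inv p = refl
  top-∏gen {suc m} w p with ∈-∃++ (PermP.∈-resp-↭ (↭-sym p) (here refl))
  ... | xs , ys , refl with PermP.↭-map-inv suc (↭-sym (PermP.drop-mid xs [] (↭-trans p (↭-reflexive (allFin-suc m)))))
  ... | w′ , e , p′ with map-++⁻ suc w′ xs (sym e)
  ... | us , vs , refl , refl , refl = begin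
    top (∏gen (List.map suc us ++ zero ∷ List.map suc vs))
      ≡⟨ cong top (∏gen-insert-zero (List.map suc us) (List.map suc vs)) ⟩
    top (constant s ⊛ (gen zero ⊛ ∏gen (List.map suc us ++ List.map suc vs)))
      ≡⟨ cong (λ t → top (constant s ⊛ (gen zero ⊛ ∏gen t))) e ⟩
    top (constant s ⊛ (gen zero ⊛ ∏gen (List.map suc (us ++ vs))))
      ≡⟨ cong (λ t → top (constant s ⊛ (gen zero ⊛ t))) (∏gen-map-suc (us ++ vs)) ⟩
    top (constant s ⊛ (gen zero ⊛ (∏gen (us ++ vs) +θ 𝟘)))
      ≡⟨ top-constant-⊛ s (gen zero ⊛ (∏gen (us ++ vs) +θ 𝟘)) ⟩
    s ℤ.* top (gen zero ⊛ (∏gen (us ++ vs) +θ 𝟘))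
      ≡⟨ cong₂ ℤ._*_ (cong sign (ListP.length-map suc us)) (trans (top-gen-zero (∏gen (us ++ vs))) (top-∏gen (us ++ vs) (↭-sym p′))) ⟩
    sign (length us) ℤ.* sign (listInversions (us ++ vs))
      ≡⟨ sign-+ (length us) (listInversions (us ++ vs)) ⟨
    sign (length us ℕ.+ listInversions (us ++ vs))
      ≡⟨ cong (λ t → sign (length us ℕ.+ t)) (trans (cong listInversions e) (listInversions-map-suc (us ++ vs))) ⟨
    sign (length us ℕ.+ listInversions (List.map suc us ++ List.map suc vs))
      ≡⟨ cong sign (listInversions-insert-zero us (List.map suc vs)) ⟨
    sign (listInversions (List.map suc us ++ zero ∷ List.map suc vs)) ∎
    where
    s = sign (length (List.map suc us))

open Words

-- The sign of a permutation through inversions of a list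

module Inversions where

  does-<? : ∀ {n} (a b : Fin n) → does (a Fin.<? b) ≡ lt a b
  does-<? a       zero    = refl
  does-<? zero    (suc b) = refl
  does-<? (suc a) (suc b) = does-<? a b

  ⟦_⟧ : Bool → ℕ
  ⟦ b ⟧ = if b then 1 else 0

  ∑ℕ : ∀ {n} → (Fin n → ℕ) → ℕ
  ∑ℕ {zero}  f = 0
  ∑ℕ {suc n} f = f zero ℕ.+ ∑ℕ (f ∘ suc)

  inversion : ∀ {m n} → (Fin m → Fin n) → Fin m → Fin m → ℕ
  inversion s x y = if lt x y then ⟦ lt (s y) (s x) ⟧ else 0

  ∑-inversion-row : ∀ {m n} (s : Fin m → Fin n) (x : Fin n) → ∑ℕ (λ y → ⟦ lt (s y) x ⟧) ≡ smaller x (tabulate s)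
  ∑-inversion-row {zero}  s x = refl
  ∑-inversion-row {suc m} s x = cong (⟦ lt (s zero) x ⟧ ℕ.+_) (∑-inversion-row (s ∘ suc) x)

  ∑-inversion : ∀ {m n} (s : Fin m → Fin n) → ∑ℕ (λ x → ∑ℕ (inversion s x)) ≡ listInversions (tabulate s)
  ∑-inversion {zero}  s = refl
  ∑-inversion {suc m} s = cong₂ ℕ._+_ (∑-inversion-row (s ∘ suc) (s zero)) (∑-inversion (s ∘ suc))

  module _ {N : ℕ} (s : Fin N → Fin N) where

    private
      Inverted? : (p : Fin N × Fin N) → Dec (s (proj₂ p) Fin.< s (proj₁ p))
      Inverted? p = s (proj₂ p) Fin.<? s (proj₁ p)
      Ordered? : (p : Fin N × Fin N) → Dec (proj₁ p Fin.< proj₂ p)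
      Ordered? p = proj₁ p Fin.<? proj₂ p
      count : List (Fin N × Fin N) → ℕ
      count ps = length (filter Inverted? (filter Ordered? ps))

    count-∷ : ∀ x y ps → count ((x , y) ∷ ps) ≡ inversion s x y ℕ.+ count ps
    count-∷ x y ps with does (x Fin.<? y) | does-<? x y
    ... | false | e rewrite sym e = refl
    ... | true  | e rewrite sym e with does (s y Fin.<? s x) | does-<? (s y) (s x)
    ... | false | e′ rewrite sym e′ = refl
    ... | true  | e′ rewrite sym e′ = refl

    count-++ : ∀ ps qs → count (ps ++ qs) ≡ count ps ℕ.+ count qs
    count-++ ps qs = trans (cong (length ∘ filter Inverted?) (ListP.filter-++ Ordered? ps qs))
      (trans (cong length (ListP.filter-++ Inverted? (filter Ordered? ps) _)) (ListP.length-++ (filter Inverted? (filter Ordered? ps))))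

    count-row : ∀ {m} (x : Fin N) (f : Fin m → Fin N) → count (List.map (λ y → (x , y)) (tabulate f)) ≡ ∑ℕ (inversion s x ∘ f)
    count-row {zero}  x f = refl
    count-row {suc m} x f = trans (count-∷ x (f zero) _) (cong (inversion s x (f zero) ℕ.+_) (count-row x (f ∘ suc)))

    count-rows : ∀ {m} (f : Fin m → Fin N) →
      count (concatMap (λ x → List.map (λ y → (x , y)) (allFin N)) (tabulate f)) ≡ ∑ℕ (λ x → ∑ℕ (inversion s (f x)))
    count-rows {zero}  f = refl
    count-rows {suc m} f = trans (count-++ (List.map (λ y → (f zero , y)) (allFin N)) _)
      (cong₂ ℕ._+_ (count-row (f zero) id) (count-rows (f ∘ suc)))

    inversions-list : inversions s ≡ listInversions (tabulate s)
    inversions-list = trans (count-rows id) (∑-inversion s)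

  parity-sign : ∀ k → (if ⌊ (k % 2) ℕ.≟ 0 ⌋ then + 1 else -[1+ 0 ]) ≡ sign k
  parity-sign zero          = refl
  parity-sign (suc zero)    = refl
  parity-sign (suc (suc k)) = begin
    (if ⌊ (suc (suc k) % 2) ℕ.≟ 0 ⌋ then + 1 else -[1+ 0 ])
      ≡⟨ cong (λ r → if ⌊ r ℕ.≟ 0 ⌋ then + 1 else -[1+ 0 ]) (trans (cong (_% 2) (ℕP.+-comm 2 k)) ([m+n]%n≡m%n k 2)) ⟩
    (if ⌊ (k % 2) ℕ.≟ 0 ⌋ then + 1 else -[1+ 0 ])
      ≡⟨ parity-sign k ⟩
    sign k
      ≡⟨ ℤP.neg-involutive (sign k) ⟨
    ℤ.- ℤ.- sign k ∎

  signPerm-list : ∀ {N} (s : Fin N → Fin N) → signPerm s ≡ sign (listInversions (tabulate s))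
  signPerm-list s = trans (parity-sign (inversions s)) (cong sign (inversions-list s))

open Inversions

-- Cycles, walks and simple paths of triples

module Cycles where

  triple-≡ : ∀ {N} {s t : Triple N} → i s ≡ i t → j s ≡ j t → k s ≡ k t → s ≡ t
  triple-≡ {s = triple a b c p q} {triple .a .b .c p′ q′} refl refl refl =
    cong₂ (triple a b c) (ℕP.<-irrelevant p p′) (ℕP.<-irrelevant q q′)

  _≟ₜ_ : ∀ {N} (s t : Triple N) → Dec (s ≡ t)
  s ≟ₜ t = map′ (λ (p , q , r) → triple-≡ p q r) (λ { refl → refl , refl , refl })
    (i s Fin.≟ i t ×-dec j s Fin.≟ j t ×-dec k s Fin.≟ k t)

  toℕ-next : ∀ {ℓ} (r : Fin (suc ℓ)) → toℕ (next r) ≡ suc (toℕ r) % suc ℓ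
  toℕ-next {ℓ} r = FinP.toℕ-fromℕ< (m%n<n (suc (toℕ r)) (suc ℓ))

  iter-suc : ∀ {A : Set} (f : A → A) k x → iter f k (f x) ≡ f (iter f k x)
  iter-suc f zero    x = refl
  iter-suc f (suc k) x = cong f (iter-suc f k x)

  toℕ-iter-next : ∀ {ℓ} k (r : Fin (suc ℓ)) → toℕ (iter next k r) ≡ (toℕ r ℕ.+ k) % suc ℓ
  toℕ-iter-next {ℓ} zero    r = trans (sym (m<n⇒m%n≡m (FinP.toℕ<n r))) (cong (_% suc ℓ) (sym (ℕP.+-identityʳ (toℕ r))))
  toℕ-iter-next {ℓ} (suc k) r = begin
    toℕ (next (iter next k r))              ≡⟨ toℕ-next (iter next k r) ⟩
    suc (toℕ (iter next k r)) % suc ℓ       ≡⟨ cong (λ t → suc t % suc ℓ) (toℕ-iter-next k r) ⟩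
    (1 ℕ.+ x % suc ℓ) % suc ℓ               ≡⟨ %-distribˡ-+ 1 (x % suc ℓ) (suc ℓ) ⟩
    (1 % suc ℓ ℕ.+ x % suc ℓ % suc ℓ) % suc ℓ ≡⟨ cong (λ t → (1 % suc ℓ ℕ.+ t) % suc ℓ) (m%n%n≡m%n x (suc ℓ)) ⟩
    (1 % suc ℓ ℕ.+ x % suc ℓ) % suc ℓ       ≡⟨ %-distribˡ-+ 1 x (suc ℓ) ⟨
    suc x % suc ℓ                           ≡⟨ cong (_% suc ℓ) (ℕP.+-suc (toℕ r) k) ⟨
    (toℕ r ℕ.+ suc k) % suc ℓ               ∎
    where
    x = toℕ r ℕ.+ k

  iter-next-period : ∀ {ℓ} (r : Fin (suc ℓ)) → iter next (suc ℓ) r ≡ r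
  iter-next-period {ℓ} r = FinP.toℕ-injective (trans (toℕ-iter-next (suc ℓ) r)
    (trans ([m+n]%n≡m%n (toℕ r) (suc ℓ)) (m<n⇒m%n≡m (FinP.toℕ<n r))))

  -- From `next r` the rotation returns to `r` through all other indices, so the step at `r` itself
  -- is never taken. This allows one triple of a cycle to be left out.
  around : ∀ {ℓ} (Q : Fin (suc ℓ) → Set) (r : Fin (suc ℓ)) →
    Q (next r) → (∀ x → x ≢ r → Q x → Q (next x)) → Q r
  around {ℓ} Q r base advance = finish (go ℓ)
    where
    -- The left summand records that the rotation has already met `r`; from then on nothing more is
    -- advanced.
    go : ∀ k → Q r ⊎ Q (iter next (suc k) r)
    go zero    = inj₂ base
    go (suc k) with go k
    ... | inj₁ q = inj₁ q
    ... | inj₂ q with iter next (suc k) r FinP.≟ r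
    ... | yes e = inj₁ (subst Q e q)
    ... | no  e = inj₂ (advance _ e q)
    finish : Q r ⊎ Q (iter next (suc ℓ) r) → Q r
    finish (inj₁ q) = q
    finish (inj₂ q) = subst Q (iter-next-period r) q

  next-cases : ∀ {ℓ} (r : Fin (suc ℓ)) → (toℕ r ≡ ℓ × next r ≡ zero) ⊎ (toℕ (next r) ≡ suc (toℕ r))
  next-cases {ℓ} r with toℕ r ℕ.≟ ℓ
  ... | yes e = inj₁ (e , FinP.toℕ-injective (trans (toℕ-next r) (trans (cong (λ t → suc t % suc ℓ) e) (n%n≡0 (suc ℓ)))))
  ... | no  e = inj₂ (trans (toℕ-next r) (m<n⇒m%n≡m (ℕ.s≤s (ℕP.≤∧≢⇒< (ℕP.<⇒≤pred (FinP.toℕ<n r)) e))))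

  unique-lookup : ∀ {A B : Set} (f : A → B) (L : List A) → Unique (List.map f L) →
    ∀ {r r′} → f (lookup L r) ≡ f (lookup L r′) → r ≡ r′
  unique-lookup f (x ∷ L) (h ∷ u) {zero}  {zero}   e = refl
  unique-lookup f (x ∷ L) (h ∷ u) {zero}  {suc r′} e = ⊥-elim (All.lookup h (∈-map⁺ f (∈-lookup r′)) e)
  unique-lookup f (x ∷ L) (h ∷ u) {suc r} {zero}   e = ⊥-elim (All.lookup h (∈-map⁺ f (∈-lookup r)) (sym e))
  unique-lookup f (x ∷ L) (h ∷ u) {suc r} {suc r′} e = cong suc (unique-lookup f L u e)

  headOr : ∀ {A : Set} → A → List A → A
  headOr z []      = z
  headOr z (x ∷ _) = x

  module _ {N : ℕ} where

    -- `Cycle` with membership in an array replaced by a predicate, so that the argument can run on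
    -- lists of triples that grow one at a time.
    record CycleOf (P : Triple N → Set) : Set where
      field
        m     : ℕ
        a     : Fin (suc (suc m)) → Fin N
        t     : Fin (suc (suc m)) → Triple N
        a-inj : Injective _≡_ _≡_ a
        t-inj : Injective _≡_ _≡_ t
        t∈P   : ∀ r → P (t r)
        a∈t   : ∀ r → a r ∈ᵥ t r
        a'∈t  : ∀ r → a (next r) ∈ᵥ t r

    mapCycle : ∀ {P Q : Triple N → Set} → (∀ {t} → P t → Q t) → CycleOf P → CycleOf Q
    mapCycle f C = record
      { m = C.m ; a = C.a ; t = C.t ; a-inj = C.a-inj ; t-inj = C.t-inj
      ; t∈P = λ r → f (C.t∈P r) ; a∈t = C.a∈t ; a'∈t = C.a'∈t }
      where module C = CycleOf C

    data WalkOf (P : Triple N → Set) : Fin N → Fin N → Set where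
      here : ∀ {u} → WalkOf P u u
      step : ∀ {u w v} (t : Triple N) → P t → u ∈ᵥ t → w ∈ᵥ t → WalkOf P w v → WalkOf P u v

    mapWalk : ∀ {P Q : Triple N → Set} → (∀ {t} → P t → Q t) → ∀ {u v} → WalkOf P u v → WalkOf Q u v
    mapWalk f here             = here
    mapWalk f (step t p x y w) = step t (f p) x y (mapWalk f w)

    _⊙_ : ∀ {P : Triple N → Set} {u v w} → WalkOf P u v → WalkOf P v w → WalkOf P u w
    here            ⊙ w′ = w′
    step t p x y w  ⊙ w′ = step t p x y (w ⊙ w′)

    reverse : ∀ {P : Triple N → Set} {u v} → WalkOf P u v → WalkOf P v u
    reverse here             = here
    reverse (step t p x y w) = reverse w ⊙ step t p y x here

    -- A path is stored as its departures, each vertex with the triple by which it is left. The end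
    -- vertex has no departure and is appended.
    Vertices : Fin N → List (Fin N × Triple N) → List (Fin N)
    Vertices v L = List.map proj₁ L ∷ʳ v

    data SimplePath (P : Triple N → Set) (v : Fin N) : Fin N → List (Fin N × Triple N) → Set where
      nil  : SimplePath P v v []
      cons : ∀ {u w L} (t : Triple N) → P t → u ∈ᵥ t → w ∈ᵥ t →
        u ∉ Vertices v L → t ∉ List.map proj₂ L → SimplePath P v w L → SimplePath P v u ((u , t) ∷ L)

    module _ {P : Triple N → Set} {v : Fin N} where

      suffix : ∀ {u w L} → SimplePath P v w L → u ∈ Vertices v L → ∃ λ L′ → SimplePath P v u L′
      suffix nil                      (here refl) = [] , nil
      suffix π@(cons t p x y u∉ t∉ r) (here refl) = _ , π
      suffix (cons t p x y u∉ t∉ r)   (there q)   = suffix r q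

      -- If the triple at u is used again later, u can take over that later step and everything in
      -- between is skipped. This removes repeated triples, as `suffix` removes repeated vertices.
      shortcut : ∀ {u w L t} → SimplePath P v w L → t ∈ List.map proj₂ L → u ∉ Vertices v L → u ∈ᵥ t →
        ∃ λ L′ → SimplePath P v u L′
      shortcut (cons t p x y _ t∉ r) (here refl) u∉ u∈t = _ , cons t p u∈t y (u∉ ∘ there) t∉ r
      shortcut (cons t p x y _ t∉ r) (there q)   u∉ u∈t = shortcut r q (u∉ ∘ there) u∈t

      simplify : ∀ {u} → WalkOf P u v → ∃ λ L → SimplePath P v u L
      simplify here = [] , nil
      simplify (step {u} t p x y w) with simplify w
      ... | L , π with any? (u FinP.≟_) (Vertices v L)
      ... | yes q = suffix π q
      ... | no  u∉ with any? (t ≟ₜ_) (List.map proj₂ L)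
      ... | yes q = shortcut π q u∉ x
      ... | no t∉ = _ , cons t p x y u∉ t∉ π

      triples-satisfy : ∀ {u L} → SimplePath P v u L → All P (List.map proj₂ L)
      triples-satisfy nil                    = []
      triples-satisfy (cons t p _ _ _ _ π) = p ∷ triples-satisfy π

    -- The vertex `z` is where the last triple must lead; a list closes up to a cycle when `z` is
    -- its own first vertex.
    Links : (Triple N → Set) → Fin N → List (Fin N × Triple N) → Set
    Links P z []            = ⊤
    Links P z ((a , t) ∷ L) = P t × a ∈ᵥ t × headOr z (List.map proj₁ L) ∈ᵥ t × Links P z L

    module _ {P : Triple N → Set} {z : Fin N} where

      links-lookup : ∀ L → Links P z L → (r : Fin (length L)) →
        P (proj₂ (lookup L r)) × proj₁ (lookup L r) ∈ᵥ proj₂ (lookup L r)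
      links-lookup (x ∷ L) (p , q , _ , h) zero    = p , q
      links-lookup (x ∷ L) (p , q , _ , h) (suc r) = links-lookup L h r

      links-next : ∀ L → Links P z L → (r r′ : Fin (length L)) → toℕ r′ ≡ suc (toℕ r) →
        proj₁ (lookup L r′) ∈ᵥ proj₂ (lookup L r)
      links-next (x ∷ y ∷ L) (_ , _ , q , h) zero    (suc zero) e = q
      links-next (x ∷ L)     (_ , _ , q , h) (suc r) (suc r′)   e = links-next L h r r′ (ℕP.suc-injective e)

      links-last : ∀ x L → Links P z (x ∷ L) → (r : Fin (suc (length L))) → toℕ r ≡ length L →
        z ∈ᵥ proj₂ (lookup (x ∷ L) r)
      links-last x []      (_ , _ , q , h) zero    e = q
      links-last x (y ∷ L) (_ , _ , q , h) (suc r) e = links-last y L h r (ℕP.suc-injective e)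

    closedChain : ∀ {P : Triple N → Set} x y L → Unique (List.map proj₁ (x ∷ y ∷ L)) →
      Unique (List.map proj₂ (x ∷ y ∷ L)) → Links P (proj₁ x) (x ∷ y ∷ L) → CycleOf P
    closedChain {P} x y L u₁ u₂ h = record
      { m = length L ; a = proj₁ ∘ lookup C ; t = proj₂ ∘ lookup C
      ; a-inj = unique-lookup proj₁ C u₁ ; t-inj = unique-lookup proj₂ C u₂
      ; t∈P = λ r → proj₁ (links-lookup C h r) ; a∈t = λ r → proj₂ (links-lookup C h r) ; a'∈t = closed }
      where
      C = x ∷ y ∷ L
      closed : ∀ r → proj₁ (lookup C (next r)) ∈ᵥ proj₂ (lookup C r)
      closed r with next-cases r
      ... | inj₂ e = links-next C h r (next r) e
      ... | inj₁ (e , e′) = subst (λ s → proj₁ (lookup C s) ∈ᵥ proj₂ (lookup C r)) (sym e′) (links-last x (y ∷ L) h r e)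

    simple-vertices : ∀ {P : Triple N → Set} {v u L} → SimplePath P v u L → Unique (Vertices v L)
    simple-vertices nil = [] ∷ []
    simple-vertices (cons t p x y u∉ t∉ π) = AllP.¬Any⇒All¬ _ u∉ ∷ simple-vertices π

    simple-triples : ∀ {P : Triple N → Set} {v u L t₀} → SimplePath P v u L → t₀ ∉ List.map proj₂ L →
      Unique (List.map proj₂ L ∷ʳ t₀)
    simple-triples nil _ = [] ∷ []
    simple-triples {t₀ = t₀} (cons {L = L} t p x y u∉ t∉ π) t₀∉ = AllP.¬Any⇒All¬ _ fresh ∷ simple-triples π (t₀∉ ∘ there)
      where
      fresh : t ∉ List.map proj₂ L ∷ʳ t₀
      fresh q with ∈-++⁻ (List.map proj₂ L) q
      ... | inj₁ q′          = t∉ q′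
      ... | inj₂ (here refl) = t₀∉ (here refl)

    start : ∀ {P : Triple N → Set} {v u L} t → SimplePath P v u L → headOr u (List.map proj₁ (L ∷ʳ (v , t))) ≡ u
    start t nil                  = refl
    start t (cons _ _ _ _ _ _ _) = refl

    simple-links : ∀ {P Q : Triple N → Set} {v u L t₀ z} → (∀ {t} → P t → Q t) → Q t₀ → v ∈ᵥ t₀ → z ∈ᵥ t₀ →
      SimplePath P v u L → Links Q z (L ∷ʳ (v , t₀))
    simple-links f q v∈ z∈ nil = q , v∈ , z∈ , tt
    simple-links {t₀ = t₀} {z} f q v∈ z∈ (cons {L = L} t p x y u∉ t∉ π) =
      f p , x , subst (_∈ᵥ t) (sym (trans (head-irrelevant L) (start t₀ π))) y , simple-links f q v∈ z∈ π
      where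
      head-irrelevant : ∀ L {a b w} → headOr a (List.map proj₁ (L ∷ʳ w)) ≡ headOr b (List.map proj₁ (L ∷ʳ w))
      head-irrelevant []      = refl
      head-irrelevant (_ ∷ _) = refl

    closedSnoc : ∀ {P : Triple N → Set} x L z → Unique (List.map proj₁ (x ∷ L ∷ʳ z)) →
      Unique (List.map proj₂ (x ∷ L ∷ʳ z)) → Links P (proj₁ x) (x ∷ L ∷ʳ z) → CycleOf P
    closedSnoc x []      z = closedChain x z []
    closedSnoc x (y ∷ L) z = closedChain x y (L ∷ʳ z)

    -- The triple t₀ closes a simple path from u to v. That t₀ violates P keeps it distinct from the
    -- triples of the path, and u ≢ v makes the path nonempty, so the cycle has length at least two.
    closeWalk : ∀ {P Q : Triple N → Set} {u v} t₀ → (∀ {t} → P t → Q t) → Q t₀ → ¬ P t₀ → u ≢ v →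
      u ∈ᵥ t₀ → v ∈ᵥ t₀ → WalkOf P u v → CycleOf Q
    closeWalk {v = v} t₀ f q ¬p u≢v u∈ v∈ w with simplify w
    ... | [] , nil = ⊥-elim (u≢v refl)
    ... | (x ∷ L) , π@(cons _ _ _ _ _ _ _) = closedSnoc x L (v , t₀)
      (subst Unique (sym (ListP.map-++ proj₁ (x ∷ L) ((v , t₀) ∷ []))) (simple-vertices π))
      (subst Unique (sym (ListP.map-++ proj₂ (x ∷ L) ((v , t₀) ∷ [])))
        (simple-triples π (λ m → ¬p (All.lookup (triples-satisfy π) m))))
      (simple-links f q v∈ u∈ π)

open Cycles

-- Forests as cycle decompositions of the product permutation

module Forests where

  module _ {A : Set} where

    unique-resp-↭ : {xs ys : List A} → xs ↭ ys → Unique xs → Unique ys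
    unique-resp-↭ p = PermS.Unique-resp-↭ (setoid A) (Perm.↭⇒↭ₛ p)

    ++-disjoint : ∀ xs {ys : List A} → Unique (xs ++ ys) → ∀ {x y} → x ∈ xs → y ∈ ys → x ≢ y
    ++-disjoint (x ∷ xs) (h ∷ u) (here refl) q = All.lookup h (∈-++⁺ʳ xs q)
    ++-disjoint (x ∷ xs) (h ∷ u) (there p)   q = ++-disjoint xs u p q

    unique-++ʳ : ∀ xs {ys : List A} → Unique (xs ++ ys) → Unique ys
    unique-++ʳ []       u       = u
    unique-++ʳ (x ∷ xs) (_ ∷ u) = unique-++ʳ xs u

    concat-↭ : {xss yss : List (List A)} → xss ↭ yss → concat xss ↭ concat yss
    concat-↭ Perm.refl         = ↭-refl
    concat-↭ (Perm.prep xs p)  = PermP.++⁺ˡ xs (concat-↭ p)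
    concat-↭ (Perm.swap {xss} {yss} xs ys p) = ↭-trans
      (↭-reflexive (sym (ListP.++-assoc xs ys (concat xss))))
      (↭-trans (PermP.++⁺ (PermP.++-comm xs ys) (concat-↭ p)) (↭-reflexive (ListP.++-assoc ys xs (concat yss))))
    concat-↭ (Perm.trans p p′) = ↭-trans (concat-↭ p) (concat-↭ p′)

    ∈-rotate : ∀ xs {ys : List A} {v} → v ∈ ys ++ xs → v ∈ xs ++ ys
    ∈-rotate xs {ys} q with ∈-++⁻ ys q
    ... | inj₁ q′ = ∈-++⁺ʳ xs q′
    ... | inj₂ q′ = ∈-++⁺ˡ q′

  module _ {V : Set} (π : V → V) where

    Chain : List V → V → Set
    Chain []       v = ⊤
    Chain (x ∷ xs) v = π x ≡ headOr v xs × Chain xs v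

    Cyclic : List V → Set
    Cyclic []       = ⊤
    Cyclic (x ∷ xs) = Chain (x ∷ xs) x

    chain-++ : ∀ xs {ys v} → Chain xs (headOr v ys) → Chain ys v → Chain (xs ++ ys) v
    chain-++ []           c        d = d
    chain-++ (x ∷ [])     (e , c)  d = e , d
    chain-++ (x ∷ y ∷ xs) (e , c)  d = e , chain-++ (y ∷ xs) c d

    chain-split : ∀ xs {ys v} → Chain (xs ++ ys) v → Chain xs (headOr v ys) × Chain ys v
    chain-split []           c       = tt , c
    chain-split (x ∷ [])     (e , c) = (e , tt) , c
    chain-split (x ∷ y ∷ xs) (e , c) = let c₁ , c₂ = chain-split (y ∷ xs) c in (e , c₁) , c₂

    cyclic-rotate : ∀ xs a ys → Cyclic (xs ++ a ∷ ys) → Cyclic ((a ∷ ys) ++ xs)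
    cyclic-rotate []       a ys c = subst (λ l → Chain l a) (cong (a ∷_) (sym (ListP.++-identityʳ ys))) c
    cyclic-rotate (x ∷ xs) a ys c = let c₁ , c₂ = chain-split (x ∷ xs) c in chain-++ (a ∷ ys) c₂ c₁

  module _ {N : ℕ} (a b c : Fin N) where

    cyc3-a : cyc3 a b c a ≡ b
    cyc3-a with a FinP.≟ a
    ... | yes _ = refl
    ... | no  e = ⊥-elim (e refl)

    cyc3-b : b ≢ a → cyc3 a b c b ≡ c
    cyc3-b b≢a with b FinP.≟ a | b FinP.≟ b
    ... | yes e | _     = ⊥-elim (b≢a e)
    ... | no _  | yes _ = refl
    ... | no _  | no e  = ⊥-elim (e refl)

    cyc3-c : c ≢ a → c ≢ b → cyc3 a b c c ≡ a
    cyc3-c c≢a c≢b with c FinP.≟ a | c FinP.≟ b | c FinP.≟ c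
    ... | yes e | _     | _     = ⊥-elim (c≢a e)
    ... | no _  | yes e | _     = ⊥-elim (c≢b e)
    ... | no _  | no _  | yes _ = refl
    ... | no _  | no _  | no e  = ⊥-elim (e refl)

    cyc3-fixed : ∀ {v} → v ≢ a → v ≢ b → v ≢ c → cyc3 a b c v ≡ v
    cyc3-fixed {v} v≢a v≢b v≢c with v FinP.≟ a | v FinP.≟ b | v FinP.≟ c
    ... | yes e | _     | _     = ⊥-elim (v≢a e)
    ... | no _  | yes e | _     = ⊥-elim (v≢b e)
    ... | no _  | no _  | yes e = ⊥-elim (v≢c e)
    ... | no _  | no _  | no _  = refl

    -- All arrows inside the word end in letters fixed by the 3-cycle, so only the closing arrow is
    -- redirected, from v to its image.
    chain-cyc3 : ∀ (π : Fin N → Fin N) x xs v → All (λ y → cyc3 a b c y ≡ y) xs →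
      Chain π (x ∷ xs) v → Chain (cyc3 a b c ∘ π) (x ∷ xs) (cyc3 a b c v)
    chain-cyc3 π x []       v []      (e , _) = cong (cyc3 a b c) e , tt
    chain-cyc3 π x (y ∷ ys) v (f ∷ h) (e , d) = trans (cong (cyc3 a b c) e) f , chain-cyc3 π y ys v h d

  module _ {M : ℕ} where

    private
      V = Fin (suc M)

    product : List (Triple (suc M)) → V → V
    product = foldr (λ t f → cyc3 (i t) (j t) (k t) ∘ f) id

    productΛ : List (Triple (suc M)) → Λ M
    productΛ = foldr (λ t x → q (i t) (j t) (k t) ⊛ x) 𝟙

    ClosedUnder : List (Triple (suc M)) → List V → Set
    ClosedUnder ts w = ∀ {t u v} → t ∈ ts → u ∈ᵥ t → v ∈ᵥ t → u ∈ w → v ∈ w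

    Connected : List (Triple (suc M)) → List V → Set
    Connected ts w = ∀ {u v} → u ∈ w → v ∈ w → WalkOf (_∈ ts) u v

    -- The words list the cycles of the permutation, which are the connected components of the forest ts.
    record Forest (ts : List (Triple (suc M))) (ws : List (List V)) : Set where
      field
        oddLengths : All OddLength ws
        partition  : concat ws ↭ allFin (suc M)
        cyclic     : All (Cyclic (product ts)) ws
        value      : productΛ ts ≡ wordsΛ ws
        size       : length ws ℕ.+ 2 ℕ.* length ts ≡ suc M
        connected  : All (Connected ts) ws
        closed     : All (ClosedUnder ts) ws
        acyclic    : ¬ CycleOf (_∈ ts)
    open Forest

    unique-words : ∀ {ts ws} → Forest ts ws → Unique (concat ws)
    unique-words F = unique-resp-↭ (↭-sym (partition F)) (UniqueP.allFin⁺ (suc M))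

    permute : ∀ {ts ws ws′} → ws ↭ ws′ → Forest ts ws → Forest ts ws′
    permute {ts} p F = record
      { oddLengths = PermP.All-resp-↭ p (oddLengths F)
      ; partition  = ↭-trans (↭-sym (concat-↭ p)) (partition F)
      ; cyclic     = PermP.All-resp-↭ p (cyclic F)
      ; value      = trans (value F) (wordsΛ-↭ (oddLengths F) p)
      ; size       = trans (cong (ℕ._+ 2 ℕ.* length ts) (sym (PermP.↭-length p))) (size F)
      ; connected  = PermP.All-resp-↭ p (connected F)
      ; closed     = PermP.All-resp-↭ p (closed F)
      ; acyclic    = acyclic F }

    rotate : ∀ {ts} xs a ys {ws} → Forest ts ((xs ++ a ∷ ys) ∷ ws) → Forest ts (((a ∷ ys) ++ xs) ∷ ws)
    rotate {ts} xs a ys {ws} F with oddLengths F | cyclic F | connected F | closed F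
    ... | o ∷ os | c ∷ cs | n ∷ ns | d ∷ ds = record
      { oddLengths = oddLength-++-comm xs (a ∷ ys) o ∷ os
      ; partition  = ↭-trans (PermP.++⁺ʳ (concat ws) (PermP.++-comm (a ∷ ys) xs)) (partition F)
      ; cyclic     = cyclic-rotate (product ts) xs a ys c ∷ cs
      ; value      = trans (value F) (cong (_⊛ wordsΛ ws) (wordΛ-rotate xs (a ∷ ys) o))
      ; size       = size F
      ; connected  = (λ u v → n (∈-rotate xs u) (∈-rotate xs v)) ∷ ns
      ; closed     = (λ t p r u → ∈-rotate (a ∷ ys) (d t p r (∈-rotate xs u))) ∷ ds
      ; acyclic    = acyclic F }

    -- Applied once per corner of a new triple, this produces three leading words that begin with
    -- the three corners, the shape needed for a merge.
    focus : ∀ {ts} pre {ws a} → Forest ts (pre ++ ws) → a ∈ concat ws → ∃ λ A → ∃ λ ws′ → Forest ts ((a ∷ A) ∷ pre ++ ws′)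
    focus pre {ws} F m with ∈-concat⁻′ ws m
    ... | w , a∈w , w∈ws with ∈-∃++ a∈w | ∈-∃++ w∈ws
    ... | xs , ys , refl | ws₁ , ws₂ , refl = ys ++ xs , ws₁ ++ ws₂ , rotate xs _ ys (permute front F)
      where
      front : pre ++ ws₁ ++ w ∷ ws₂ ↭ w ∷ pre ++ ws₁ ++ ws₂
      front = ↭-trans (↭-reflexive (sym (ListP.++-assoc pre ws₁ (w ∷ ws₂))))
        (↭-trans (PermP.shift w (pre ++ ws₁) ws₂) (↭-reflexive (cong (w ∷_) (ListP.++-assoc pre ws₁ ws₂))))

    everywhere : ∀ {ts ws} → Forest ts ws → ∀ v → v ∈ concat ws
    everywhere F v = PermP.∈-resp-↭ (↭-sym (partition F)) (∈-allFin v)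

    emptyForest : Forest [] (List.map [_] (allFin (suc M)))
    emptyForest = record
      { oddLengths = AllP.map⁺ (All.universal (λ _ → refl) vs)
      ; partition  = ↭-reflexive (ListP.concat-map-[ vs ])
      ; cyclic     = AllP.map⁺ (All.universal (λ _ → refl , tt) vs)
      ; value      = sym (ones vs)
      ; size       = trans (ℕP.+-identityʳ _) (trans (ListP.length-map [_] vs) (ListP.length-tabulate {n = suc M} id))
      ; connected  = AllP.map⁺ (All.universal (λ x → λ { (here refl) (here refl) → here }) vs)
      ; closed     = AllP.map⁺ (All.universal (λ x ()) vs)
      ; acyclic    = λ C → ¬∈[] (CycleOf.t∈P C zero) }
      where
      vs = allFin (suc M)
      ¬∈[] : ∀ {t : Triple (suc M)} → ¬ t ∈ []
      ¬∈[] ()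
      ones : ∀ xs → wordsΛ (List.map [_] xs) ≡ 𝟙
      ones []       = refl
      ones (x ∷ xs) = trans (⊛-identityˡ _) (ones xs)

    HasCycle : List (Triple (suc M)) → Set
    HasCycle ts = CycleOf (_∈ ts) × productΛ ts ≡ 𝟘

    closeCycle : ∀ {ts ws w t u v} → Forest ts ws → t ∉ ts → w ∈ ws → u ∈ w → v ∈ w → u ≢ v →
      u ∈ᵥ t → v ∈ᵥ t → CycleOf (_∈ (t ∷ ts))
    closeCycle {t = t} F t∉ w∈ u∈ v∈ u≢v u∈t v∈t =
      closeWalk t there (here refl) t∉ u≢v u∈t v∈t (All.lookup (connected F) w∈ u∈ v∈)

    module Merge {ts a A b B c C ws} (F : Forest ts ((a ∷ A) ∷ (b ∷ B) ∷ (c ∷ C) ∷ ws))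
                 (a<b : a Fin.< b) (b<c : b Fin.< c) where

      t : Triple (suc M)
      t = triple a b c a<b b<c

      merged : List V
      merged = (a ∷ A) ++ (b ∷ B) ++ (c ∷ C)

      U : Unique ((a ∷ A) ++ (b ∷ B) ++ (c ∷ C) ++ concat ws)
      U = unique-words F

      a#rest : ∀ {x y} → x ∈ a ∷ A → y ∈ (b ∷ B) ++ (c ∷ C) ++ concat ws → x ≢ y
      a#rest = ++-disjoint (a ∷ A) U

      b#rest : ∀ {x y} → x ∈ b ∷ B → y ∈ (c ∷ C) ++ concat ws → x ≢ y
      b#rest = ++-disjoint (b ∷ B) (unique-++ʳ (a ∷ A) U)

      c#rest : ∀ {x y} → x ∈ c ∷ C → y ∈ concat ws → x ≢ y
      c#rest = ++-disjoint (c ∷ C) (unique-++ʳ (b ∷ B) (unique-++ʳ (a ∷ A) U))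

      a#b : ∀ {x y} → x ∈ a ∷ A → y ∈ b ∷ B → x ≢ y
      a#b p p′ = a#rest p (∈-++⁺ˡ p′)

      a#c : ∀ {x y} → x ∈ a ∷ A → y ∈ c ∷ C → x ≢ y
      a#c p p′ = a#rest p (∈-++⁺ʳ (b ∷ B) (∈-++⁺ˡ p′))

      b#c : ∀ {x y} → x ∈ b ∷ B → y ∈ c ∷ C → x ≢ y
      b#c p p′ = b#rest p (∈-++⁺ˡ p′)

      a≢b : a ≢ b
      a≢b = a#b (here refl) (here refl)
      a≢c : a ≢ c
      a≢c = a#c (here refl) (here refl)
      b≢c : b ≢ c
      b≢c = b#c (here refl) (here refl)

      oddLengths′ : All OddLength (merged ∷ ws)
      oddLengths′ with oddLengths F
      ... | oa ∷ ob ∷ oc ∷ os = (begin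
        odd (length merged)
          ≡⟨ cong odd (trans (ListP.length-++ (a ∷ A)) (cong (length (a ∷ A) ℕ.+_) (ListP.length-++ (b ∷ B)))) ⟩
        odd (length (a ∷ A) ℕ.+ (length (b ∷ B) ℕ.+ length (c ∷ C)))
          ≡⟨ trans (odd-+ (length (a ∷ A)) _) (cong (odd (length (a ∷ A)) xor_) (odd-+ (length (b ∷ B)) (length (c ∷ C)))) ⟩
        odd (length (a ∷ A)) xor (odd (length (b ∷ B)) xor odd (length (c ∷ C)))
          ≡⟨ cong₂ _xor_ oa (cong₂ _xor_ ob oc) ⟩
        true ∎) ∷ os

      partition′ : concat (merged ∷ ws) ↭ allFin (suc M)
      partition′ = ↭-trans (↭-reflexive (trans (ListP.++-assoc (a ∷ A) _ _)
        (cong ((a ∷ A) ++_) (ListP.++-assoc (b ∷ B) (c ∷ C) (concat ws))))) (partition F)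

      σ : V → V
      σ = cyc3 a b c

      fixed : ∀ {v} → v ≢ a → v ≢ b → v ≢ c → σ v ≡ v
      fixed = cyc3-fixed a b c

      tail-≢ : ∀ {x : V} {xs} → Unique (x ∷ xs) → ∀ {y} → y ∈ xs → y ≢ x
      tail-≢ (h ∷ _) p e = All.lookup h p (sym e)

      unique-prefix : ∀ xs {ys : List V} → Unique (xs ++ ys) → Unique xs
      unique-prefix []       u       = []
      unique-prefix (x ∷ xs) (h ∷ u) = AllP.++⁻ˡ xs h ∷ unique-prefix xs u

      -- The last letter of `a ∷ A` used to return to a and is now sent to b; likewise the word of b
      -- ends by going to c, and that of c by going to a. Three closed words are spliced into one.
      merged-cyclic : ∀ {π} → Cyclic π (a ∷ A) → Cyclic π (b ∷ B) → Cyclic π (c ∷ C) → Cyclic (σ ∘ π) merged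
      merged-cyclic {π} ca cb cc =
        chain-++ (σ ∘ π) (a ∷ A) (subst (Chain (σ ∘ π) (a ∷ A)) (cyc3-a a b c) (chain-cyc3 a b c π a A a fixA ca))
          (chain-++ (σ ∘ π) (b ∷ B) (subst (Chain (σ ∘ π) (b ∷ B)) (cyc3-b a b c (a≢b ∘ sym)) (chain-cyc3 a b c π b B b fixB cb))
            (subst (Chain (σ ∘ π) (c ∷ C)) (cyc3-c a b c (a≢c ∘ sym) (b≢c ∘ sym)) (chain-cyc3 a b c π c C c fixC cc)))
        where
        fixA : All (λ y → σ y ≡ y) A
        fixA = All.tabulate λ p → fixed (tail-≢ (unique-prefix (a ∷ A) U) p) (a#b (there p) (here refl)) (a#c (there p) (here refl))
        fixB : All (λ y → σ y ≡ y) B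
        fixB = All.tabulate λ p → fixed (λ e → a#b (here refl) (there p) (sym e))
          (tail-≢ (unique-prefix (b ∷ B) (unique-++ʳ (a ∷ A) U)) p) (b#c (there p) (here refl))
        fixC : All (λ y → σ y ≡ y) C
        fixC = All.tabulate λ p → fixed (λ e → a#c (here refl) (there p) (sym e)) (λ e → b#c (here refl) (there p) (sym e))
          (tail-≢ (unique-prefix (c ∷ C) (unique-++ʳ (b ∷ B) (unique-++ʳ (a ∷ A) U))) p)

      other-fixed : ∀ {v} → v ∈ concat ws → σ v ≡ v
      other-fixed p = fixed (λ e → a#rest (here refl) (∈-++⁺ʳ (b ∷ B) (∈-++⁺ʳ (c ∷ C) p)) (sym e))
        (λ e → b#rest (here refl) (∈-++⁺ʳ (c ∷ C) p) (sym e)) (λ e → c#rest (here refl) p (sym e))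

      other-cyclic : ∀ {π} w → (∀ {v} → v ∈ w → σ v ≡ v) → Cyclic π w → Cyclic (σ ∘ π) w
      other-cyclic []       f d = tt
      other-cyclic {π} (x ∷ w) f d = subst (Chain (σ ∘ π) (x ∷ w)) (f (here refl))
        (chain-cyc3 a b c π x w x (All.tabulate (f ∘ there)) d)

      cyclic′ : All (Cyclic (product (t ∷ ts))) (merged ∷ ws)
      cyclic′ with cyclic F
      ... | ca ∷ cb ∷ cc ∷ cs = merged-cyclic ca cb cc ∷
        All.tabulate (λ {w} p → other-cyclic w (λ q → other-fixed (∈-concat⁺′ q p)) (All.lookup cs p))

      value′ : productΛ (t ∷ ts) ≡ wordsΛ (merged ∷ ws)
      value′ with oddLengths F
      ... | oa ∷ ob ∷ _ = begin
        q a b c ⊛ productΛ ts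
          ≡⟨ cong (q a b c ⊛_) (value F) ⟩
        q a b c ⊛ (wordΛ (a ∷ A) ⊛ (wordΛ (b ∷ B) ⊛ (wordΛ (c ∷ C) ⊛ wordsΛ ws)))
          ≡⟨ cong (λ x → q a b c ⊛ (wordΛ (a ∷ A) ⊛ x)) (⊛-assoc (wordΛ (b ∷ B)) (wordΛ (c ∷ C)) (wordsΛ ws)) ⟨
        q a b c ⊛ (wordΛ (a ∷ A) ⊛ (wordΛ (b ∷ B) ⊛ wordΛ (c ∷ C) ⊛ wordsΛ ws))
          ≡⟨ cong (q a b c ⊛_) (⊛-assoc (wordΛ (a ∷ A)) _ (wordsΛ ws)) ⟨
        q a b c ⊛ (wordΛ (a ∷ A) ⊛ (wordΛ (b ∷ B) ⊛ wordΛ (c ∷ C)) ⊛ wordsΛ ws)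
          ≡⟨ ⊛-assoc (q a b c) _ (wordsΛ ws) ⟨
        q a b c ⊛ (wordΛ (a ∷ A) ⊛ (wordΛ (b ∷ B) ⊛ wordΛ (c ∷ C))) ⊛ wordsΛ ws
          ≡⟨ cong (_⊛ wordsΛ ws) (wordΛ-merge a A b B c C oa ob) ⟨
        wordΛ merged ⊛ wordsΛ ws ∎

      size′ : length (merged ∷ ws) ℕ.+ 2 ℕ.* length (t ∷ ts) ≡ suc M
      size′ = trans (cong suc (trans (cong (length ws ℕ.+_) (2*suc (length ts)))
        (trans (ℕP.+-suc (length ws) _) (cong suc (ℕP.+-suc (length ws) _))))) (size F)

      connected′ : All (Connected (t ∷ ts)) (merged ∷ ws)
      connected′ with connected F
      ... | na ∷ nb ∷ nc ∷ ns = (λ u v → to-a u ⊙ reverse (to-a v)) ∷ All.tabulate (λ w∈ u v → mapWalk there (All.lookup ns w∈ u v))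
        where
        to-a : ∀ {v} → v ∈ merged → WalkOf (_∈ (t ∷ ts)) v a
        to-a p with ∈-++⁻ (a ∷ A) p
        ... | inj₁ p′ = mapWalk there (na p′ (here refl))
        ... | inj₂ p′ with ∈-++⁻ (b ∷ B) p′
        ... | inj₁ p″ = mapWalk there (nb p″ (here refl)) ⊙ step t (here refl) (inj₂ (inj₁ refl)) (inj₁ refl) here
        ... | inj₂ p″ = mapWalk there (nc p″ (here refl)) ⊙ step t (here refl) (inj₂ (inj₂ refl)) (inj₁ refl) here

      ∈ᵥ⇒∈merged : ∀ {v} → v ∈ᵥ t → v ∈ merged
      ∈ᵥ⇒∈merged (inj₁ refl)        = here refl
      ∈ᵥ⇒∈merged (inj₂ (inj₁ refl)) = ∈-++⁺ʳ (a ∷ A) (here refl)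
      ∈ᵥ⇒∈merged (inj₂ (inj₂ refl)) = ∈-++⁺ʳ (a ∷ A) (∈-++⁺ʳ (b ∷ B) (here refl))

      closed′ : All (ClosedUnder (t ∷ ts)) (merged ∷ ws)
      closed′ with closed F
      ... | da ∷ db ∷ dc ∷ ds = merged-closed ∷ All.tabulate other-closed
        where
        merged-closed : ClosedUnder (t ∷ ts) merged
        merged-closed (here refl) u∈ v∈ _ = ∈ᵥ⇒∈merged v∈
        merged-closed (there m) u∈ v∈ p with ∈-++⁻ (a ∷ A) p
        ... | inj₁ p′ = ∈-++⁺ˡ (da m u∈ v∈ p′)
        ... | inj₂ p′ with ∈-++⁻ (b ∷ B) p′
        ... | inj₁ p″ = ∈-++⁺ʳ (a ∷ A) (∈-++⁺ˡ (db m u∈ v∈ p″))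
        ... | inj₂ p″ = ∈-++⁺ʳ (a ∷ A) (∈-++⁺ʳ (b ∷ B) (dc m u∈ v∈ p″))
        merged#ws : Unique (merged ++ concat ws)
        merged#ws = unique-resp-↭ (↭-sym partition′) (UniqueP.allFin⁺ (suc M))
        other-closed : ∀ {w} → w ∈ ws → ClosedUnder (t ∷ ts) w
        other-closed w∈ (here refl) u∈ v∈ p = ⊥-elim (++-disjoint merged merged#ws (∈ᵥ⇒∈merged u∈) (∈-concat⁺′ p w∈) refl)
        other-closed w∈ (there m)   u∈ v∈ p = All.lookup ds w∈ m u∈ v∈ p

      -- Before t was added, its corners lay in three disjoint words, each closed under the old
      -- triples. The word of the first corner therefore serves as witness.
      separated : ∀ {u v} → u ≢ v → u ∈ᵥ t → v ∈ᵥ t → ∃ λ w → ClosedUnder ts w × u ∈ w × v ∉ w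
      separated u≢v u∈ v∈ with closed F
      separated u≢v (inj₁ refl)        (inj₁ refl)        | _ = ⊥-elim (u≢v refl)
      separated u≢v (inj₁ refl)        (inj₂ (inj₁ refl)) | da ∷ _ = a ∷ A , da , here refl , λ p → a#b p (here refl) refl
      separated u≢v (inj₁ refl)        (inj₂ (inj₂ refl)) | da ∷ _ = a ∷ A , da , here refl , λ p → a#c p (here refl) refl
      separated u≢v (inj₂ (inj₁ refl)) (inj₁ refl)        | _ ∷ db ∷ _ = b ∷ B , db , here refl , λ p → a#b (here refl) p refl
      separated u≢v (inj₂ (inj₁ refl)) (inj₂ (inj₁ refl)) | _ = ⊥-elim (u≢v refl)
      separated u≢v (inj₂ (inj₁ refl)) (inj₂ (inj₂ refl)) | _ ∷ db ∷ _ = b ∷ B , db , here refl , λ p → b#c p (here refl) refl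
      separated u≢v (inj₂ (inj₂ refl)) (inj₁ refl)        | _ ∷ _ ∷ dc ∷ _ = c ∷ C , dc , here refl , λ p → a#c (here refl) p refl
      separated u≢v (inj₂ (inj₂ refl)) (inj₂ (inj₁ refl)) | _ ∷ _ ∷ dc ∷ _ = c ∷ C , dc , here refl , λ p → b#c (here refl) p refl
      separated u≢v (inj₂ (inj₂ refl)) (inj₂ (inj₂ refl)) | _ = ⊥-elim (u≢v refl)

      -- A new cycle would use t, and the rest of it would join two vertices of t inside one old word.
      acyclic′ : ¬ CycleOf (_∈ (t ∷ ts))
      acyclic′ C = go (FinP.any? (λ r → C.t r ≟ₜ t))
        where
        module C = CycleOf C
        old : ∀ {s} → s ∈ t ∷ ts → s ≢ t → s ∈ ts
        old (here e)  s≢t = ⊥-elim (s≢t e)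
        old (there m) s≢t = m
        -- A cycle has at least two indices, so `next` has no fixed point.
        r≢next : ∀ (r : Fin (suc (suc C.m))) → C.a (next r) ≢ C.a r
        r≢next r e with C.a-inj e | next-cases r
        ... | e′ | inj₁ (p , p′) = ℕP.0≢1+n (trans (cong toℕ (trans (sym p′) e′)) p)
        ... | e′ | inj₂ p        = ℕP.1+n≢n (trans (sym p) (cong toℕ e′))
        go : Dec (∃ λ r → C.t r ≡ t) → ⊥
        go (no ¬p) = acyclic F (record
          { m = C.m ; a = C.a ; t = C.t ; a-inj = C.a-inj ; t-inj = C.t-inj
          ; t∈P = λ r → old (C.t∈P r) (λ e → ¬p (r , e)) ; a∈t = C.a∈t ; a'∈t = C.a'∈t })
        go (yes (r , e)) with separated (r≢next r) (subst (C.a (next r) ∈ᵥ_) e (C.a'∈t r)) (subst (C.a r ∈ᵥ_) e (C.a∈t r))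
        ... | w , d , p , ¬p = ¬p (around (λ x → C.a x ∈ w) r p
          (λ x x≢r → d (old (C.t∈P x) (λ e′ → x≢r (C.t-inj (trans e′ (sym e))))) (C.a∈t x) (C.a'∈t x)))

      mergedForest : Forest (t ∷ ts) (merged ∷ ws)
      mergedForest = record
        { oddLengths = oddLengths′ ; partition = partition′ ; cyclic = cyclic′ ; value = value′
        ; size = size′ ; connected = connected′ ; closed = closed′ ; acyclic = acyclic′ }

    elsewhere : ∀ {v : V} w {ws} → v ∈ concat (w ∷ ws) → v ∉ w → v ∈ concat ws
    elsewhere w m v∉ with ∈-++⁻ w m
    ... | inj₁ p = ⊥-elim (v∉ p)
    ... | inj₂ p = p

    -- Focusing on c, then b, then a leaves the words in the order that `Merge` expects. If two
    -- corners already share a word, the value of that word annihilates their difference, and q can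
    -- be written with that difference as a factor, so the product vanishes. A walk inside the word
    -- is then closed to a cycle by the new triple.
    addTriple : ∀ {ts ws} t → t ∉ ts → Forest ts ws → (∃ λ ws′ → Forest (t ∷ ts) ws′) ⊎ HasCycle (t ∷ ts)
    addTriple {ts} t@(triple a b c a<b b<c) t∉ F₀ with focus [] F₀ (everywhere F₀ c)
    ... | C , ws₁ , F₁ with any? (b FinP.≟_) (c ∷ C) | any? (a FinP.≟_) (c ∷ C)
    ... | yes p | _ = inj₂ (closeCycle F₁ t∉ (here refl) p (here refl) (FinP.<⇒≢ b<c) (inj₂ (inj₁ refl)) (inj₂ (inj₂ refl))
      , trans (cong (q a b c ⊛_) (value F₁)) (q-kills-bc a b c _ (wordsΛ-kills (oddLengths F₁) (here refl) p (here refl))))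
    ... | no _ | yes p = inj₂ (closeCycle F₁ t∉ (here refl) p (here refl) (FinP.<⇒≢ (FinP.<-trans a<b b<c)) (inj₁ refl) (inj₂ (inj₂ refl))
      , trans (cong (q a b c ⊛_) (value F₁)) (q-kills-ac a b c _ (wordsΛ-kills (oddLengths F₁) (here refl) p (here refl))))
    ... | no b∉ | no a∉ with focus ((c ∷ C) ∷ []) F₁ (elsewhere (c ∷ C) {ws₁} (everywhere F₁ b) b∉)
    ... | B , ws₂ , F₂ with any? (a FinP.≟_) (b ∷ B)
    ... | yes p = inj₂ (closeCycle F₂ t∉ (here refl) p (here refl) (FinP.<⇒≢ a<b) (inj₁ refl) (inj₂ (inj₁ refl))
      , trans (cong (q a b c ⊛_) (value F₂)) (q-kills-ab a b c _ (wordsΛ-kills (oddLengths F₂) (here refl) p (here refl))))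
    ... | no a∉′ with focus ((b ∷ B) ∷ (c ∷ C) ∷ []) F₂
                      (elsewhere (c ∷ C) {ws₂} (elsewhere (b ∷ B) {(c ∷ C) ∷ ws₂} (everywhere F₂ a) a∉′) a∉)
    ... | A , ws₃ , F₃ = inj₁ (_ , Merge.mergedForest F₃ a<b b<c)

    forestOrCycle : ∀ ts → Unique ts → (∃ λ ws → Forest ts ws) ⊎ HasCycle ts
    forestOrCycle []       _       = inj₁ (_ , emptyForest)
    forestOrCycle (t ∷ ts) (h ∷ u) with forestOrCycle ts u
    ... | inj₁ (ws , F)  = addTriple t (λ m → All.lookup h m refl) F
    ... | inj₂ (C , e)   = inj₂ (mapCycle there C , trans (cong (q (i t) (j t) (k t) ⊛_) e) (⊛-zeroʳ _))

open Forests

-- Summation over all sets of triples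

module TripleSets where

  -- Folding over indices instead of a list makes the fold unfold in step with a vector indexed by
  -- the same `Fin n`.
  foldrFin : ∀ {X : Set} {n} → (Fin n → X → X) → X → X
  foldrFin {n = zero}  h e = e
  foldrFin {n = suc n} h e = h zero (foldrFin (h ∘ suc) e)

  foldrFin-≡ : ∀ {X : Set} {n} {h h′ : Fin n → X → X} → (∀ a x → h a x ≡ h′ a x) → ∀ e → foldrFin h e ≡ foldrFin h′ e
  foldrFin-≡ {n = zero}  e₁ e = refl
  foldrFin-≡ {n = suc n} {h} e₁ e = trans (cong (h zero) (foldrFin-≡ (e₁ ∘ suc) e)) (e₁ zero _)

  foldr-map-tabulate : ∀ {X Y : Set} {n} {A : Set} (h : Y → X → X) (g : A → Y) (f : Fin n → A) e →
    foldr h e (List.map g (tabulate f)) ≡ foldrFin (λ a → h (g (f a))) e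
  foldr-map-tabulate {n = zero}  h g f e = refl
  foldr-map-tabulate {n = suc n} h g f e = cong (h (g (f zero))) (foldr-map-tabulate h g (f ∘ suc) e)

  foldr-concatMap-tabulate : ∀ {X Y : Set} {n} {A : Set} (h : Y → X → X) (g : A → List Y) (f : Fin n → A) e →
    foldr h e (concatMap g (tabulate f)) ≡ foldrFin (λ a x → foldr h x (g (f a))) e
  foldr-concatMap-tabulate {n = zero}  h g f e = refl
  foldr-concatMap-tabulate {n = suc n} h g f e = trans (ListP.foldr-++ h e (g (f zero)) _)
    (cong (λ x → foldr h x (g (f zero))) (foldr-concatMap-tabulate h g (f ∘ suc) e))

  foldrFin₃ : ∀ {X : Set} {n} → (Fin n → Fin n → Fin n → X → X) → X → X
  foldrFin₃ h = foldrFin λ a → foldrFin λ b → foldrFin λ c → h a b c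

  foldr-allTriples : ∀ {X : Set} N (h : Fin N × Fin N × Fin N → X → X) e →
    foldr h e (allTriples N) ≡ foldrFin₃ (λ a b c → h (a , b , c)) e
  foldr-allTriples N h e = trans
    (foldr-concatMap-tabulate h (λ a → concatMap (λ b → List.map (λ c → (a , b , c)) (allFin N)) (allFin N)) id e)
    (foldrFin-≡ (λ a x → trans
      (foldr-concatMap-tabulate h (λ b → List.map (λ c → (a , b , c)) (allFin N)) id x)
      (foldrFin-≡ (λ b y → foldr-map-tabulate h (λ c → (a , b , c)) id y) x)) e)

  vectors : ∀ {A : Set} → List A → (n : ℕ) → List (Vec A n)
  vectors xs zero    = [] ∷ []
  vectors xs (suc n) = cartesianProductWith _∷_ xs (vectors xs n)

  vectors-unique : ∀ {A : Set} {xs : List A} → Unique xs → ∀ n → Unique (vectors xs n)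
  vectors-unique u zero    = [] ∷ []
  vectors-unique u (suc n) = UniqueP.cartesianProductWith⁺ _∷_ (λ { refl → refl , refl }) u (vectors-unique u n)

  vectors-complete : ∀ {A : Set} {xs : List A} → (∀ x → x ∈ xs) → ∀ {n} (v : Vec A n) → v ∈ vectors xs n
  vectors-complete h []      = here refl
  vectors-complete h (x ∷ v) = ∈-cartesianProductWith⁺ _∷_ (h x) (vectors-complete h v)

  bools : List Bool
  bools = true ∷ false ∷ []

  allTSets : ∀ N → List (TSet N)
  allTSets N = vectors (vectors (vectors bools N) N) N

  allTSets-unique : ∀ N → Unique (allTSets N)
  allTSets-unique N = vectors-unique (vectors-unique (vectors-unique (((λ ()) ∷ []) ∷ [] ∷ []) N) N) N

  allTSets-complete : ∀ {N} (S : TSet N) → S ∈ allTSets N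
  allTSets-complete = vectors-complete (vectors-complete (vectors-complete λ { true → here refl ; false → there (here refl) }))

  -- The index is the number of triples chosen.
  Series : ℕ → Set
  Series m = ℕ → Λ m

  module _ {m : ℕ} where

    ∑ᴸ : ∀ {A : Set} → List A → (A → Series m) → Series m
    ∑ᴸ xs f k = sum (List.map (λ x → f x k) xs)

    ∑ᴸ-cong : ∀ {A : Set} (xs : List A) {f g : A → Series m} → (∀ x → f x ≗ g x) → ∑ᴸ xs f ≗ ∑ᴸ xs g
    ∑ᴸ-cong []       h k = refl
    ∑ᴸ-cong (x ∷ xs) h k = cong₂ _⊕_ (h x k) (∑ᴸ-cong xs h k)

    ∑ᴸ-++ : ∀ {A : Set} (xs ys : List A) (f : A → Series m) k → ∑ᴸ (xs ++ ys) f k ≡ ∑ᴸ xs f k ⊕ ∑ᴸ ys f k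
    ∑ᴸ-++ []       ys f k = sym (⊕-identityˡ _)
    ∑ᴸ-++ (x ∷ xs) ys f k = trans (cong (f x k ⊕_) (∑ᴸ-++ xs ys f k)) (sym (⊕-assoc (f x k) _ _))

    ∑ᴸ-cartesianProductWith : ∀ {A B C : Set} (c : A → B → C) xs ys (f : C → Series m) →
      ∑ᴸ (cartesianProductWith c xs ys) f ≗ ∑ᴸ xs (λ x → ∑ᴸ ys (λ y → f (c x y)))
    ∑ᴸ-cartesianProductWith c []       ys f k = refl
    ∑ᴸ-cartesianProductWith c (x ∷ xs) ys f k = trans (∑ᴸ-++ (List.map (c x) ys) _ f k)
      (cong₂ _⊕_ (cong sum (sym (ListP.map-∘ ys))) (∑ᴸ-cartesianProductWith c xs ys f k))

    -- What is needed to move an operator through a finite sum. Series are functions compared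
    -- pointwise, so compatibility with `≗` has to be carried along.
    record Additive (G : Series m → Series m) : Set where
      field
        respects : ∀ {f g} → f ≗ g → G f ≗ G g
        plus     : ∀ f g k → G (λ l → f l ⊕ g l) k ≡ G f k ⊕ G g k
        null     : ∀ k → G (λ _ → 𝟘) k ≡ 𝟘
    open Additive

    additive-∑ᴸ : ∀ {A : Set} {G} → Additive G → ∀ (xs : List A) f → ∑ᴸ xs (G ∘ f) ≗ G (∑ᴸ xs f)
    additive-∑ᴸ α []       f k = sym (null α k)
    additive-∑ᴸ {G = G} α (x ∷ xs) f k = trans (cong (G (f x) k ⊕_) (additive-∑ᴸ α xs f k)) (sym (plus α (f x) (∑ᴸ xs f) k))

    additive-foldrFin : ∀ {n} {h : Fin n → Series m → Series m} → (∀ i → Additive (h i)) → Additive (foldrFin h)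
    additive-foldrFin {zero}  α = record { respects = λ e → e ; plus = λ f g k → refl ; null = λ k → refl }
    additive-foldrFin {suc n} {h} α = record
      { respects = λ e → respects (α zero) (respects rest e)
      ; plus     = λ f g k → trans (respects (α zero) (plus rest f g) k) (plus (α zero) _ _ k)
      ; null     = λ k → trans (respects (α zero) (null rest) k) (null (α zero) k) }
      where
      rest : Additive (foldrFin (h ∘ suc))
      rest = additive-foldrFin (α ∘ suc)

    foldrFin-≗ : ∀ {n} {h h′ : Fin n → Series m → Series m} → (∀ i {f g} → f ≗ g → h i f ≗ h i g) →
      (∀ i f → h i f ≗ h′ i f) → ∀ f → foldrFin h f ≗ foldrFin h′ f
    foldrFin-≗ {zero}  c e f k = refl
    foldrFin-≗ {suc n} c e f k = trans (c zero (foldrFin-≗ (c ∘ suc) (e ∘ suc) f) k) (e zero _ k)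

    -- The distributive law for a product of sums, one coordinate at a time: additivity of the
    -- operator at the head lets the sum over all tails pass through it.
    ∑ᴸ-vectors : ∀ {A : Set} (xs : List A) n (op : Fin n → A → Series m → Series m) → (∀ i x → Additive (op i x)) → ∀ f →
      ∑ᴸ (vectors xs n) (λ v → foldrFin (λ i → op i (Vec.lookup v i)) f) ≗ foldrFin (λ i g → ∑ᴸ xs (λ x → op i x g)) f
    ∑ᴸ-vectors xs zero    op α f k = ⊕-identityʳ (f k)
    ∑ᴸ-vectors xs (suc n) op α f k = begin
      ∑ᴸ (vectors xs (suc n)) (λ v → foldrFin (λ i → op i (Vec.lookup v i)) f) k
        ≡⟨ ∑ᴸ-cartesianProductWith _∷_ xs (vectors xs n) (λ v → foldrFin (λ i → op i (Vec.lookup v i)) f) k ⟩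
      ∑ᴸ xs (λ x → ∑ᴸ (vectors xs n) (λ v → op zero x (foldrFin (λ i → op (suc i) (Vec.lookup v i)) f))) k
        ≡⟨ ∑ᴸ-cong xs (λ x → additive-∑ᴸ (α zero x) (vectors xs n) (λ v → foldrFin (λ i → op (suc i) (Vec.lookup v i)) f)) k ⟩
      ∑ᴸ xs (λ x → op zero x (∑ᴸ (vectors xs n) (λ v → foldrFin (λ i → op (suc i) (Vec.lookup v i)) f))) k
        ≡⟨ ∑ᴸ-cong xs (λ x → respects (α zero x) (∑ᴸ-vectors xs n (op ∘ suc) (α ∘ suc) f)) k ⟩
      ∑ᴸ xs (λ x → op zero x (foldrFin (λ i g → ∑ᴸ xs (λ x → op (suc i) x g)) f)) k ∎

    -- Multiplication by x z, where z is a formal variable that counts the chosen triples.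
    shift : Λ m → Series m → Series m
    shift x f zero    = 𝟘
    shift x f (suc k) = x ⊛ f k

    choose : Λ m → Bool → Series m → Series m
    choose x b f = if b then shift x f else f

    additive-choose : ∀ x b → Additive (choose x b)
    additive-choose x false = record { respects = λ e → e ; plus = λ f g k → refl ; null = λ k → refl }
    additive-choose x true  = record
      { respects = λ { e zero → refl ; e (suc k) → cong (x ⊛_) (e k) }
      ; plus     = λ { f g zero → sym (⊕-identityˡ 𝟘) ; f g (suc k) → ⊛-distribˡ x (f k) (g k) }
      ; null     = λ { zero → refl ; (suc k) → ⊛-zeroʳ x } }

    one : Series m
    one zero    = 𝟙
    one (suc k) = 𝟘

    ∑-choices : ∀ {N} (x : Fin N → Fin N → Fin N → Λ m) f →
      ∑ᴸ (allTSets N) (λ S → foldrFin₃ (λ a b c → choose (x a b c) (entry S a b c)) f) ≗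
      foldrFin₃ (λ a b c g → ∑ᴸ bools (λ z → choose (x a b c) z g)) f
    ∑-choices {N} x f k = begin
      ∑ᴸ (vectors planes N) (λ S → foldrFin (λ a → op₃ a (Vec.lookup S a)) f) k
        ≡⟨ ∑ᴸ-vectors planes N op₃ α₃ f k ⟩
      foldrFin (λ a g → ∑ᴸ planes (λ v → op₃ a v g)) f k
        ≡⟨ foldrFin-≗ (λ a e → ∑ᴸ-cong planes (λ v → respects (α₃ a v) e))
             (λ a g l → trans (∑ᴸ-vectors rows N (op₂ a) (α₂ a) g l)
               (foldrFin-≗ (λ b e → ∑ᴸ-cong rows (λ v → respects (α₂ a b v) e))
                 (λ b g′ → ∑ᴸ-vectors bools N (op₁ a b) (α₁ a b) g′) g l)) f k ⟩
      foldrFin₃ (λ a b c g → ∑ᴸ bools (λ z → choose (x a b c) z g)) f k ∎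
      where
      rows = vectors bools N
      planes = vectors rows N
      op₁ : Fin N → Fin N → Fin N → Bool → Series m → Series m
      op₁ a b c = choose (x a b c)
      op₂ : Fin N → Fin N → Vec Bool N → Series m → Series m
      op₂ a b v = foldrFin (λ c → op₁ a b c (Vec.lookup v c))
      op₃ : Fin N → Vec (Vec Bool N) N → Series m → Series m
      op₃ a v = foldrFin (λ b → op₂ a b (Vec.lookup v b))
      α₁ : ∀ a b c z → Additive (op₁ a b c z)
      α₁ a b c = additive-choose (x a b c)
      α₂ : ∀ a b v → Additive (op₂ a b v)
      α₂ a b v = additive-foldrFin (λ c → α₁ a b c (Vec.lookup v c))
      α₃ : ∀ a v → Additive (op₃ a v)
      α₃ a v = additive-foldrFin (λ b → α₂ a b (Vec.lookup v b))

    -- Summing over both choices multiplies by 1 + x z, and the coefficients of a product of such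
    -- factors are the elementary symmetric functions.
    esym-choices : ∀ {Y : Set} (x : Y → Λ m) ys →
      foldr (λ y g → ∑ᴸ bools (λ z → choose (x y) z g)) one ys ≗ esym (List.map x ys)
    esym-choices x []       zero    = refl
    esym-choices x []       (suc k) = refl
    esym-choices x (y ∷ ys) zero    = trans (⊕-identityˡ _) (trans (⊕-identityʳ _) (esym-choices x ys zero))
    esym-choices x (y ∷ ys) (suc k) = trans
      (cong₂ (λ s t → x y ⊛ s ⊕ (t ⊕ 𝟘)) (esym-choices x ys k) (esym-choices x ys (suc k)))
      (trans (cong (x y ⊛ esym (List.map x ys) k ⊕_) (⊕-identityʳ _)) (⊕-comm _ _))

    foldrFin-⊕ : ∀ {n} (x : Fin n → Λ m) e → foldrFin (λ a s → x a ⊕ s) e ≡ ∑ x ⊕ e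
    foldrFin-⊕ {zero}  x e = sym (⊕-identityˡ e)
    foldrFin-⊕ {suc n} x e = trans (cong (x zero ⊕_) (foldrFin-⊕ (x ∘ suc) e)) (sym (⊕-assoc (x zero) _ e))

    sum-allTriples : ∀ {N} (x : Fin N → Fin N → Fin N → Λ m) →
      sum (List.map (λ (a , b , c) → x a b c) (allTriples N)) ≡ ∑ (λ a → ∑ (λ b → ∑ (λ c → x a b c)))
    sum-allTriples {N} x = begin
      sum (List.map (λ (a , b , c) → x a b c) (allTriples N))
        ≡⟨ ListP.foldr-map _⊕_ (λ (a , b , c) → x a b c) 𝟘 (allTriples N) ⟩
      foldr (λ (a , b , c) s → x a b c ⊕ s) 𝟘 (allTriples N)
        ≡⟨ foldr-allTriples N (λ (a , b , c) s → x a b c ⊕ s) 𝟘 ⟩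
      foldrFin₃ (λ a b c s → x a b c ⊕ s) 𝟘
        ≡⟨ foldrFin-≡ (λ a s → trans (foldrFin-≡ (λ b s′ → foldrFin-⊕ (x a b) s′) s) (foldrFin-⊕ (λ b → ∑ (x a b)) s)) 𝟘 ⟩
      foldrFin (λ a s → ∑ (λ b → ∑ (x a b)) ⊕ s) 𝟘
        ≡⟨ trans (foldrFin-⊕ (λ a → ∑ (λ b → ∑ (x a b))) 𝟘) (⊕-identityʳ _) ⟩
      ∑ (λ a → ∑ (λ b → ∑ (λ c → x a b c))) ∎

  module _ {M : ℕ} where

    private
      N = suc M

    -- The zero outside a < b < c gives every ill-formed array weight zero, so the sum can run over
    -- all arrays.
    increasing-q : Fin N → Fin N → Fin N → Λ M
    increasing-q a b c = if lt₃ a b c then q a b c else 𝟘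

    weight : TSet N → List (Fin N × Fin N × Fin N) → Series M
    weight S = foldr (λ (a , b , c) → choose (increasing-q a b c) (entry S a b c)) one

    ∑-weight : ∀ k → ∑ᴸ (allTSets N) (λ S → weight S (allTriples N)) k ≡
      esym (List.map (λ (a , b , c) → increasing-q a b c) (allTriples N)) k
    ∑-weight k = begin
      ∑ᴸ (allTSets N) (λ S → weight S (allTriples N)) k
        ≡⟨ ∑ᴸ-cong (allTSets N) (λ S l → cong (λ f → f l)
             (foldr-allTriples N (λ (a , b , c) → choose (increasing-q a b c) (entry S a b c)) one)) k ⟩
      ∑ᴸ (allTSets N) (λ S → foldrFin₃ (λ a b c → choose (increasing-q a b c) (entry S a b c)) one) k
        ≡⟨ ∑-choices increasing-q one k ⟩
      foldrFin₃ (λ a b c g → ∑ᴸ bools (λ z → choose (increasing-q a b c) z g)) one k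
        ≡⟨ cong (λ f → f k) (foldr-allTriples N (λ (a , b , c) g → ∑ᴸ bools (λ z → choose (increasing-q a b c) z g)) one) ⟨
      foldr (λ (a , b , c) g → ∑ᴸ bools (λ z → choose (increasing-q a b c) z g)) one (allTriples N) k
        ≡⟨ esym-choices (λ (a , b , c) → increasing-q a b c) (allTriples N) k ⟩
      esym (List.map (λ (a , b , c) → increasing-q a b c) (allTriples N)) k ∎

    square-zero : ∀ (ps : List (Fin N × Fin N × Fin N)) → All SquareZero (List.map (λ (a , b , c) → increasing-q a b c) ps)
    square-zero []                 = []
    square-zero ((a , b , c) ∷ ps) = head (lt₃ a b c) ∷ square-zero ps
      where
      head : ∀ z → SquareZero (if z then q a b c else 𝟘)
      head true  = even-q a b c , q-square a b c
      head false = bar-constant (+ 0) , ⊛-zeroˡ 𝟘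

  top-∑-weight : ∀ n → let N = suc (2 ℕ.* suc n) in
    top (∑ᴸ (allTSets N) (λ S → weight S (allTriples N)) (suc n)) ≡ + (N ℕ.^ n)
  top-∑-weight n = trans (cong top (∑-weight {M} (suc n)))
    (top-esym n qs (square-zero {M} (allTriples (suc M))) (sum-allTriples {M} increasing-q))
    where
    M = 2 ℕ.* suc n
    qs : List (Λ M)
    qs = List.map (λ (a , b , c) → increasing-q a b c) (allTriples (suc M))

open TripleSets

-- From arrays to triple lists, and which arrays are spanning trees

module Trees where

  lt₃-true : ∀ {n} {a b c : Fin n} → a Fin.< b → b Fin.< c → lt₃ a b c ≡ true
  lt₃-true {a = zero}  {suc b} {suc c} p          (ℕ.s≤s q) = trans (sym (does-<? b c)) (dec-true (b Fin.<? c) q)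
  lt₃-true {a = suc a} {suc b} {suc c} (ℕ.s≤s p)  (ℕ.s≤s q) = lt₃-true p q

  lt-true⁻ : ∀ {n} {a b : Fin n} → lt a b ≡ true → a Fin.< b
  lt-true⁻ {a = zero}  {suc b} e = ℕ.s≤s ℕ.z≤n
  lt-true⁻ {a = suc a} {suc b} e = ℕ.s≤s (lt-true⁻ e)

  lt₃-true⁻ : ∀ {n} {a b c : Fin n} → lt₃ a b c ≡ true → a Fin.< b × b Fin.< c
  lt₃-true⁻ {a = zero}  {suc b} {suc c} e = ℕ.s≤s ℕ.z≤n , ℕ.s≤s (lt-true⁻ e)
  lt₃-true⁻ {a = suc a} {suc b} {suc c} e = let p , q = lt₃-true⁻ {a = a} {b} {c} e in ℕ.s≤s p , ℕ.s≤s q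

  cartesianProductWith-concatMap : ∀ {A B C : Set} (f : A → B → C) xs ys →
    cartesianProductWith f xs ys ≡ concatMap (λ x → List.map (f x) ys) xs
  cartesianProductWith-concatMap f []       ys = refl
  cartesianProductWith-concatMap f (x ∷ xs) ys = cong (List.map (f x) ys ++_) (cartesianProductWith-concatMap f xs ys)

  allTriples-product : ∀ N → allTriples N ≡ cartesianProduct (allFin N) (cartesianProduct (allFin N) (allFin N))
  allTriples-product N = sym (trans (cartesianProductWith-concatMap _,_ (allFin N) _)
    (ListP.concatMap-cong (λ a → trans (cong (List.map (a ,_)) (cartesianProductWith-concatMap _,_ (allFin N) (allFin N)))
      (trans (ListP.map-concatMap (a ,_) (λ b → List.map (b ,_) (allFin N)) (allFin N))
        (ListP.concatMap-cong (λ b → sym (ListP.map-∘ (allFin N))) (allFin N)))) (allFin N)))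

  allTriples-unique : ∀ N → Unique (allTriples N)
  allTriples-unique N = subst Unique (sym (allTriples-product N))
    (UniqueP.cartesianProduct⁺ (UniqueP.allFin⁺ N) (UniqueP.cartesianProduct⁺ (UniqueP.allFin⁺ N) (UniqueP.allFin⁺ N)))

  allTriples-complete : ∀ {N} (p : Fin N × Fin N × Fin N) → p ∈ allTriples N
  allTriples-complete {N} (a , b , c) = subst ((a , b , c) ∈_) (sym (allTriples-product N))
    (∈-cartesianProduct⁺ (∈-allFin a) (∈-cartesianProduct⁺ (∈-allFin b) (∈-allFin c)))

  if-app : ∀ {A B : Set} z {f g : A → B} x → (if z then f else g) x ≡ (if z then f x else g x)
  if-app true  x = refl
  if-app false x = refl

  module _ {N : ℕ} (S : TSet N) where

    corners : Triple N → Fin N × Fin N × Fin N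
    corners t = i t , j t , k t

    insert : Fin N → Fin N → Fin N → List (Triple N) → List (Triple N)
    insert a b c ts with entry S a b c | a Fin.<? b | b Fin.<? c
    ... | true | yes p | yes q = triple a b c p q ∷ ts
    ... | _    | _     | _     = ts

    triplesAmong : List (Fin N × Fin N × Fin N) → List (Triple N)
    triplesAmong = foldr (λ (a , b , c) → insert a b c) []

    Ordered : Fin N × Fin N × Fin N → Set
    Ordered (a , b , c) = entry S a b c ≡ true → lt₃ a b c ≡ true

    Disordered : Fin N × Fin N × Fin N → Set
    Disordered (a , b , c) = entry S a b c ≡ true × lt₃ a b c ≡ false

    insert-≡ : ∀ (t : Triple N) ts → t ∈ₜ S → insert (i t) (j t) (k t) ts ≡ t ∷ ts
    insert-≡ (triple a b c a<b b<c) ts e with entry S a b c | a Fin.<? b | b Fin.<? c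
    ... | true | yes p | yes q = cong (_∷ ts) (triple-≡ refl refl refl)
    ... | true | no ¬p | _     = ⊥-elim (¬p a<b)
    ... | true | yes _ | no ¬q = ⊥-elim (¬q b<c)

    ∈-insert⁻ : ∀ a b c ts {t} → t ∈ insert a b c ts → (t ∈ₜ S × corners t ≡ (a , b , c)) ⊎ t ∈ ts
    ∈-insert⁻ a b c ts m with entry S a b c in e | a Fin.<? b | b Fin.<? c
    ∈-insert⁻ a b c ts (here refl) | true  | yes p | yes q = inj₁ (e , refl)
    ∈-insert⁻ a b c ts (there m)   | true  | yes p | yes q = inj₂ m
    ∈-insert⁻ a b c ts m           | true  | yes p | no ¬q = inj₂ m
    ∈-insert⁻ a b c ts m           | true  | no ¬p | _     = inj₂ m
    ∈-insert⁻ a b c ts m           | false | _     | _     = inj₂ m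

    ∈-insert⁺ : ∀ a b c ts {t} → t ∈ ts → t ∈ insert a b c ts
    ∈-insert⁺ a b c ts m with entry S a b c | a Fin.<? b | b Fin.<? c
    ... | true  | yes p | yes q = there m
    ... | true  | yes p | no ¬q = m
    ... | true  | no ¬p | _     = m
    ... | false | _     | _     = m

    unique-insert : ∀ a b c ts → Unique ts → (∀ {t} → t ∈ ts → corners t ≢ (a , b , c)) → Unique (insert a b c ts)
    unique-insert a b c ts u fresh with entry S a b c | a Fin.<? b | b Fin.<? c
    ... | true  | yes p | yes q = All.tabulate (λ m e → fresh m (cong corners (sym e))) ∷ u
    ... | true  | yes p | no ¬q = u
    ... | true  | no ¬p | _     = u
    ... | false | _     | _     = u

    ∈-triplesAmong⁻ : ∀ ps {t} → t ∈ triplesAmong ps → t ∈ₜ S × corners t ∈ ps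
    ∈-triplesAmong⁻ ((a , b , c) ∷ ps) m with ∈-insert⁻ a b c (triplesAmong ps) m
    ... | inj₁ (p , e) = p , here e
    ... | inj₂ m′      = let p , q = ∈-triplesAmong⁻ ps m′ in p , there q

    ∈-triplesAmong⁺ : ∀ ps {t} → t ∈ₜ S → corners t ∈ ps → t ∈ triplesAmong ps
    ∈-triplesAmong⁺ (_ ∷ ps) {t} p (here refl) = subst (t ∈_) (sym (insert-≡ t (triplesAmong ps) p)) (here refl)
    ∈-triplesAmong⁺ ((a , b , c) ∷ ps) p (there m) = ∈-insert⁺ a b c (triplesAmong ps) (∈-triplesAmong⁺ ps p m)

    triplesAmong-unique : ∀ ps → Unique ps → Unique (triplesAmong ps)
    triplesAmong-unique []                 _       = []
    triplesAmong-unique ((a , b , c) ∷ ps) (h ∷ u) = unique-insert a b c (triplesAmong ps) (triplesAmong-unique ps u)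
      (λ m e → All.lookup h (proj₂ (∈-triplesAmong⁻ ps m)) (sym e))

    insert-ordered : ∀ a b c ts → Ordered (a , b , c) →
      (entry S a b c ≡ false × insert a b c ts ≡ ts) ⊎
      (∃ λ t → entry S a b c ≡ true × corners t ≡ (a , b , c) × insert a b c ts ≡ t ∷ ts)
    insert-ordered a b c ts o with entry S a b c in e | a Fin.<? b | b Fin.<? c
    ... | false | _     | _     = inj₁ (refl , refl)
    ... | true  | yes p | yes q = inj₂ (triple a b c p q , refl , refl , refl)
    ... | true  | no ¬p | _     = ⊥-elim (¬p (proj₁ (lt₃-true⁻ (o refl))))
    ... | true  | yes _ | no ¬q = ⊥-elim (¬q (proj₂ (lt₃-true⁻ {a = a} (o refl))))

    orderedness : (∀ p → Ordered p) ⊎ ∃ λ p → p ∈ allTriples N × Disordered p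
    orderedness with any? (λ { (a , b , c) → (entry S a b c BoolP.≟ true) ×-dec (lt₃ a b c BoolP.≟ false) }) (allTriples N)
    ... | yes m = inj₂ (find m)
    ... | no ¬m = inj₁ ordered
      where
      ordered : ∀ p → Ordered p
      ordered (a , b , c) e with lt₃ a b c in e′
      ... | true  = refl
      ... | false = ⊥-elim (¬m (lose (allTriples-complete (a , b , c)) (e , e′)))

  module _ {M : ℕ} (S : TSet (suc M)) where

    private
      N = suc M
      V = Fin N

    weight-disordered : ∀ ps {p} → p ∈ ps → Disordered S p → ∀ n → weight S ps n ≡ 𝟘
    weight-disordered ((a , b , c) ∷ ps) (here refl) (e , e′) n rewrite e | e′ = vanish n
      where
      vanish : ∀ n → shift 𝟘 (weight S ps) n ≡ 𝟘
      vanish zero    = refl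
      vanish (suc n) = ⊛-zeroˡ _
    weight-disordered ((a , b , c) ∷ ps) (there m) d n = keep (entry S a b c) n
      where
      keep : ∀ z n → choose (increasing-q a b c) z (weight S ps) n ≡ 𝟘
      keep false n       = weight-disordered ps m d n
      keep true  zero    = refl
      keep true  (suc n) = trans (cong (increasing-q a b c ⊛_) (weight-disordered ps m d n)) (⊛-zeroʳ _)

    -- Every true entry contributes one factor q z and every false entry the factor 1, so the series
    -- of a single array is a monomial whose exponent is the number of its triples.
    weight-ordered : (∀ p → Ordered S p) → ∀ ps → let ts = triplesAmong S ps in
      weight S ps (length ts) ≡ productΛ ts × (∀ n → n ≢ length ts → weight S ps n ≡ 𝟘)
    weight-ordered o [] = refl , λ { zero n≢0 → ⊥-elim (n≢0 refl) ; (suc n) _ → refl }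
    weight-ordered o ((a , b , c) ∷ ps) with insert-ordered S a b c (triplesAmong S ps) (o (a , b , c)) | weight-ordered o ps
    ... | inj₁ (e , e′) | ih rewrite e | e′ = ih
    ... | inj₂ (t , e , refl , e′) | ih₁ , ih₂ rewrite e | e′ | o (a , b , c) e =
      cong (q a b c ⊛_) ih₁ , λ { zero _ → refl ; (suc n) n≢ → trans (cong (q a b c ⊛_) (ih₂ n (n≢ ∘ cong suc))) (⊛-zeroʳ _) }

    -- The step function of `prodω₀` is local to its definition and cannot be named here, so it is
    -- replaced by any `h` with the same pointwise behaviour.
    foldr-product : (∀ p → Ordered S p) → (h : V × V × V → (V → V) → V → V) →
      (∀ p f v → h p f v ≡ (if entry S (proj₁ p) (proj₁ (proj₂ p)) (proj₂ (proj₂ p))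
                            then cyc3 (proj₁ p) (proj₁ (proj₂ p)) (proj₂ (proj₂ p)) (f v) else f v)) →
      ∀ ps v → foldr h id ps v ≡ product (triplesAmong S ps) v
    foldr-product o h hyp []                 v = refl
    foldr-product o h hyp ((a , b , c) ∷ ps) v with insert-ordered S a b c (triplesAmong S ps) (o (a , b , c))
      | hyp (a , b , c) (foldr h id ps) v | foldr-product o h hyp ps v
    ... | inj₁ (e , e′) | e₁ | ih rewrite e | e′ = trans e₁ ih
    ... | inj₂ (t , e , refl , e′) | e₁ | ih rewrite e | e′ = trans e₁ (cong (cyc3 a b c) ih)

    triples : List (Triple N)
    triples = triplesAmong S (allTriples N)

    prodω₀-product : (∀ p → Ordered S p) → ∀ v → prodω₀ S v ≡ product triples v
    prodω₀-product o = foldr-product o _ (λ p f v → if-app (entry S (proj₁ p) (proj₁ (proj₂ p)) (proj₂ (proj₂ p))) v) (allTriples N)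

    ∈-triples⁻ : ∀ {t} → t ∈ triples → t ∈ₜ S
    ∈-triples⁻ m = proj₁ (∈-triplesAmong⁻ S (allTriples N) m)

    ∈-triples⁺ : ∀ {t} → t ∈ₜ S → t ∈ triples
    ∈-triples⁺ e = ∈-triplesAmong⁺ S (allTriples N) e (allTriples-complete _)

    fromCycleOf : CycleOf (_∈ₜ S) → Cycle S
    fromCycleOf C = record
      { m = C.m ; a = C.a ; t = C.t ; a-inj = C.a-inj ; t-inj = C.t-inj
      ; t∈S = C.t∈P ; a∈t = C.a∈t ; a'∈t = C.a'∈t }
      where module C = CycleOf C

    toCycleOf : Cycle S → CycleOf (_∈ₜ S)
    toCycleOf C = record
      { m = C.m ; a = C.a ; t = C.t ; a-inj = C.a-inj ; t-inj = C.t-inj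
      ; t∈P = C.t∈S ; a∈t = C.a∈t ; a'∈t = C.a'∈t }
      where module C = Cycle C

    fromWalkOf : ∀ {u v} → WalkOf (_∈ₜ S) u v → Walk S u v
    fromWalkOf here             = here
    fromWalkOf (step t p x y w) = step t p x y (fromWalkOf w)

    toWalkOf : ∀ {u v} → Walk S u v → WalkOf (_∈ₜ S) u v
    toWalkOf here             = here
    toWalkOf (step t p x y w) = step t p x y (toWalkOf w)

    -- A walk to a different vertex must begin with a triple through u; covering is thereby reduced
    -- to connectedness.
    cover : (∀ u v → Walk S u v) → ∀ {u v : V} → u ≢ v → ∃ λ t → t ∈ₜ S × u ∈ᵥ t
    cover h {u} {v} u≢v with h u v
    ... | here           = ⊥-elim (u≢v refl)
    ... | step t p x _ _ = t , p , x

  iter-cong : ∀ {A : Set} {f g : A → A} → (∀ x → f x ≡ g x) → ∀ r x → iter f r x ≡ iter g r x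
  iter-cong e zero    x = refl
  iter-cong {g = g} e (suc r) x = trans (e _) (cong g (iter-cong e r x))

  -- Each letter is the image of the one before it, so the word is the orbit of its first letter.
  -- This identifies a word of the forest with `cycleWord`.
  chain-tabulate : ∀ {V : Set} (π : V → V) n x xs v → length (x ∷ xs) ≡ n → Chain π (x ∷ xs) v →
    x ∷ xs ≡ tabulate {n = n} (λ r → iter π (toℕ r) x)
  chain-tabulate π (suc zero)    x []       v e c = refl
  chain-tabulate π (suc (suc n)) x (y ∷ ys) v e (d , c) = cong (x ∷_) (trans (chain-tabulate π (suc n) y ys v (ℕP.suc-injective e) c)
    (ListP.tabulate-cong (λ r → trans (cong (iter π (toℕ r)) (sym d)) (iter-suc π (toℕ r) x))))

  module _ {M : ℕ} where

    private
      N = suc M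

    word-sign : ∀ (A : List (Fin N)) → zero ∷ A ↭ allFin N → top (∏vertex A) ≡ sign (listInversions (zero ∷ A))
    word-sign A p with PermP.↭-map-inv suc (↭-sym (PermP.drop-∷ (↭-trans p (↭-reflexive (allFin-suc M)))))
    ... | w , refl , p′ = begin
      top (∏vertex (List.map suc w))               ≡⟨ cong top (∏vertex-map-suc w) ⟩
      top (∏gen w)                                 ≡⟨ top-∏gen w (↭-sym p′) ⟩
      sign (listInversions w)                      ≡⟨ cong sign (listInversions-map-suc w) ⟨
      sign (listInversions (List.map suc w))       ≡⟨ cong (λ s → sign (s ℕ.+ listInversions (List.map suc w))) (smaller-zero (List.map suc w)) ⟨
      sign (listInversions (zero ∷ List.map suc w)) ∎

    stay : ∀ {ts : List (Triple N)} {w u v} → ClosedUnder ts w → WalkOf (_∈ ts) u v → u ∈ w → v ∈ w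
    stay c here             p = p
    stay c (step t m x y w) p = stay c w (c m x y p)

    -- Two readings of one word starting at vertex 0: its exterior element is a monomial whose top
    -- coefficient is the sign of the word, and as a cycle of the product permutation it is the word
    -- that defines `sgnω₀`.
    forest-sign : ∀ {S : TSet N} {ts A} → (∀ v → prodω₀ S v ≡ product ts v) → Forest ts ((zero ∷ A) ∷ []) →
      top (productΛ ts) ≡ sgnω₀ S
    forest-sign {S} {ts} {A} e F = begin
      top (productΛ ts)                          ≡⟨ cong top (trans (Forest.value F) (⊛-identityʳ _)) ⟩
      top (steps zero A)                         ≡⟨ cong top (steps-zero A) ⟩
      top (∏vertex A)                            ≡⟨ word-sign A p ⟩
      sign (listInversions (zero ∷ A))           ≡⟨ cong (sign ∘ listInversions) word ⟨
      sign (listInversions (tabulate (cycleWord S))) ≡⟨ signPerm-list (cycleWord S) ⟨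
      sgnω₀ S                                    ∎
      where
      p : zero ∷ A ↭ allFin N
      p = ↭-trans (↭-reflexive (sym (ListP.++-identityʳ (zero ∷ A)))) (Forest.partition F)
      word : tabulate (cycleWord S) ≡ zero ∷ A
      word = trans (ListP.tabulate-cong (λ r → iter-cong e (toℕ r) zero))
        (sym (chain-tabulate _ N zero A zero (trans (PermP.↭-length p) (ListP.length-tabulate {n = N} id)) (All.head (Forest.cyclic F))))

  Verdict : ∀ {M} → TSet (suc M) → Λ M → Set
  Verdict S z = (SpanningTree S × top z ≡ sgnω₀ S) ⊎ (¬ SpanningTree S × top z ≡ + 0)

  vanishing : ∀ {M} (S : TSet (suc M)) {z} → ¬ SpanningTree S → z ≡ 𝟘 → Verdict S z
  vanishing {M} S ¬T e = inj₂ (¬T , trans (cong top e) (top-𝟘 M))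

  module Analysis {M : ℕ} (n : ℕ) (M≡2n : M ≡ 2 ℕ.* n) (another : (v : Fin (suc M)) → ∃ λ u → v ≢ u)
    (S : TSet (suc M)) (ts : List (Triple (suc M)))
    (from : ∀ {t} → t ∈ ts → t ∈ₜ S) (to : ∀ {t} → t ∈ₜ S → t ∈ ts)
    (wellFormed : WellFormed S) (prodω₀≗ : ∀ v → prodω₀ S v ≡ product ts v) where

    cyclic : CycleOf (_∈ ts) → ¬ SpanningTree S
    cyclic C T = SpanningTree.acyclic T (fromCycleOf S (mapCycle from C))

    disconnected : ∀ {w w′ ws} → Forest ts (w ∷ w′ ∷ ws) → ¬ SpanningTree S
    disconnected {x ∷ xs} {y ∷ ys} F T = ++-disjoint (x ∷ xs) (unique-words F)
      (stay (All.head (Forest.closed F)) (mapWalk to (toWalkOf S (SpanningTree.connected T x y))) (here refl)) (here refl) refl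
    disconnected {x ∷ xs} {[]} F _ with Forest.oddLengths F
    ... | _ ∷ () ∷ _
    disconnected {[]} F _ with Forest.oddLengths F
    ... | () ∷ _

    tree : ∀ {w} → Forest ts (w ∷ []) → SpanningTree S
    tree {w} F = record
      { wellFormed = wellFormed
      ; acyclic    = λ C → Forest.acyclic F (mapCycle to (toCycleOf S C))
      ; covering   = λ v → cover S connect (proj₂ (another v))
      ; connected  = connect }
      where
      inside : ∀ v → v ∈ w
      inside v = subst (v ∈_) (ListP.++-identityʳ w) (everywhere F v)
      connect : ∀ u v → Walk S u v
      connect u v = fromWalkOf S (mapWalk from (All.head (Forest.connected F) (inside u) (inside v)))

    right-size : ∀ {w} → Forest ts (w ∷ []) → n ≡ length ts
    right-size F = ℕP.*-cancelˡ-≡ n (length ts) 2 (trans (sym M≡2n) (sym (ℕP.suc-injective (Forest.size F))))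

    -- Words plus twice the triples make 2n + 1, so n triples leave room for one word only.
    wrong-size : ∀ {w w′ ws} → Forest ts (w ∷ w′ ∷ ws) → n ≢ length ts
    wrong-size {ws = ws} F e = ℕP.m≢1+n+m (2 ℕ.* n) {length ws} (trans (sym M≡2n)
      (sym (trans (cong (λ l → suc (length ws) ℕ.+ 2 ℕ.* l) e) (ℕP.suc-injective (Forest.size F)))))

    focused : ∀ {A ws} z → Forest ts ((zero ∷ A) ∷ ws) →
      (n ≡ length ts → z ≡ productΛ ts) → (n ≢ length ts → z ≡ 𝟘) → Verdict S z
    focused {ws = []}     z F w₁ w₂ = inj₁ (tree F , trans (cong top (w₁ (right-size F))) (forest-sign {S = S} prodω₀≗ F))
    focused {ws = w ∷ ws} z F w₁ w₂ = vanishing S (disconnected F) (w₂ (wrong-size F))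

    -- The weight is kept abstract as `z`, known only through its value at the right number of
    -- triples and its vanishing at any other. A set with a cycle may have any size, hence the case
    -- split on the number of triples there.
    analyse : Unique ts → ∀ z → (n ≡ length ts → z ≡ productΛ ts) → (n ≢ length ts → z ≡ 𝟘) → Verdict S z
    analyse u z w₁ w₂ = [ forest , (λ (C , e) → vanishing S (cyclic C) (vanish e (n ℕ.≟ length ts))) ]′ (forestOrCycle ts u)
      where
      forest : (∃ λ ws → Forest ts ws) → Verdict S z
      forest (_ , F) = let _ , _ , F′ = focus [] F (everywhere F zero) in focused z F′ w₁ w₂
      vanish : productΛ ts ≡ 𝟘 → Dec (n ≡ length ts) → z ≡ 𝟘
      vanish e (yes e′) = trans (w₁ e′) e
      vanish e (no n≢)  = w₂ n≢

  disordered : ∀ {M} (S : TSet (suc M)) {p} → Disordered S p → ¬ SpanningTree S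
  disordered S {a , b , c} (e , e′) T with SpanningTree.wellFormed T a b c e
  ... | p , p′ with trans (sym (lt₃-true p p′)) e′
  ... | ()

  verdict : ∀ {M} n → M ≡ 2 ℕ.* n → ((v : Fin (suc M)) → ∃ λ u → v ≢ u) → (S : TSet (suc M)) →
    Verdict S (weight S (allTriples (suc M)) n)
  verdict {M} n M≡2n another S = [ ordered , (λ (p , m , d) → vanishing S (disordered S d) (weight-disordered S ps m d n)) ]′ (orderedness S)
    where
    ps : List (Fin (suc M) × Fin (suc M) × Fin (suc M))
    ps = allTriples (suc M)
    ordered : (∀ p → Ordered S p) → Verdict S (weight S ps n)
    ordered o = Analysis.analyse n M≡2n another S (triples S) (∈-triples⁻ S) (∈-triples⁺ S)
      (λ a b c e → lt₃-true⁻ (o (a , b , c) e)) (prodω₀-product S o)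
      (triplesAmong-unique S ps (allTriples-unique (suc M))) (weight S ps n)
      (λ e → trans (cong (weight S ps) e) (proj₁ (weight-ordered S o ps))) (proj₂ (weight-ordered S o ps) n)

open Trees

-- Comparison of the weighted sum with the given lists of trees

another : ∀ {m} (v : Fin (suc (suc m))) → ∃ λ u → v ≢ u
another zero    = suc zero , λ ()
another (suc v) = zero , λ ()

signPerm-cases : ∀ {N} (s : Fin N → Fin N) → signPerm s ≡ + 1 ⊎ signPerm s ≡ -[1+ 0 ]
signPerm-cases s with ⌊ (inversions s ℕ.% 2) ℕ.≟ 0 ⌋
... | true  = inj₁ refl
... | false = inj₂ refl

unique-set-↭ : ∀ {A : Set} {xs ys : List A} → Unique xs → Unique ys →
  (∀ {x} → x ∈ xs → x ∈ ys) → (∀ {x} → x ∈ ys → x ∈ xs) → xs ↭ ys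
unique-set-↭ {ys = []}     []      u f g = ↭-refl
unique-set-↭ {ys = y ∷ ys} []      u f g with g (here refl)
... | ()
unique-set-↭ {xs = x ∷ xs} (h ∷ u) v f g with ∈-∃++ (f (here refl))
... | ys₁ , ys₂ , refl with unique-resp-↭ (PermP.shift x ys₁ ys₂) v
... | h′ ∷ v′ = ↭-trans (Perm.prep x (unique-set-↭ u v′ f′ g′)) (↭-sym (PermP.shift x ys₁ ys₂))
  where
  f′ : ∀ {z} → z ∈ xs → z ∈ ys₁ ++ ys₂
  f′ m with PermP.∈-resp-↭ (PermP.shift x ys₁ ys₂) (f (there m))
  ... | here refl = ⊥-elim (All.lookup h m refl)
  ... | there m′  = m′
  g′ : ∀ {z} → z ∈ ys₁ ++ ys₂ → z ∈ xs
  g′ m with g (PermP.∈-resp-↭ (↭-sym (PermP.shift x ys₁ ys₂)) (there m))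
  ... | here refl = ⊥-elim (All.lookup h′ m refl)
  ... | there m′  = m′

module _ {A : Set} (f : A → ℤ) where

  ∑ℤ : List A → ℤ
  ∑ℤ []       = + 0
  ∑ℤ (x ∷ xs) = f x ℤ.+ ∑ℤ xs

  ∑ℤ-++ : ∀ xs ys → ∑ℤ (xs ++ ys) ≡ ∑ℤ xs ℤ.+ ∑ℤ ys
  ∑ℤ-++ []       ys = sym (ℤP.+-identityˡ _)
  ∑ℤ-++ (x ∷ xs) ys = trans (cong (λ z → f x ℤ.+ z) (∑ℤ-++ xs ys)) (sym (ℤP.+-assoc (f x) _ _))

  ∑ℤ-↭ : ∀ {xs ys} → xs ↭ ys → ∑ℤ xs ≡ ∑ℤ ys
  ∑ℤ-↭ Perm.refl                    = refl
  ∑ℤ-↭ (Perm.prep x p)              = cong (λ z → f x ℤ.+ z) (∑ℤ-↭ p)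
  ∑ℤ-↭ (Perm.swap {xs} {ys} x y p)  = begin
    f x ℤ.+ (f y ℤ.+ ∑ℤ xs)  ≡⟨ ℤP.+-assoc (f x) (f y) _ ⟨
    f x ℤ.+ f y ℤ.+ ∑ℤ xs    ≡⟨ cong₂ ℤ._+_ (ℤP.+-comm (f x) (f y)) (∑ℤ-↭ p) ⟩
    f y ℤ.+ f x ℤ.+ ∑ℤ ys    ≡⟨ ℤP.+-assoc (f y) (f x) _ ⟩
    f y ℤ.+ (f x ℤ.+ ∑ℤ ys)  ∎
  ∑ℤ-↭ (Perm.trans p p′)            = trans (∑ℤ-↭ p) (∑ℤ-↭ p′)

  nonzero? : ∀ x → Dec (f x ≢ + 0)
  nonzero? x = ¬? (f x ℤ.≟ + 0)

  ∑ℤ-filter : ∀ xs → ∑ℤ xs ≡ ∑ℤ (filter nonzero? xs)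
  ∑ℤ-filter [] = refl
  ∑ℤ-filter (x ∷ xs) with f x ℤ.≟ + 0
  ... | yes e = trans (cong₂ ℤ._+_ e (∑ℤ-filter xs)) (ℤP.+-identityˡ _)
  ... | no _  = cong (λ z → f x ℤ.+ z) (∑ℤ-filter xs)

  -- Discarding the zero terms leaves a list without repetitions that has the same members as ys,
  -- hence a permutation of it.
  ∑ℤ-support : ∀ {xs ys} → Unique xs → Unique ys → (∀ x → x ∈ xs) →
    (∀ {x} → f x ≢ + 0 → x ∈ ys) → (∀ {x} → x ∈ ys → f x ≢ + 0) → ∑ℤ xs ≡ ∑ℤ ys
  ∑ℤ-support {xs} u v complete into nonzero = trans (∑ℤ-filter xs) (∑ℤ-↭ (unique-set-↭
    (UniqueP.filter⁺ nonzero? u) v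
    (λ m → into (proj₂ (∈-filter⁻ nonzero? {xs = xs} m)))
    (λ m → ∈-filter⁺ nonzero? (complete _) (nonzero m))))

  ∑ℤ-+1 : ∀ xs → (∀ {x} → x ∈ xs → f x ≡ + 1) → ∑ℤ xs ≡ + length xs
  ∑ℤ-+1 []       h = refl
  ∑ℤ-+1 (x ∷ xs) h = cong₂ ℤ._+_ (h (here refl)) (∑ℤ-+1 xs (λ m → h (there m)))

  ∑ℤ--1 : ∀ xs → (∀ {x} → x ∈ xs → f x ≡ -[1+ 0 ]) → ∑ℤ xs ≡ ℤ.- + length xs
  ∑ℤ--1 []       h = refl
  ∑ℤ--1 (x ∷ xs) h = trans (cong₂ ℤ._+_ (h (here refl)) (∑ℤ--1 xs (λ m → h (there m)))) (sym (ℤP.neg-distrib-+ (+ 1) (+ length xs)))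

top-∑ᴸ : ∀ {A : Set} {m} (f : A → Series m) k xs → top (∑ᴸ xs f k) ≡ ∑ℤ (λ x → top (f x k)) xs
top-∑ᴸ {m = m} f k []       = top-𝟘 m
top-∑ᴸ f k (x ∷ xs) = trans (top-⊕ (f x k) (∑ᴸ xs f k)) (cong (λ z → top (f x k) ℤ.+ z) (top-∑ᴸ f k xs))

-- The support of f is exactly the set of trees. Since every sign is 1 or -1, it splits into the two
-- given lists, which are disjoint because f takes different values on them.
signedCount : ∀ {A : Set} (P : A → Set) (sgn f : A → ℤ) → (∀ x → sgn x ≡ + 1 ⊎ sgn x ≡ -[1+ 0 ]) →
  (∀ x → (P x × f x ≡ sgn x) ⊎ (¬ P x × f x ≡ + 0)) →
  {all : List A} → Unique all → (∀ x → x ∈ all) →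
  (Tplus Tminus : List A) → Unique Tplus → Unique Tminus →
  (∀ x → (x ∈ Tplus) ⇔ (P x × sgn x ≡ + 1)) →
  (∀ x → (x ∈ Tminus) ⇔ (P x × sgn x ≡ -[1+ 0 ])) →
  ∑ℤ f all ≡ + length Tplus - + length Tminus
signedCount P sgn f sgn-cases cases {all} u complete Tplus Tminus u⁺ u⁻ h⁺ h⁻ = begin
  ∑ℤ f all                       ≡⟨ ∑ℤ-support f u (UniqueP.++⁺ u⁺ u⁻ disjoint) complete into nonzero ⟩
  ∑ℤ f (Tplus ++ Tminus)         ≡⟨ ∑ℤ-++ f Tplus Tminus ⟩
  ∑ℤ f Tplus ℤ.+ ∑ℤ f Tminus     ≡⟨ cong₂ ℤ._+_ (∑ℤ-+1 f Tplus value⁺) (∑ℤ--1 f Tminus value⁻) ⟩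
  + length Tplus - + length Tminus ∎
  where
  value : ∀ {S} → P S → f S ≡ sgn S
  value {S} T with cases S
  ... | inj₁ (_ , e)  = e
  ... | inj₂ (¬T , _) = ⊥-elim (¬T T)
  value⁺ : ∀ {S} → S ∈ Tplus → f S ≡ + 1
  value⁺ {S} m = let T , e = Equivalence.to (h⁺ S) m in trans (value T) e
  value⁻ : ∀ {S} → S ∈ Tminus → f S ≡ -[1+ 0 ]
  value⁻ {S} m = let T , e = Equivalence.to (h⁻ S) m in trans (value T) e
  disjoint : ∀ {S} → ¬ (S ∈ Tplus × S ∈ Tminus)
  disjoint (m⁺ , m⁻) with trans (sym (value⁺ m⁺)) (value⁻ m⁻)
  ... | ()
  nonzero : ∀ {S} → S ∈ Tplus ++ Tminus → f S ≢ + 0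
  nonzero m e with ∈-++⁻ Tplus m
  ... | inj₁ m⁺ with () ← trans (sym (value⁺ m⁺)) e
  ... | inj₂ m⁻ with () ← trans (sym (value⁻ m⁻)) e
  classify : ∀ {S} → P S → sgn S ≡ + 1 ⊎ sgn S ≡ -[1+ 0 ] → S ∈ Tplus ++ Tminus
  classify {S} T (inj₁ e) = ∈-++⁺ˡ (Equivalence.from (h⁺ S) (T , e))
  classify {S} T (inj₂ e) = ∈-++⁺ʳ Tplus (Equivalence.from (h⁻ S) (T , e))
  into : ∀ {S} → f S ≢ + 0 → S ∈ Tplus ++ Tminus
  into {S} f≢0 with cases S
  ... | inj₁ (T , _) = classify T (sgn-cases S)
  ... | inj₂ (_ , e) = ⊥-elim (f≢0 e)

theorem4p3 : (n : ℕ) → 1 ≤ n →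
    (Tplus Tminus : List (TSet (suc (2 * n)))) →
    Unique Tplus → Unique Tminus →
    (∀ S → (S ∈ Tplus) ⇔ (SpanningTree S × sgnω₀ S ≡ + 1)) →
    (∀ S → (S ∈ Tminus) ⇔ (SpanningTree S × sgnω₀ S ≡ -[1+ 0 ])) →
    + length Tplus - + length Tminus ≡ + ((suc (2 * n)) ^ (n ∸ 1))
-- From here `n` is the predecessor of the number of triples, so the exponent `suc n ∸ 1` is simply
-- `n`.
theorem4p3 (suc n) _ Tplus Tminus u⁺ u⁻ h⁺ h⁻ = trans
  (sym (signedCount SpanningTree sgnω₀ f (λ S → signPerm-cases (cycleWord S)) cases
    (allTSets-unique N) allTSets-complete Tplus Tminus u⁺ u⁻ h⁺ h⁻))
  (trans (sym (top-∑ᴸ (λ S → weight S (allTriples N)) (suc n) (allTSets N))) (top-∑-weight n))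
  where
  N : ℕ
  N = suc (2 * suc n)
  f : TSet N → ℤ
  f S = top (weight S (allTriples N) (suc n))
  cases : ∀ S → (SpanningTree S × f S ≡ sgnω₀ S) ⊎ (¬ SpanningTree S × f S ≡ + 0)
  cases S = verdict (suc n) refl another S
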